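{- For any $\varepsilon>0$, there exists an algorithm for the problem $BW^{\max}$ that, given any instance that has a feasible solution, outputs a set $S$ of items whose total value is at least the optimal value of $BW^{\max}$, such that $$(1-\varepsilon)\,l_i^w\le\sum_{j\in S\cap V_i}w_j^{(i)}\le(1+\varepsilon)\,u_i^w\qquad\text{for all }i\in[m],$$ and $$\sum_{i=1}^{m}\sum_{j\in S\cap V_i}w_j^{(i)}\le(1+\varepsilon)B.$$ The running time of the algorithm is $$O\!\left(\frac{n^2\,m\,\log^3 m\;\log_{1+\varepsilon}^{3}\!\left(\frac{B}{w_{\min}}\right)}{\varepsilon}\right),$$ where $w_{\min}=\min\{w_j^{(i)} : i\in[m],\ j\in V_i,\ w_j^{(i)}>0\}$.
   Context: Items are partitioned into $m$ categories; $V_i$ is the set of items of category $i\in[m]=\{1,\dots,m\}$. Item $j\in V_i$ has a non-negative weight $w_j^{(i)}$ and a non-negative value $v_j^{(i)}$ (rational numbers). At least one item has positive weight, so that $w_{\min}$ is defined. $n=\max_{i\in[m]}|V_i|$. Problem $BW^{\max}$: given the items, bounds $0\le l_i^w\le u_i^w$ for each $i\in[m]$, and a knapsack capacity $B$, find a subset $S\subseteq\bigcup_i V_i$ maximizing the total value $\sum_{i}\sum_{j\in S\cap V_i}v_j^{(i)}$ subject to $l_i^w\le\sum_{j\in S\cap V_i}w_j^{(i)}\le u_i^w$ for all $i\in[m]$ and $\sum_i\sum_{j\in S\cap V_i}w_j^{(i)}\le B$. A feasible solution is a subset satisfying all these constraints; the optimal value is the maximum total value of a feasible solution. Running time counts elementary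 operations (arithmetic, comparison, rounding) on numbers, each at unit cost. Inside the $O(\cdot)$, each logarithmic factor $x$ is read as $\max\{1,x\}$ (so that the bound is meaningful e.g. for $m=1$). -}

module Defs where

open import Data.Bool.Base using (Bool; true; false; if_then_else_; _∧_)
open import Data.Fin.Base using (Fin; toℕ; fromℕ<)
open import Data.Fin.Subset using (Subset)
open import Data.Integer.Base using (+_; ∣_∣)
open import Data.Nat.Base as ℕ using (ℕ; suc)
import Data.Nat.Properties as ℕ
open import Data.Product.Base using (∃-syntax; _×_)
open import Data.Rational.Base as ℚ
  using (ℚ; 0ℚ; 1ℚ; _+_; _-_; _*_; _÷_; _/_; _≤_; _<_; Positive; floor; ↥_; ↧ₙ_)
open import Data.Rational.Properties as ℚ using (+-0-monoid; pos⇒nonZero)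
open import Data.Vec.Base using (lookup; tabulate)
open import Data.Vec.Functional using (foldr)
open import Relation.Binary.PropositionalEquality.Core using (_≡_)
open import Relation.Nullary.Decidable.Core using (yes; no; does)

open import Algebra.Properties.Monoid.Sum +-0-monoid using (sum-syntax)
open import Algebra.Definitions.RawSemiring ℚ.+-*-rawSemiring using (_^_)

fromℕ : ℕ → ℚ
fromℕ k = + k / 1

------------------------------------------------------------------------
-- The problem BW^max

record Instance : Set where
  field
    m    : ℕ
    size : Fin m → ℕ
    w v  : (i : Fin m) → Fin (size i) → ℚ
    l u  : Fin m → ℚ
    B    : ℚ
    w≥0  : ∀ i j → 0ℚ ≤ w i j
    v≥0  : ∀ i j → 0ℚ ≤ v i j
    l≥0  : ∀ i → 0ℚ ≤ l i
    l≤u  : ∀ i → l i ≤ u i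
    some-w>0 : ∃[ i ] ∃[ j ] 0ℚ < w i j

  n : ℕ
  n = foldr ℕ._⊔_ 0 size

  -- A set of items, given by its part in each category.
  Selection : Set
  Selection = (i : Fin m) → Subset (size i)

  Σ∈ : ∀ {k} → Subset k → (Fin k → ℚ) → ℚ
  Σ∈ {k} S f = ∑[ j < k ] (if lookup S j then f j else 0ℚ)

  categoryWeight : Selection → Fin m → ℚ
  categoryWeight S i = Σ∈ (S i) (w i)

  totalWeight : Selection → ℚ
  totalWeight S = ∑[ i < m ] categoryWeight S i

  totalValue : Selection → ℚ
  totalValue S = ∑[ i < m ] Σ∈ (S i) (v i)

  record Feasible (S : Selection) : Set where
    field
      lower    : ∀ i → l i ≤ categoryWeight S i
      upper    : ∀ i → categoryWeight S i ≤ u i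
      capacity : totalWeight S ≤ B

  record IsOptimalValue (opt : ℚ) : Set where
    field
      attained : ∃[ S ] (Feasible S × totalValue S ≡ opt)
      maximal  : ∀ S → Feasible S → totalValue S ≤ opt

  record IsApproximateSolution (ε : ℚ) (S : Selection) : Set where
    field
      value    : ∀ opt → IsOptimalValue opt → opt ≤ totalValue S
      lower    : ∀ i → (1ℚ - ε) * l i ≤ categoryWeight S i
      upper    : ∀ i → categoryWeight S i ≤ (1ℚ + ε) * u i
      capacity : totalWeight S ≤ (1ℚ + ε) * B

  record IsMinPositiveWeight (wₘ : ℚ) : Set where
    field
      positive : Positive wₘ
      attained : ∃[ i ] ∃[ j ] w i j ≡ wₘ
      minimal  : ∀ i j → 0ℚ < w i j → wₘ ≤ w i j

------------------------------------------------------------------------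
-- Model of computation
--
-- Structured programs over a random-access memory whose cells hold exact
-- natural or rational numbers.  A program refers to finitely many arrays,
-- numbered by ℕ; every array is two-dimensional (a scalar is the entry
-- (0 , 0)), and its indices are computed at run time.  Every arithmetic
-- operation, comparison, rounding, constant, memory access and control
-- step costs one unit.

data Sort : Set where
  nat rat : Sort

Val : Sort → Set
Val nat = ℕ
Val rat = ℚ

infixl 7 _:*_ _:/_
infixl 6 _:+_ _:-_
infix  4 _:≤_ _:<_

data Exp : Sort → Set where
  lit   : ∀ {s} → Val s → Exp s
  read  : ∀ s (a : ℕ) (i j : Exp nat) → Exp s
  _:+_ _:-_ _:*_ : ∀ {s} → Exp s → Exp s → Exp s
  _:/_  : Exp rat → Exp rat → Exp rat
  round : Exp rat → Exp nat
  embed : Exp nat → Exp rat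

data Test : Set where
  _:≤_ _:<_ : ∀ {s} → Exp s → Exp s → Test

data Program : Set where
  skip  : Program
  write : ∀ s (a : ℕ) (i j : Exp nat) → Exp s → Program
  _⨾_   : Program → Program → Program
  If    : Test → Program → Program → Program
  While : Test → Program → Program

infixr 3 _⨾_

Memory : Set
Memory = ∀ s (a i j : ℕ) → Val s

update : Memory → ∀ s (a i j : ℕ) → Val s → Memory
update M nat a i j x nat a′ i′ j′ =
  if (a ℕ.≡ᵇ a′) ∧ (i ℕ.≡ᵇ i′) ∧ (j ℕ.≡ᵇ j′) then x else M nat a′ i′ j′
update M rat a i j x rat a′ i′ j′ =
  if (a ℕ.≡ᵇ a′) ∧ (i ℕ.≡ᵇ i′) ∧ (j ℕ.≡ᵇ j′) then x else M rat a′ i′ j′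
update M nat _ _ _ _ rat = M rat
update M rat _ _ _ _ nat = M nat

add sub mul : ∀ s → Val s → Val s → Val s
add nat = ℕ._+_
add rat = _+_
sub nat = ℕ._∸_
sub rat = _-_
mul nat = ℕ._*_
mul rat = _*_

-- Division by zero yields zero.
div : ℚ → ℚ → ℚ
div p q with q ℚ.≟ 0ℚ
... | yes _   = 0ℚ
... | no  q≢0 = (p ÷ q) {{ℚ.≢-nonZero q≢0}}

leq lt : ∀ s → Val s → Val s → Bool
leq nat x y = does (x ℕ.≤? y)
leq rat x y = does (x ℚ.≤? y)
lt  nat x y = does (x ℕ.<? y)
lt  rat x y = does (x ℚ.<? y)

eval : ∀ {s} → Exp s → Memory → Val s
eval         (lit x)        M = x
eval         (read s a i j) M = M s a (eval i M) (eval j M)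
eval {s}     (d :+ e)       M = add s (eval d M) (eval e M)
eval {s}     (d :- e)       M = sub s (eval d M) (eval e M)
eval {s}     (d :* e)       M = mul s (eval d M) (eval e M)
eval         (d :/ e)       M = div (eval d M) (eval e M)
-- The floor of a nonnegative number; ∣_∣ only matters below zero.
eval         (round e)      M = ∣ floor (eval e M) ∣
eval         (embed e)      M = fromℕ (eval e M)

evalTest : Test → Memory → Bool
evalTest (_:≤_ {s} d e) M = leq s (eval d M) (eval e M)
evalTest (_:<_ {s} d e) M = lt  s (eval d M) (eval e M)

cost : ∀ {s} → Exp s → ℕ
cost (lit _)        = 1
cost (read _ _ i j) = suc (cost i ℕ.+ cost j)
cost (d :+ e)       = suc (cost d ℕ.+ cost e)
cost (d :- e)       = suc (cost d ℕ.+ cost e)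
cost (d :* e)       = suc (cost d ℕ.+ cost e)
cost (d :/ e)       = suc (cost d ℕ.+ cost e)
cost (round e)      = suc (cost e)
cost (embed e)      = suc (cost e)

costTest : Test → ℕ
costTest (d :≤ e) = suc (cost d ℕ.+ cost e)
costTest (d :< e) = suc (cost d ℕ.+ cost e)

-- ⟨ c , M ⟩⇓⟨ M′ , t ⟩ : started in memory M, the program c halts in
-- memory M′ after t elementary operations.
infix 2 ⟨_,_⟩⇓⟨_,_⟩

data ⟨_,_⟩⇓⟨_,_⟩ : Program → Memory → Memory → ℕ → Set where
  ⇓skip  : ∀ {M} → ⟨ skip , M ⟩⇓⟨ M , 1 ⟩
  ⇓write : ∀ {s a i j e M} →
           ⟨ write s a i j e , M ⟩⇓⟨ update M s a (eval i M) (eval j M) (eval e M)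
                                    , suc (cost i ℕ.+ cost j ℕ.+ cost e) ⟩
  ⇓seq   : ∀ {c d M M₁ M₂ t₁ t₂} →
           ⟨ c , M ⟩⇓⟨ M₁ , t₁ ⟩ → ⟨ d , M₁ ⟩⇓⟨ M₂ , t₂ ⟩ →
           ⟨ c ⨾ d , M ⟩⇓⟨ M₂ , t₁ ℕ.+ t₂ ⟩
  ⇓then  : ∀ {b c d M M₁ t} → evalTest b M ≡ true →
           ⟨ c , M ⟩⇓⟨ M₁ , t ⟩ →
           ⟨ If b c d , M ⟩⇓⟨ M₁ , suc (costTest b ℕ.+ t) ⟩
  ⇓else  : ∀ {b c d M M₁ t} → evalTest b M ≡ false →
           ⟨ d , M ⟩⇓⟨ M₁ , t ⟩ →
           ⟨ If b c d , M ⟩⇓⟨ M₁ , suc (costTest b ℕ.+ t) ⟩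
  ⇓stop  : ∀ {b c M} → evalTest b M ≡ false →
           ⟨ While b c , M ⟩⇓⟨ M , suc (costTest b) ⟩
  ⇓loop  : ∀ {b c M M₁ M₂ t₁ t₂} → evalTest b M ≡ true →
           ⟨ c , M ⟩⇓⟨ M₁ , t₁ ⟩ → ⟨ While b c , M₁ ⟩⇓⟨ M₂ , t₂ ⟩ →
           ⟨ While b c , M ⟩⇓⟨ M₂ , suc (costTest b ℕ.+ t₁ ℕ.+ t₂) ⟩

------------------------------------------------------------------------
-- Input and output

extend : ∀ {A : Set} {k} → A → (Fin k → A) → ℕ → A
extend {k = k} d f i with i ℕ.<? k
... | yes i<k = f (fromℕ< i<k)
... | no  _   = d

-- Natural arrays: 0 holds m, 1 the category sizes.  Rational arrays: 0 and 1
-- hold weights and values (row = category), 2 and 3 the bounds l and u, 4 the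
-- capacity.  Every other cell is 0.
input : Instance → Memory
input I nat 0 0 0 = Instance.m I
input I nat 1 i 0 = extend 0 (Instance.size I) i
input I nat _ _ _ = 0
input I rat 0 i j = extend 0ℚ (λ k → extend 0ℚ (Instance.w I k) j) i
input I rat 1 i j = extend 0ℚ (λ k → extend 0ℚ (Instance.v I k) j) i
input I rat 2 i 0 = extend 0ℚ (Instance.l I) i
input I rat 3 i 0 = extend 0ℚ (Instance.u I) i
input I rat 4 0 0 = Instance.B I
input I rat _ _ _ = 0ℚ

-- Item j of category i is selected iff entry (i , j) of natural array 2 is 1.
output : (I : Instance) → Memory → Instance.Selection I
output I M i = tabulate λ j → M nat 2 (toℕ i) (toℕ j) ℕ.≡ᵇ 1

------------------------------------------------------------------------
-- The running-time bound

-- max {1 , log_b x} ≤ q, for rational q and b > 1.  With q = a/d in lowest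
-- terms, log_b x ≤ q iff x ^ d ≤ b ^ a (also when 0 ≤ x < 1, since q ≥ 1).
record MaxOneLog≤ (b x q : ℚ) : Set where
  field
    one≤ : 1ℚ ≤ q
    log≤ : x ^ (↧ₙ q) ≤ b ^ ∣ ↥ q ∣

-- t ≤ C n² m λ₁³ λ₂³ / ε, where λ₁ = max {1 , log₂ m} and
-- λ₂ = max {1 , log_{1+ε} (B / w_min)}.  As real numbers, λ₁ and λ₂ are given
-- by their rational upper bounds p and q: the inequality holds for λ₁ and λ₂
-- iff it holds for all such p and q.
WithinTime : (C : ℕ) (ε : ℚ) → .{{Positive ε}} → Instance → ℕ → Set
WithinTime C ε I t =
  ∀ wₘ (min : IsMinPositiveWeight wₘ) p q →
  MaxOneLog≤ (fromℕ 2) (fromℕ m) p →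
  MaxOneLog≤ (1ℚ + ε) ((B ÷ wₘ) {{pos⇒nonZero wₘ {{IsMinPositiveWeight.positive min}}}}) q →
  fromℕ t ≤ (fromℕ C * (fromℕ n ^ 2 * fromℕ m * p ^ 3 * q ^ 3) ÷ ε) {{pos⇒nonZero ε}}
  where open Instance I

-- On every instance with a feasible solution, P halts within the time bound
-- with constant C and outputs an ε-approximate solution.
Solves : (C : ℕ) (ε : ℚ) → .{{Positive ε}} → Program → Set
Solves C ε P =
  ∀ (I : Instance) → (∃[ S ] Instance.Feasible I S) →
  ∃[ M ] ∃[ t ] (⟨ P , input I ⟩⇓⟨ M , t ⟩
               × Instance.IsApproximateSolution I ε (output I M)
               × WithinTime C ε I t)

{-# OPTIONS --safe #-}

-- Pad the instance to 2ᵃ categories of 2ᵇ items each and regard the items as the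
-- leaves of a perfect binary tree, in which the categories are the nodes of
-- height b.  With E = a + b + 1 choose ρ > 1 such that ρᴱ ≤ 1 + ε ≤ ρᶜᴱ, for a
-- constant c ≥ 1 + ε.  Every node keeps one selection of the leaves below it for
-- each bucket [ μ ρᵏ , μ ρᵏ⁺¹ ) of weights, where μ is the least positive weight:
-- among the selections that arise, one of greatest value.  The table of a node
-- arises from all pairs of entries of its two children; at a category, those
-- that violate its relaxed bounds are dropped.  Replacing a selection by another
-- one of the same bucket changes its weight by a factor of at most ρ and happens
-- at most E times along a path, so some selection at the root is at least as
-- valuable as the optimum, with all weights within a factor ρᴱ ≤ 1 + ε.
--
-- With K buckets, merging takes O(K³) steps per node, hence O(n m K³) in total,
-- and K = O(E λ₂) = O(b λ₁ λ₂).  The bound follows from b³ = O(2ᵇ) = O(n).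

module Submission where

open import Defs
open import Data.Bool.Base using (Bool; true; false; if_then_else_; _∨_; T)
open import Data.Fin.Base as Fin using (Fin; toℕ; fromℕ<)
open import Data.Fin.Properties using (toℕ<n; toℕ-fromℕ<; fromℕ<-toℕ)
open import Data.Integer.Base as ℤ using (+_; ∣_∣)
import Data.Integer.Properties as ℤₚ
open import Data.Nat.Base as ℕ using (ℕ; zero; suc; z≤n; s≤s)
import Data.Nat.Properties as ℕₚ
open import Data.Nat.Tactic.RingSolver using () renaming (solve-∀ to ℕ-solve)
import Data.Nat.DivMod as DM
open import Data.Nat.Divisibility using (n∣m*n)
open import Data.Product.Base using (Σ-syntax; ∃-syntax; _×_; _,_; proj₁; proj₂)
open import Data.Rational.Base as ℚ using (ℚ; 0ℚ; 1ℚ; ½; Positive; _≤_; _<_; _+_; _*_; _-_; _÷_; -_; 1/_; ↥_; ↧ₙ_; ↧_)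
import Data.Rational.Properties as ℚₚ
import Data.Rational.Unnormalised.Base as ℚᵘ
import Data.Rational.Unnormalised.Properties as ℚᵘₚ
open import Data.Sum.Base using (_⊎_; inj₁; inj₂)
open import Data.Empty using (⊥; ⊥-elim)
open import Data.Unit.Base using (⊤; tt)
open import Function.Base using (_∘_; id)
open import Level using (0ℓ)
open import Relation.Binary.PropositionalEquality
open import Relation.Nullary using (yes; no; Dec; does; ¬_)
open import Relation.Nullary.Decidable.Core using (dec⇒maybe)
open import Relation.Nullary.Decidable using (dec-true; dec-false)
open import Tactic.RingSolver using () renaming (solve-∀ to ring-solve)
open import Tactic.RingSolver.Core.AlmostCommutativeRing using (AlmostCommutativeRing; fromCommutativeRing)
open import Algebra.Definitions.RawSemiring ℚₚ.+-*-rawSemiring using (_^_)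
open import Data.Vec.Base using (lookup)
open import Data.Vec.Properties using (lookup∘tabulate)
open import Algebra.Properties.Monoid.Sum ℚₚ.+-0-monoid using (sum-syntax; sum-cong-≗)
open import Data.Vec.Functional using (foldr)

-- Rational numbers and powers

-- An E-th root of 1 + ε is irrational in general. Therefore `ρ` is 1 + κ / E with κ = ε / (1 + ε),
-- and Bernoulli's inequality bounds its powers from both sides. Carrying a selection through a
-- merge has to cost O(1). Each leaf owns one binary digit of a rational code, so joining disjoint
-- selections is one addition, and a single code is unpacked at the very end. Every table satisfies
-- two invariants at once. Soundness: a nonempty entry describes an actual selection that passed the
-- relaxed tests. Completeness: every selection within the exact bounds has a stand-in of at least
-- its value and of close weight. Closeness is a two-sided factor and weights of siblings add up, so
-- the error grows with the height alone; it stays within 1 + ε, and the relaxed tests never drop a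
-- stand-in. The table sizes depend on ε through the logarithm to base 1 + ε and through c. The
-- factor 1 / ε of the claimed bound falls below 1 for large ε, which is why the constant is uniform
-- over ε ≤ ε₀ and contains an upper bound of ε₀.

ℚ-ring : AlmostCommutativeRing 0ℓ 0ℓ
ℚ-ring = fromCommutativeRing ℚₚ.+-*-commutativeRing (λ x → dec⇒maybe (0ℚ ℚₚ.≟ x))

-- Inequalities over ℚ are proved by exhibiting the difference as a manifestly
-- nonnegative expression, the identity being left to the ring solver.
≤-by : ∀ {p q} r → 0ℚ ≤ r → q ≡ p + r → p ≤ q
≤-by {p} {q} r 0≤r q≡p+r = begin
  p       ≡⟨ ℚₚ.+-identityʳ p ⟨
  p + 0ℚ  ≤⟨ ℚₚ.+-monoʳ-≤ p 0≤r ⟩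
  p + r   ≡⟨ q≡p+r ⟨
  q       ∎
  where open ℚₚ.≤-Reasoning

0≤- : ∀ {p q} → p ≤ q → 0ℚ ≤ q - p
0≤- {p} {q} p≤q = begin
  0ℚ     ≡⟨ ℚₚ.+-inverseʳ p ⟨
  p - p  ≤⟨ ℚₚ.+-monoˡ-≤ (- p) p≤q ⟩
  q - p  ∎
  where open ℚₚ.≤-Reasoning

0≤+ : ∀ {p q} → 0ℚ ≤ p → 0ℚ ≤ q → 0ℚ ≤ p + q
0≤+ = ℚₚ.+-mono-≤

0≤* : ∀ {p q} → 0ℚ ≤ p → 0ℚ ≤ q → 0ℚ ≤ p * q
0≤* {p} {q} 0≤p 0≤q = ℚₚ.nonNegative⁻¹ (p * q)
  {{ℚₚ.nonNeg*nonNeg⇒nonNeg p {{ℚ.nonNegative 0≤p}} q {{ℚ.nonNegative 0≤q}}}}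

0<* : ∀ {p q} → 0ℚ < p → 0ℚ < q → 0ℚ < p * q
0<* {p} {q} 0<p 0<q = ℚₚ.positive⁻¹ (p * q)
  {{ℚₚ.pos*pos⇒pos p {{ℚ.positive 0<p}} q {{ℚ.positive 0<q}}}}

*-monoˡ : ∀ {p q} r → 0ℚ ≤ r → p ≤ q → r * p ≤ r * q
*-monoˡ r 0≤r = ℚₚ.*-monoˡ-≤-nonNeg r {{ℚ.nonNegative 0≤r}}

*-monoʳ : ∀ {p q} r → 0ℚ ≤ r → p ≤ q → p * r ≤ q * r
*-monoʳ r 0≤r = ℚₚ.*-monoʳ-≤-nonNeg r {{ℚ.nonNegative 0≤r}}

*-mono : ∀ {p q r s} → 0ℚ ≤ q → 0ℚ ≤ r → p ≤ q → r ≤ s → p * r ≤ q * s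
*-mono {p} {q} {r} {s} 0≤q 0≤r p≤q r≤s = ℚₚ.≤-trans (*-monoʳ r 0≤r p≤q) (*-monoˡ q 0≤q r≤s)

*-cancelˡ : ∀ {p q} r → 0ℚ < r → r * p ≤ r * q → p ≤ q
*-cancelˡ r 0<r = ℚₚ.*-cancelˡ-≤-pos r {{ℚ.positive 0<r}}

0≤1 : 0ℚ ≤ 1ℚ
0≤1 = ℚ.*≤* (ℤ.+≤+ z≤n)

0<1 : 0ℚ < 1ℚ
0<1 = ℚ.*<* (ℤ.+<+ (s≤s z≤n))

<⇒≱ : ∀ {p q} → p < q → ¬ q ≤ p
<⇒≱ p<q q≤p = ℚₚ.<-irrefl refl (ℚₚ.<-≤-trans p<q q≤p)

fromℕᵘ : ∀ k → ℚ.toℚᵘ (fromℕ k) ℚᵘ.≃ ℚᵘ.mkℚᵘ (+ k) 0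
fromℕᵘ k = ℚₚ.toℚᵘ-fromℚᵘ (ℚᵘ.mkℚᵘ (+ k) 0)

fromℕ-+ : ∀ j k → fromℕ (j ℕ.+ k) ≡ fromℕ j + fromℕ k
fromℕ-+ j k = ℚₚ.toℚᵘ-injective (begin
  ℚ.toℚᵘ (fromℕ (j ℕ.+ k))                     ≈⟨ fromℕᵘ (j ℕ.+ k) ⟩
  ℚᵘ.mkℚᵘ (+ (j ℕ.+ k)) 0                      ≈⟨ ℚᵘ.*≡* (cong₂ (λ x y → (x ℤ.+ y) ℤ.* + 1)
                                                    (sym (ℤₚ.*-identityʳ (+ j))) (sym (ℤₚ.*-identityʳ (+ k)))) ⟩
  ℚᵘ.mkℚᵘ (+ j) 0 ℚᵘ.+ ℚᵘ.mkℚᵘ (+ k) 0         ≈⟨ ℚᵘₚ.+-cong (fromℕᵘ j) (fromℕᵘ k) ⟨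
  ℚ.toℚᵘ (fromℕ j) ℚᵘ.+ ℚ.toℚᵘ (fromℕ k)       ≈⟨ ℚₚ.toℚᵘ-homo-+ (fromℕ j) (fromℕ k) ⟨
  ℚ.toℚᵘ (fromℕ j + fromℕ k)                   ∎)
  where open ℚᵘₚ.≃-Reasoning

fromℕ-suc : ∀ k → fromℕ (suc k) ≡ 1ℚ + fromℕ k
fromℕ-suc = fromℕ-+ 1

0≤fromℕ : ∀ k → 0ℚ ≤ fromℕ k
0≤fromℕ zero    = ℚₚ.≤-refl
0≤fromℕ (suc k) = subst (0ℚ ≤_) (sym (fromℕ-suc k)) (0≤+ 0≤1 (0≤fromℕ k))

fromℕ-mono : ∀ {j k} → j ℕ.≤ k → fromℕ j ≤ fromℕ k
fromℕ-mono {j} {k} j≤k = ≤-by (fromℕ (k ℕ.∸ j)) (0≤fromℕ (k ℕ.∸ j))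
  (trans (cong fromℕ (sym (ℕₚ.m+[n∸m]≡n j≤k))) (fromℕ-+ j (k ℕ.∸ j)))

1≤fromℕ : ∀ {k} → 1 ℕ.≤ k → 1ℚ ≤ fromℕ k
1≤fromℕ = fromℕ-mono {1}

fromℕ-* : ∀ j k → fromℕ (j ℕ.* k) ≡ fromℕ j * fromℕ k
fromℕ-* zero    k = sym (ℚₚ.*-zeroˡ (fromℕ k))
fromℕ-* (suc j) k = begin
  fromℕ (k ℕ.+ j ℕ.* k)             ≡⟨ fromℕ-+ k (j ℕ.* k) ⟩
  fromℕ k + fromℕ (j ℕ.* k)         ≡⟨ cong (_+_ (fromℕ k)) (fromℕ-* j k) ⟩
  fromℕ k + fromℕ j * fromℕ k       ≡⟨ lemma (fromℕ j) (fromℕ k) ⟩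
  (1ℚ + fromℕ j) * fromℕ k          ≡⟨ cong (_* fromℕ k) (fromℕ-suc j) ⟨
  fromℕ (suc j) * fromℕ k           ∎
  where
  open ≡-Reasoning
  lemma : ∀ x y → y + x * y ≡ (1ℚ + x) * y
  lemma = ring-solve ℚ-ring

p≤fromℕ : ∀ p → p ≤ fromℕ ∣ ↥ p ∣
p≤fromℕ p@(ℚ.mkℚ _ _ _) = ℚₚ.toℚᵘ-cancel-≤ (ℚᵘₚ.≤-respʳ-≃ (ℚᵘₚ.≃-sym (fromℕᵘ ∣ ↥ p ∣)) (ℚᵘ.*≤* (begin
  ↥ p ℤ.* + 1                 ≡⟨ ℤₚ.*-identityʳ (↥ p) ⟩
  ↥ p                         ≤⟨ i≤∣i∣ (↥ p) ⟩
  + ∣ ↥ p ∣                   ≡⟨ ℤₚ.*-identityʳ (+ ∣ ↥ p ∣) ⟨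
  + ∣ ↥ p ∣ ℤ.* + 1           ≤⟨ ℤₚ.*-monoˡ-≤-nonNeg (+ ∣ ↥ p ∣) (ℤ.+≤+ (s≤s z≤n)) ⟩
  + ∣ ↥ p ∣ ℤ.* ↧ p           ∎)))
  where
  open ℤₚ.≤-Reasoning
  i≤∣i∣ : ∀ i → i ℤ.≤ + ∣ i ∣
  i≤∣i∣ (+ n)      = ℤₚ.≤-refl
  i≤∣i∣ ℤ.-[1+ n ] = ℤ.-≤+

q*↧q : ∀ q → 0ℚ ≤ q → q * fromℕ (↧ₙ q) ≡ fromℕ ∣ ↥ q ∣
q*↧q q@(ℚ.mkℚ (+ n) d-1 _) 0≤q = ℚₚ.toℚᵘ-injective (begin
  ℚ.toℚᵘ (q * fromℕ (suc d-1))                  ≈⟨ ℚₚ.toℚᵘ-homo-* q (fromℕ (suc d-1)) ⟩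
  ℚ.toℚᵘ q ℚᵘ.* ℚ.toℚᵘ (fromℕ (suc d-1))        ≈⟨ ℚᵘₚ.*-congˡ {ℚ.toℚᵘ q} (fromℕᵘ (suc d-1)) ⟩
  ℚ.toℚᵘ q ℚᵘ.* ℚᵘ.mkℚᵘ (+ suc d-1) 0           ≈⟨ ℚᵘ.*≡* (trans (ℤₚ.*-assoc (+ n) _ _)
                                                     (cong (λ z → + n ℤ.* z) (sym (ℤₚ.pos-* (suc d-1) 1)))) ⟩
  ℚᵘ.mkℚᵘ (+ n) 0                               ≈⟨ fromℕᵘ n ⟨
  ℚ.toℚᵘ (fromℕ n)                              ∎)
  where open ℚᵘₚ.≃-Reasoning
q*↧q (ℚ.mkℚ ℤ.-[1+ _ ] _ _) (ℚ.*≤* ())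

÷-* : ∀ p q .{{_ : ℚ.NonZero q}} → (p ÷ q) * q ≡ p
÷-* p q = trans (ℚₚ.*-assoc p (1/ q) q) (trans (cong (p *_) (ℚₚ.*-inverseˡ q)) (ℚₚ.*-identityʳ p))

div-* : ∀ p {q} → q ≢ 0ℚ → div p q * q ≡ p
div-* p {q} q≢0 with q ℚₚ.≟ 0ℚ
... | yes q≡0  = ⊥-elim (q≢0 q≡0)
... | no  q≢0′ = ÷-* p q {{ℚ.≢-nonZero q≢0′}}

^-+ : ∀ r j k → r ^ (j ℕ.+ k) ≡ r ^ j * r ^ k
^-+ r zero    k = sym (ℚₚ.*-identityˡ (r ^ k))
^-+ r (suc j) k = trans (cong (r *_) (^-+ r j k)) (sym (ℚₚ.*-assoc r (r ^ j) (r ^ k)))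

^-* : ∀ r j k → r ^ (j ℕ.* k) ≡ (r ^ k) ^ j
^-* r zero    k = refl
^-* r (suc j) k = trans (^-+ r k (j ℕ.* k)) (cong (r ^ k *_) (^-* r j k))

*-^ : ∀ p q k → (p * q) ^ k ≡ p ^ k * q ^ k
*-^ p q zero    = refl
*-^ p q (suc k) = trans (cong (p * q *_) (*-^ p q k)) (lemma p q (p ^ k) (q ^ k))
  where
  lemma : ∀ p q x y → (p * q) * (x * y) ≡ (p * x) * (q * y)
  lemma = ring-solve ℚ-ring

0≤^ : ∀ {p} → 0ℚ ≤ p → ∀ k → 0ℚ ≤ p ^ k
0≤^ 0≤p zero    = 0≤1
0≤^ 0≤p (suc k) = 0≤* 0≤p (0≤^ 0≤p k)

^-monoˡ : ∀ {p q} → 0ℚ ≤ p → p ≤ q → ∀ k → p ^ k ≤ q ^ k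
^-monoˡ 0≤p p≤q zero    = ℚₚ.≤-refl
^-monoˡ 0≤p p≤q (suc k) = *-mono (ℚₚ.≤-trans 0≤p p≤q) (0≤^ 0≤p k) p≤q (^-monoˡ 0≤p p≤q k)

1≤^ : ∀ {p} → 1ℚ ≤ p → ∀ k → 1ℚ ≤ p ^ k
1≤^ 1≤p zero    = ℚₚ.≤-refl
1≤^ 1≤p (suc k) = *-mono (ℚₚ.≤-trans 0≤1 1≤p) 0≤1 1≤p (1≤^ 1≤p k)

0<^ : ∀ {p} → 0ℚ < p → ∀ k → 0ℚ < p ^ k
0<^ 0<p zero    = 0<1
0<^ 0<p (suc k) = 0<* 0<p (0<^ 0<p k)

^-monoʳ : ∀ {p} → 1ℚ ≤ p → ∀ {j k} → j ℕ.≤ k → p ^ j ≤ p ^ k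
^-monoʳ {p} 1≤p {j} {k} j≤k = begin
  p ^ j                    ≡⟨ ℚₚ.*-identityʳ (p ^ j) ⟨
  p ^ j * 1ℚ               ≤⟨ *-monoˡ (p ^ j) (0≤^ (ℚₚ.≤-trans 0≤1 1≤p) j) (1≤^ 1≤p (k ℕ.∸ j)) ⟩
  p ^ j * p ^ (k ℕ.∸ j)    ≡⟨ ^-+ p j (k ℕ.∸ j) ⟨
  p ^ (j ℕ.+ (k ℕ.∸ j))    ≡⟨ cong (p ^_) (ℕₚ.m+[n∸m]≡n j≤k) ⟩
  p ^ k                    ∎
  where open ℚₚ.≤-Reasoning

^-cancelʳ-≤ : ∀ {p} → 1ℚ < p → ∀ {j k} → p ^ j ≤ p ^ k → j ℕ.≤ k
^-cancelʳ-≤ {p} 1<p {j} {k} pʲ≤pᵏ with j ℕₚ.≤? k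
... | yes j≤k = j≤k
... | no  j≰k = ⊥-elim (<⇒≱ pᵏ<pᵏ⁺¹ (ℚₚ.≤-trans (^-monoʳ (ℚₚ.<⇒≤ 1<p) (ℕₚ.≰⇒> j≰k)) pʲ≤pᵏ))
  where
  pᵏ<pᵏ⁺¹ : p ^ k < p ^ suc k
  pᵏ<pᵏ⁺¹ = subst (_< p ^ suc k) (ℚₚ.*-identityˡ (p ^ k))
    (ℚₚ.*-monoˡ-<-pos (p ^ k) {{ℚ.positive (0<^ (ℚₚ.<-trans 0<1 1<p) k)}} 1<p)

bernoulli : ∀ {δ} → 0ℚ ≤ δ → ∀ k → 1ℚ + fromℕ k * δ ≤ (1ℚ + δ) ^ k
bernoulli {δ} 0≤δ zero    = ℚₚ.≤-reflexive (trans (cong (_+_ 1ℚ) (ℚₚ.*-zeroˡ δ)) (ℚₚ.+-identityʳ 1ℚ))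
bernoulli {δ} 0≤δ (suc k) = begin
  1ℚ + fromℕ (suc k) * δ              ≡⟨ cong (λ x → 1ℚ + x * δ) (fromℕ-suc k) ⟩
  1ℚ + (1ℚ + fromℕ k) * δ             ≤⟨ ≤-by (fromℕ k * (δ * δ)) (0≤* (0≤fromℕ k) (0≤* 0≤δ 0≤δ)) (lemma (fromℕ k) δ) ⟩
  (1ℚ + δ) * (1ℚ + fromℕ k * δ)       ≤⟨ *-monoˡ (1ℚ + δ) (0≤+ 0≤1 0≤δ) (bernoulli 0≤δ k) ⟩
  (1ℚ + δ) * (1ℚ + δ) ^ k             ∎
  where
  open ℚₚ.≤-Reasoning
  lemma : ∀ x δ → (1ℚ + δ) * (1ℚ + x * δ) ≡ 1ℚ + (1ℚ + x) * δ + x * (δ * δ)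
  lemma = ring-solve ℚ-ring

-- A division-free form of (1 + δ)ᵏ ≤ 1 / (1 - kδ). The induction rests on (1 + δ)(1 - (k + 1)δ) = 1
-- - kδ - (k + 1)δ².
^-inverse-bernoulli : ∀ {δ} → 0ℚ ≤ δ → ∀ k → (1ℚ + δ) ^ k * (1ℚ - fromℕ k * δ) ≤ 1ℚ
^-inverse-bernoulli {δ} 0≤δ zero    = ℚₚ.≤-reflexive (lemma δ)
  where
  lemma : ∀ δ → 1ℚ * (1ℚ - 0ℚ * δ) ≡ 1ℚ
  lemma = ring-solve ℚ-ring
^-inverse-bernoulli {δ} 0≤δ (suc k) = begin
  (1ℚ + δ) ^ suc k * (1ℚ - fromℕ (suc k) * δ)       ≡⟨ cong (λ x → (1ℚ + δ) ^ suc k * (1ℚ - x * δ)) (fromℕ-suc k) ⟩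
  (1ℚ + δ) ^ suc k * (1ℚ - (1ℚ + fromℕ k) * δ)      ≤⟨ ≤-by ((1ℚ + δ) ^ k * ((1ℚ + fromℕ k) * (δ * δ)))
                                                         (0≤* (0≤^ (0≤+ 0≤1 0≤δ) k) (0≤* (0≤+ 0≤1 (0≤fromℕ k)) (0≤* 0≤δ 0≤δ)))
                                                         (lemma ((1ℚ + δ) ^ k) (fromℕ k) δ) ⟩
  (1ℚ + δ) ^ k * (1ℚ - fromℕ k * δ)                 ≤⟨ ^-inverse-bernoulli 0≤δ k ⟩
  1ℚ                                                ∎
  where
  open ℚₚ.≤-Reasoning
  lemma : ∀ r x δ → r * (1ℚ - x * δ) ≡ (1ℚ + δ) * r * (1ℚ - (1ℚ + x) * δ) + r * ((1ℚ + x) * (δ * δ))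
  lemma = ring-solve ℚ-ring

-- Bernoulli's inequality with δ = r - 1. The numerator of x / δ is taken for k: dropping the
-- denominator and the sign can only increase the quotient.
archimedean-^ : ∀ {r} → 1ℚ < r → ∀ x → ∃[ k ] x < r ^ k
archimedean-^ {r} 1<r x = k , (begin-strict
  x                             <⟨ subst (_< 1ℚ + x) (ℚₚ.+-identityˡ x) (ℚₚ.+-monoˡ-< x 0<1) ⟩
  1ℚ + x                        ≡⟨ cong (_+_ 1ℚ) (div-* x δ≢0) ⟨
  1ℚ + div x δ * δ              ≤⟨ ℚₚ.+-monoʳ-≤ 1ℚ (*-monoʳ δ (ℚₚ.<⇒≤ 0<δ) (p≤fromℕ (div x δ))) ⟩
  1ℚ + fromℕ k * δ              ≤⟨ bernoulli (ℚₚ.<⇒≤ 0<δ) k ⟩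
  (1ℚ + δ) ^ k                  ≡⟨ cong (_^ k) (lemma r) ⟩
  r ^ k                         ∎)
  where
  open ℚₚ.≤-Reasoning
  δ = r - 1ℚ
  k = ∣ ↥ (div x δ) ∣
  0<δ : 0ℚ < δ
  0<δ = subst (_< δ) (ℚₚ.+-inverseʳ 1ℚ) (ℚₚ.+-monoˡ-< (- 1ℚ) 1<r)
  δ≢0 : δ ≢ 0ℚ
  δ≢0 δ≡0 = ℚₚ.<-irrefl (sym δ≡0) 0<δ
  lemma : ∀ r → 1ℚ + (r - 1ℚ) ≡ r
  lemma = ring-solve ℚ-ring

-- Minimality matters for the running time: the grid stops at the first power beyond the capacity,
-- so all earlier powers are still within it, which bounds their number.
least : ∀ {P : ℕ → Set} → (∀ k → Dec (P k)) → ∀ k → P k → ∃[ j ] (P j × (∀ i → i ℕ.< j → ¬ P i))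
least P? k Pk with P? 0
... | yes P0 = 0 , P0 , λ _ ()
least P? zero    Pk | no ¬P0 = ⊥-elim (¬P0 Pk)
least P? (suc k) Pk | no ¬P0 with least (P? ∘ suc) k Pk
... | j , Pj , below = suc j , Pj , λ { zero _ → ¬P0 ; (suc i) (s≤s i<j) → below i i<j }

-- From rᵏ ≤ b x and b ≤ rᵉ one gets k ≤ e (1 + log_b x).
exponent-bound : ∀ {b x q r} e k → 0ℚ ≤ b → 1ℚ < r → b ≤ r ^ e → MaxOneLog≤ b x q → 0ℚ ≤ x →
                 r ^ k ≤ b * x → fromℕ k ≤ fromℕ e * (1ℚ + q)
exponent-bound {b} {x} {q} {r} e k 0≤b 1<r b≤rᵉ log 0≤x rᵏ≤bx = *-cancelˡ (fromℕ d) 0<d (begin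
  fromℕ d * fromℕ k                     ≡⟨ fromℕ-* d k ⟨
  fromℕ (d ℕ.* k)                       ≤⟨ fromℕ-mono (^-cancelʳ-≤ 1<r {d ℕ.* k} {(d ℕ.+ a) ℕ.* e} powers) ⟩
  fromℕ ((d ℕ.+ a) ℕ.* e)               ≡⟨ trans (fromℕ-* (d ℕ.+ a) e) (cong (_* fromℕ e) (fromℕ-+ d a)) ⟩
  (fromℕ d + fromℕ a) * fromℕ e         ≡⟨ cong (λ y → (fromℕ d + y) * fromℕ e) (sym (q*↧q q (ℚₚ.≤-trans 0≤1 one≤))) ⟩
  (fromℕ d + q * fromℕ d) * fromℕ e     ≡⟨ lemma (fromℕ d) q (fromℕ e) ⟩
  fromℕ d * (fromℕ e * (1ℚ + q))        ∎)
  where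
  open ℚₚ.≤-Reasoning
  open MaxOneLog≤ log
  a = ∣ ↥ q ∣
  d = ↧ₙ q
  0<d : 0ℚ < fromℕ d
  0<d = ℚₚ.<-≤-trans 0<1 (1≤fromℕ {d} (s≤s z≤n))
  lemma : ∀ d q e → (d + q * d) * e ≡ d * (e * (1ℚ + q))
  lemma = ring-solve ℚ-ring
  powers : r ^ (d ℕ.* k) ≤ r ^ ((d ℕ.+ a) ℕ.* e)
  powers = begin
    r ^ (d ℕ.* k)             ≡⟨ ^-* r d k ⟩
    (r ^ k) ^ d               ≤⟨ ^-monoˡ (0≤^ (ℚₚ.≤-trans 0≤1 (ℚₚ.<⇒≤ 1<r)) k) rᵏ≤bx d ⟩
    (b * x) ^ d               ≡⟨ *-^ b x d ⟩
    b ^ d * x ^ d             ≤⟨ *-monoˡ (b ^ d) (0≤^ 0≤b d) log≤ ⟩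
    b ^ d * b ^ a             ≡⟨ ^-+ b d a ⟨
    b ^ (d ℕ.+ a)             ≤⟨ ^-monoˡ 0≤b b≤rᵉ (d ℕ.+ a) ⟩
    (r ^ e) ^ (d ℕ.+ a)       ≡⟨ ^-* r (d ℕ.+ a) e ⟨
    r ^ ((d ℕ.+ a) ℕ.* e)     ∎

-- Program logic

does-true : ∀ {P : Set} (d : Dec P) → does d ≡ true → P
does-true (yes p) _ = p
does-true (no _)  ()

does-false : ∀ {P : Set} (d : Dec P) → does d ≡ false → ¬ P
does-false (no ¬p) _ = ¬p
does-false (yes _) ()

<-true : ∀ {x y} → does (x ℚₚ.<? y) ≡ true → x < y
<-true = does-true (_ ℚₚ.<? _)

<-false : ∀ {x y} → does (x ℚₚ.<? y) ≡ false → y ≤ x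
<-false eq = ℚₚ.≮⇒≥ (does-false (_ ℚₚ.<? _) eq)

≤-true : ∀ {x y} → does (x ℚₚ.≤? y) ≡ true → x ≤ y
≤-true = does-true (_ ℚₚ.≤? _)

≤-false : ∀ {x y} → does (x ℚₚ.≤? y) ≡ false → y < x
≤-false eq = ℚₚ.≰⇒> (does-false (_ ℚₚ.≤? _) eq)

<ℕ-true : ∀ {x y} → does (x ℕₚ.<? y) ≡ true → x ℕ.< y
<ℕ-true {x} {y} = does-true (x ℕₚ.<? y)

<ℕ-false : ∀ {x y} → does (x ℕₚ.<? y) ≡ false → y ℕ.≤ x
<ℕ-false {x} {y} eq = ℕₚ.≮⇒≥ (does-false (x ℕₚ.<? y) eq)

≡ᵇ-refl : ∀ k → (k ℕ.≡ᵇ k) ≡ true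
≡ᵇ-refl zero    = refl
≡ᵇ-refl (suc k) = ≡ᵇ-refl k

≡ᵇ-false : ∀ {j k} → j ≢ k → (j ℕ.≡ᵇ k) ≡ false
≡ᵇ-false {zero}  {zero}  j≢k = ⊥-elim (j≢k refl)
≡ᵇ-false {zero}  {suc k} _   = refl
≡ᵇ-false {suc j} {zero}  _   = refl
≡ᵇ-false {suc j} {suc k} j≢k = ≡ᵇ-false (j≢k ∘ cong suc)

≡ᵇ-sound : ∀ j k → (j ℕ.≡ᵇ k) ≡ true → j ≡ k
≡ᵇ-sound j k eq = ℕₚ.≡ᵇ⇒≡ j k (subst T (sym eq) tt)


-- A syntactic approximation that records arrays and ignores cells. It evaluates on every concrete
-- program, so each side condition of a frame argument is proved by `refl`.
writes : Program → Sort → ℕ → Bool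
writes skip              s   a = false
writes (write nat b _ _ _) nat a = b ℕ.≡ᵇ a
writes (write rat b _ _ _) rat a = b ℕ.≡ᵇ a
writes (write nat b _ _ _) rat a = false
writes (write rat b _ _ _) nat a = false
writes (c ⨾ d)           s   a = writes c s a ∨ writes d s a
writes (If _ c d)        s   a = writes c s a ∨ writes d s a
writes (While _ c)       s   a = writes c s a

∨-false : ∀ {x y} → x ∨ y ≡ false → x ≡ false × y ≡ false
∨-false {false} eq = refl , eq

-- A record, so that c can be recovered from the type.
record Frame (c : Program) (M M′ : Memory) : Set where
  constructor frame
  field
    unchanged : ∀ s a → writes c s a ≡ false → ∀ i j → M′ s a i j ≡ M s a i j

open Frame

frame-rule : ∀ {c M M′ t} → ⟨ c , M ⟩⇓⟨ M′ , t ⟩ → Frame c M M′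
frame-rule D = frame (go D)
  where
  go : ∀ {c M M′ t} → ⟨ c , M ⟩⇓⟨ M′ , t ⟩ →
       ∀ s a → writes c s a ≡ false → ∀ i j → M′ s a i j ≡ M s a i j
  go ⇓skip _ _ _ _ _ = refl
  go (⇓write {nat}) nat a w i j rewrite w = refl
  go (⇓write {rat}) rat a w i j rewrite w = refl
  go (⇓write {nat}) rat a w i j = refl
  go (⇓write {rat}) nat a w i j = refl
  go (⇓seq C D) s a w i j = trans (go D s a (proj₂ (∨-false w)) i j) (go C s a (proj₁ (∨-false w)) i j)
  go (⇓then _ C) s a w i j = go C s a (proj₁ (∨-false w)) i j
  go (⇓else {c = c} _ D) s a w i j = go D s a (proj₂ (∨-false {writes c s a} w)) i j
  go (⇓stop _) _ _ _ _ _ = refl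
  go (⇓loop _ C D) s a w i j = trans (go D s a w i j) (go C s a w i j)

-- Total correctness with an upper bound on the time instead of the exact time, so that different
-- execution paths can share one bound.
Run : Program → Memory → ℕ → (Memory → Set) → Set
Run c M T Q = ∃[ M′ ] ∃[ t ] (⟨ c , M ⟩⇓⟨ M′ , t ⟩ × t ℕ.≤ T × Q M′)

run-weaken : ∀ {c M T T′} {Q Q′ : Memory → Set} → T ℕ.≤ T′ → (∀ M′ → Frame c M M′ → Q M′ → Q′ M′) →
             Run c M T Q → Run c M T′ Q′
run-weaken T≤T′ Q⇒Q′ (M′ , t , D , t≤T , q) = M′ , t , D , ℕₚ.≤-trans t≤T T≤T′ , Q⇒Q′ M′ (frame-rule D) q

run-skip : ∀ {M} {Q : Memory → Set} → Q M → Run skip M 1 Q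
run-skip {M} q = M , 1 , ⇓skip , ℕₚ.≤-refl , q

run-write : ∀ {s a i j e M} {Q : Memory → Set} → Q (update M s a (eval i M) (eval j M) (eval e M)) →
            Run (write s a i j e) M (suc (cost i ℕ.+ cost j ℕ.+ cost e)) Q
run-write q = _ , _ , ⇓write , ℕₚ.≤-refl , q

run-seq : ∀ {c d M T₁ T₂} {P Q : Memory → Set} → Run c M T₁ P →
          (∀ M₁ → Frame c M M₁ → P M₁ → Run d M₁ T₂ Q) → Run (c ⨾ d) M (T₁ ℕ.+ T₂) Q
run-seq (M₁ , t₁ , C , t₁≤ , p) k with k M₁ (frame-rule C) p
... | M₂ , t₂ , D , t₂≤ , q = M₂ , _ , ⇓seq C D , ℕₚ.+-mono-≤ t₁≤ t₂≤ , q

-- Unlike `run-seq`, this keeps the intermediate memory as an explicit `update`, so that later reads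
-- reduce by computation.
run-write-seq : ∀ {s a i j e d M T} {Q : Memory → Set} →
                Run d (update M s a (eval i M) (eval j M) (eval e M)) T Q →
                Run (write s a i j e ⨾ d) M (suc (cost i ℕ.+ cost j ℕ.+ cost e) ℕ.+ T) Q
run-write-seq (M₂ , t₂ , D , t₂≤ , q) = M₂ , _ , ⇓seq ⇓write D , ℕₚ.+-monoʳ-≤ _ t₂≤ , q

-- The times of the branches are added instead of taking their maximum: this at most doubles the
-- charge and keeps all bounds sums.
run-if : ∀ {b c d M T₁ T₂} {Q : Memory → Set} →
         (evalTest b M ≡ true → Run c M T₁ Q) → (evalTest b M ≡ false → Run d M T₂ Q) →
         Run (If b c d) M (suc (costTest b ℕ.+ (T₁ ℕ.+ T₂))) Q
run-if {b} {M = M} {T₁} {T₂} f g with evalTest b M in eq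
... | true  with f refl
...   | M′ , t , D , t≤ , q = M′ , _ , ⇓then eq D ,
        s≤s (ℕₚ.+-monoʳ-≤ (costTest b) (ℕₚ.≤-trans t≤ (ℕₚ.m≤m+n T₁ T₂))) , q
run-if {b} {M = M} {T₁} {T₂} f g | false with g refl
...   | M′ , t , D , t≤ , q = M′ , _ , ⇓else eq D ,
        s≤s (ℕₚ.+-monoʳ-≤ (costTest b) (ℕₚ.≤-trans t≤ (ℕₚ.m≤n+m T₂ T₁))) , q

loopTime : Test → ℕ → ℕ → ℕ
loopTime b L T = L ℕ.* (suc (costTest b) ℕ.+ T) ℕ.+ suc (costTest b)

-- The invariant is indexed by the number of rounds made. As a round can start only while this
-- number is below `L`, the difference serves as fuel for a structural recursion.
run-while : ∀ {b c M T} (I : ℕ → Memory → Set) (L : ℕ) →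
            (∀ k M → I k M → evalTest b M ≡ true → k ℕ.< L × Run c M T (I (suc k))) → I 0 M →
            Run (While b c) M (loopTime b L T) (λ M′ → ∃[ k ] (I k M′ × evalTest b M′ ≡ false))
run-while {b} {c} {T = T} I L step = go L 0 refl
  where
  go : ∀ {M} f k → k ℕ.+ f ≡ L → I k M →
       Run (While b c) M (loopTime b f T) (λ M′ → ∃[ k ] (I k M′ × evalTest b M′ ≡ false))
  go {M} f k k+f≡L i with evalTest b M in eq
  ... | false = M , _ , ⇓stop eq , ℕₚ.m≤n+m _ (f ℕ.* (suc (costTest b) ℕ.+ T)) , k , i , eq
  ... | true with f | step k M i eq
  ...   | zero | k<L , _ = ⊥-elim (ℕₚ.<-irrefl (trans (sym (ℕₚ.+-identityʳ k)) k+f≡L) k<L)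
  ...   | suc f′ | _ , M₁ , t₁ , C , t₁≤ , i₁ with go f′ (suc k) (trans (sym (ℕₚ.+-suc k f′)) k+f≡L) i₁
  ...     | M₂ , t₂ , D , t₂≤ , post = M₂ , _ , ⇓loop eq C D ,
            ℕₚ.≤-trans (ℕₚ.+-mono-≤ (s≤s (ℕₚ.+-monoʳ-≤ (costTest b) t₁≤)) t₂≤)
              (ℕₚ.≤-reflexive (sym (ℕₚ.+-assoc (suc (costTest b) ℕ.+ T) _ _))) , post

-- Scalars and counting loops

scalar : ∀ s → ℕ → Exp s
scalar s a = read s a (lit 0) (lit 0)

assign : ∀ s → ℕ → Exp s → Program
assign s a e = write s a (lit 0) (lit 0) e

-- The limit is evaluated once, and the counter is decremented before the body, which thus sees all
-- values below the limit in descending order. Descending is what the tree requires: in heap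
-- numbering, children have larger numbers than their parent.
Down : ℕ → Exp nat → Program → Program
Down a e c = assign nat a e ⨾ While (lit 0 :< scalar nat a) (assign nat a (scalar nat a :- lit 1) ⨾ c)

downTime : ℕ → Exp nat → ℕ → ℕ → ℕ
downTime a e L T = suc (2 ℕ.+ cost e) ℕ.+ loopTime (lit 0 :< scalar nat a) L (8 ℕ.+ T)

update-counter : ∀ M a x → update M nat a 0 0 x nat a 0 0 ≡ x
update-counter M a x rewrite ≡ᵇ-refl a = refl

run-down : ∀ {a e c M T} (I : ℕ → Memory → Set) (L : ℕ) → writes c nat a ≡ false → eval e M ≡ L →
           I L (update M nat a 0 0 L) →
           (∀ k M → k ℕ.< L → I (suc k) M → Run c (update M nat a 0 0 k) T (I k)) →
           Run (Down a e c) M (downTime a e L T) (I 0)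
run-down {a} {e} {c} {M} {T} I L safe refl start step =
  run-write-seq (run-weaken ℕₚ.≤-refl finish (run-while Counted L body (L , ℕₚ.+-identityʳ L , update-counter M a L , start)))
  where
  Counted : ℕ → Memory → Set
  Counted k M = ∃[ r ] (r ℕ.+ k ≡ L × M nat a 0 0 ≡ r × I r M)
  body : ∀ k M → Counted k M → _ → k ℕ.< L × Run _ M (8 ℕ.+ T) (Counted (suc k))
  body k M (zero  , r+k≡L , ctr , i) eq = ⊥-elim (ℕₚ.<-irrefl (sym ctr) (<ℕ-true eq))
  body k M (suc r , r+k≡L , ctr , i) eq =
    ℕₚ.≤-trans (s≤s (ℕₚ.m≤n+m k r)) (ℕₚ.≤-reflexive r+k≡L) ,
    run-write-seq (subst (λ x → Run c (update M nat a 0 0 (x ℕ.∸ 1)) T (Counted (suc k))) (sym ctr)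
      (run-weaken ℕₚ.≤-refl
        (λ M′ fr i′ → r , trans (ℕₚ.+-suc r k) r+k≡L ,
                      trans (unchanged fr nat a safe 0 0) (update-counter M a r) , i′)
        (step r M (ℕₚ.≤-trans (s≤s (ℕₚ.m≤m+n r k)) (ℕₚ.≤-reflexive r+k≡L)) i)))
  finish : ∀ M′ → _ → ∃[ k ] (Counted k M′ × _) → I 0 M′
  finish M′ _ (k , (zero  , _ , _ , i) , _)    = i
  finish M′ _ (k , (suc r , _ , ctr , i) , eq) = ⊥-elim (ℕₚ.<⇒≱ (s≤s (z≤n {r})) (ℕₚ.≤-trans (ℕₚ.≤-reflexive (sym ctr)) (<ℕ-false eq)))

-- For scans in which the order of rounds is immaterial: a round settles its own case and spoils no
-- other one.
run-for : ∀ {a e c M T} (P : Memory → Set) (Q : ℕ → Memory → Set) (L : ℕ) →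
          writes c nat a ≡ false → eval e M ≡ L → P (update M nat a 0 0 L) →
          (∀ k M → k ℕ.< L → P M →
             Run c (update M nat a 0 0 k) T (λ M′ → P M′ × Q k M′ × (∀ j → j ℕ.< L → Q j M → Q j M′))) →
          Run (Down a e c) M (downTime a e L T) (λ M′ → P M′ × (∀ j → j ℕ.< L → Q j M′))
run-for {c = c} P Q L safe L≡ start step =
  run-weaken ℕₚ.≤-refl (λ { M′ _ (p , q) → p , λ j → q j z≤n })
    (run-down I L safe L≡ (start , λ j L≤j j<L → ⊥-elim (ℕₚ.<⇒≱ j<L L≤j)) body)
  where
  I : ℕ → Memory → Set
  I k M = P M × (∀ j → k ℕ.≤ j → j ℕ.< L → Q j M)
  body : ∀ k M → k ℕ.< L → I (suc k) M → Run c _ _ (I k)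
  body k M k<L (p , q) = run-weaken ℕₚ.≤-refl post (step k M k<L p)
    where
    post : ∀ M′ → _ → P M′ × Q k M′ × (∀ j → j ℕ.< L → Q j M → Q j M′) → I k M′
    post M′ _ (p′ , qk , keep) = p′ , new
      where
      new : ∀ j → k ℕ.≤ j → j ℕ.< L → Q j M′
      new j k≤j j<L with k ℕₚ.≟ j
      ... | yes refl = qk
      ... | no  k≢j  = keep j j<L (q j (ℕₚ.≤∧≢⇒< k≤j k≢j) j<L)

-- Trees of leaves and buckets of weights

pick : Bool → ℚ → ℚ
pick s x = if s then x else 0ℚ

rsum : ℕ → (ℕ → ℚ) → ℚ
rsum zero    f = 0ℚ
rsum (suc k) f = rsum k f + f k

rsum-cong : ∀ k {f g} → (∀ i → i ℕ.< k → f i ≡ g i) → rsum k f ≡ rsum k g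
rsum-cong zero    eq = refl
rsum-cong (suc k) eq = cong₂ _+_ (rsum-cong k λ i i<k → eq i (ℕₚ.m≤n⇒m≤1+n i<k)) (eq k ℕₚ.≤-refl)

rsum-+ : ∀ j k f → rsum (j ℕ.+ k) f ≡ rsum j f + rsum k (f ∘ (j ℕ.+_))
rsum-+ j zero    f = trans (cong (λ i → rsum i f) (ℕₚ.+-identityʳ j)) (sym (ℚₚ.+-identityʳ (rsum j f)))
rsum-+ j (suc k) f = begin
  rsum (j ℕ.+ suc k) f                                   ≡⟨ cong (λ i → rsum i f) (ℕₚ.+-suc j k) ⟩
  rsum (j ℕ.+ k) f + f (j ℕ.+ k)                         ≡⟨ cong (_+ f (j ℕ.+ k)) (rsum-+ j k f) ⟩
  rsum j f + rsum k (f ∘ (j ℕ.+_)) + f (j ℕ.+ k)         ≡⟨ ℚₚ.+-assoc (rsum j f) _ _ ⟩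
  rsum j f + (rsum k (f ∘ (j ℕ.+_)) + f (j ℕ.+ k))       ∎
  where open ≡-Reasoning

rsum-0 : ∀ k {f} → (∀ i → i ℕ.< k → f i ≡ 0ℚ) → rsum k f ≡ 0ℚ
rsum-0 zero    eq = refl
rsum-0 (suc k) eq = cong₂ _+_ (rsum-0 k λ i i<k → eq i (ℕₚ.m≤n⇒m≤1+n i<k)) (eq k ℕₚ.≤-refl)

rsum-* : ∀ j k f → rsum (j ℕ.* k) f ≡ rsum j (λ i → rsum k (λ p → f (i ℕ.* k ℕ.+ p)))
rsum-* zero    k f = refl
rsum-* (suc j) k f = begin
  rsum (k ℕ.+ j ℕ.* k) f                                     ≡⟨ cong (λ i → rsum i f) (ℕₚ.+-comm k (j ℕ.* k)) ⟩
  rsum (j ℕ.* k ℕ.+ k) f                                     ≡⟨ rsum-+ (j ℕ.* k) k f ⟩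
  rsum (j ℕ.* k) f + rsum k (λ p → f (j ℕ.* k ℕ.+ p))        ≡⟨ cong (_+ rsum k (λ p → f (j ℕ.* k ℕ.+ p))) (rsum-* j k f) ⟩
  rsum (suc j) (λ i → rsum k (λ p → f (i ℕ.* k ℕ.+ p)))      ∎
  where open ≡-Reasoning

∑≡rsum : ∀ k (f : ℕ → ℚ) → (∑[ i < k ] f (toℕ i)) ≡ rsum k f
∑≡rsum zero    f = refl
∑≡rsum (suc k) f = begin
  f 0 + (∑[ i < k ] f (suc (toℕ i)))  ≡⟨ cong (_+_ (f 0)) (∑≡rsum k (f ∘ suc)) ⟩
  f 0 + rsum k (f ∘ suc)              ≡⟨ cong (_+ rsum k (f ∘ suc)) (ℚₚ.+-identityˡ (f 0)) ⟨
  rsum 1 f + rsum k (f ∘ suc)         ≡⟨ rsum-+ 1 k f ⟨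
  rsum (suc k) f                      ∎
  where open ≡-Reasoning

rsum-pad : ∀ {k n} f → k ℕ.≤ n → (∀ i → k ℕ.≤ i → f i ≡ 0ℚ) → rsum n f ≡ rsum k f
rsum-pad {k} {n} f k≤n eq = begin
  rsum n f                                       ≡⟨ cong (λ i → rsum i f) (ℕₚ.m+[n∸m]≡n k≤n) ⟨
  rsum (k ℕ.+ (n ℕ.∸ k)) f                       ≡⟨ rsum-+ k (n ℕ.∸ k) f ⟩
  rsum k f + rsum (n ℕ.∸ k) (f ∘ (k ℕ.+_))       ≡⟨ cong (_+_ (rsum k f)) (rsum-0 (n ℕ.∸ k) λ i _ → eq (k ℕ.+ i) (ℕₚ.m≤m+n k i)) ⟩
  rsum k f + 0ℚ                                  ≡⟨ ℚₚ.+-identityʳ (rsum k f) ⟩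
  rsum k f                                       ∎
  where open ≡-Reasoning

-- The nodes of a binary tree are numbered as in a heap.
Sel : ℕ → Set
Sel zero    = Bool
Sel (suc h) = Sel h × Sel h

left right : ℕ → ℕ
left  x = 2 ℕ.* x
right x = suc (2 ℕ.* x)

tot : ∀ h → ℕ → Sel h → (ℕ → ℚ) → ℚ
tot zero    x s       f = pick s (f x)
tot (suc h) x (s , t) f = tot h (left x) s f + tot h (right x) t f

tab : ∀ h → ℕ → (ℕ → Bool) → Sel h
tab zero    x φ = φ x
tab (suc h) x φ = tab h (left x) φ , tab h (right x) φ

left-leaf : ∀ x p → (2 ℕ.* x) ℕ.* p ≡ x ℕ.* (2 ℕ.* p)
left-leaf = ℕ-solve

right-leaf : ∀ x p → (1 ℕ.+ 2 ℕ.* x) ℕ.* p ≡ x ℕ.* (2 ℕ.* p) ℕ.+ p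
right-leaf = ℕ-solve

end-right : ∀ x p → (2 ℕ.+ 2 ℕ.* x) ℕ.* p ≡ (1 ℕ.+ x) ℕ.* (2 ℕ.* p)
end-right = ℕ-solve

leaves-left : ∀ x h → left x ℕ.* 2 ℕ.^ h ≡ x ℕ.* 2 ℕ.^ suc h
leaves-left x h = left-leaf x (2 ℕ.^ h)

leaves-right : ∀ x h → right x ℕ.* 2 ℕ.^ h ≡ x ℕ.* 2 ℕ.^ suc h ℕ.+ 2 ℕ.^ h
leaves-right x h = right-leaf x (2 ℕ.^ h)

tab-cong : ∀ h x {φ ψ} → (∀ y → x ℕ.* 2 ℕ.^ h ℕ.≤ y → y ℕ.< suc x ℕ.* 2 ℕ.^ h → φ y ≡ ψ y) →
           tab h x φ ≡ tab h x ψ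
tab-cong zero    x eq = eq x (ℕₚ.≤-reflexive (ℕₚ.*-identityʳ x)) (ℕₚ.≤-reflexive (sym (ℕₚ.*-identityʳ (suc x))))
tab-cong (suc h) x eq = cong₂ _,_
  (tab-cong h (left x) λ y lo hi → eq y (ℕₚ.≤-trans (ℕₚ.≤-reflexive (sym (leaves-left x h))) lo)
    (ℕₚ.<-≤-trans hi (ℕₚ.≤-trans (ℕₚ.*-monoˡ-≤ (2 ℕ.^ h) (ℕₚ.n≤1+n (suc (left x)))) (ℕₚ.≤-reflexive (end-right x (2 ℕ.^ h))))))
  (tab-cong h (right x) λ y lo hi → eq y
    (ℕₚ.≤-trans (ℕₚ.m≤m+n _ (2 ℕ.^ h)) (ℕₚ.≤-trans (ℕₚ.≤-reflexive (sym (leaves-right x h))) lo))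
    (ℕₚ.<-≤-trans hi (ℕₚ.≤-reflexive (end-right x (2 ℕ.^ h)))))

-- Turns the nested pair stored at the root into a predicate on leaf numbers, the form in which it
-- can be decoded. The halves occupy disjoint ranges, so their predicates are glued at the first
-- leaf of the right half.
tab-surjective : ∀ h x (s : Sel h) → ∃[ φ ] tab h x φ ≡ s
tab-surjective zero    x s       = (λ _ → s) , refl
tab-surjective (suc h) x (s , t) with tab-surjective h (left x) s | tab-surjective h (right x) t
... | φ , refl | ψ , refl = χ , cong₂ _,_ (tab-cong h (left x) below) (tab-cong h (right x) above)
  where
  χ : ℕ → Bool
  χ y = if does (y ℕₚ.<? right x ℕ.* 2 ℕ.^ h) then φ y else ψ y
  below : ∀ y → _ → y ℕ.< suc (left x) ℕ.* 2 ℕ.^ h → χ y ≡ φ y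
  below y _ y< = cong (λ b → if b then φ y else ψ y)
    (dec-true (y ℕₚ.<? right x ℕ.* 2 ℕ.^ h) y<)
  above : ∀ y → right x ℕ.* 2 ℕ.^ h ℕ.≤ y → _ → χ y ≡ ψ y
  above y y≥ _ = cong (λ b → if b then φ y else ψ y)
    (dec-false (y ℕₚ.<? right x ℕ.* 2 ℕ.^ h) (ℕₚ.≤⇒≯ y≥))

tot-tab : ∀ h x φ f → tot h x (tab h x φ) f ≡
          rsum (2 ℕ.^ h) (λ p → pick (φ (x ℕ.* 2 ℕ.^ h ℕ.+ p)) (f (x ℕ.* 2 ℕ.^ h ℕ.+ p)))
tot-tab zero x φ f = trans (cong (λ y → pick (φ y) (f y)) (sym (trans (ℕₚ.+-identityʳ (x ℕ.* 1)) (ℕₚ.*-identityʳ x))))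
  (sym (ℚₚ.+-identityˡ _))
tot-tab (suc h) x φ f = begin
  tot h (left x) (tab h (left x) φ) f + tot h (right x) (tab h (right x) φ) f
    ≡⟨ cong₂ _+_ (tot-tab h (left x) φ f) (tot-tab h (right x) φ f) ⟩
  rsum p (λ i → g (left x ℕ.* p ℕ.+ i)) + rsum p (λ i → g (right x ℕ.* p ℕ.+ i))
    ≡⟨ cong₂ _+_ (rsum-cong p λ i _ → cong (λ y → g (y ℕ.+ i)) (leaves-left x h))
                 (rsum-cong p λ i _ → cong g (trans (cong (ℕ._+ i) (leaves-right x h)) (ℕₚ.+-assoc (x ℕ.* 2 ℕ.^ suc h) p i))) ⟩
  rsum p g′ + rsum p (g′ ∘ (p ℕ.+_))
    ≡⟨ rsum-+ p p g′ ⟨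
  rsum (p ℕ.+ p) g′
    ≡⟨ cong (λ i → rsum (p ℕ.+ i) g′) (ℕₚ.+-identityʳ p) ⟨
  rsum (2 ℕ.^ suc h) g′ ∎
  where
  open ≡-Reasoning
  p = 2 ℕ.^ h
  g g′ : ℕ → ℚ
  g y = pick (φ y) (f y)
  g′ i = g (x ℕ.* 2 ℕ.^ suc h ℕ.+ i)

0≤pick : ∀ s {x} → 0ℚ ≤ x → 0ℚ ≤ pick s x
0≤pick true  0≤x = 0≤x
0≤pick false _   = ℚₚ.≤-refl

0≤tot : ∀ {f} → (∀ y → 0ℚ ≤ f y) → ∀ h x s → 0ℚ ≤ tot h x s f
0≤tot 0≤f zero    x s       = 0≤pick s (0≤f x)
0≤tot 0≤f (suc h) x (s , t) = 0≤+ (0≤tot 0≤f h (left x) s) (0≤tot 0≤f h (right x) t)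

≤+ˡ : ∀ {p q} → 0ℚ ≤ q → p ≤ p + q
≤+ˡ {q = q} 0≤q = ≤-by q 0≤q refl

≤+ʳ : ∀ {p q} → 0ℚ ≤ p → q ≤ p + q
≤+ʳ {p} {q} 0≤p = ≤-by p 0≤p (ℚₚ.+-comm p q)

-- Every node x carries an interval [ lo x , hi x ] for the weight below it.
module Bounds (w lo hi : ℕ → ℚ) where

  -- Leaves carry no condition. Since `Padded` guarantees `1≤b`, a category is never a leaf and no
  -- bound is lost.
  Exact : ∀ h → ℕ → Sel h → Set
  Exact zero    x s = ⊤
  Exact (suc h) x s = lo x ≤ tot (suc h) x s w × tot (suc h) x s w ≤ hi x ×
                      Exact h (left x) (proj₁ s) × Exact h (right x) (proj₂ s)

  Approx : ℚ → ∀ h → ℕ → Sel h → Set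
  Approx ε zero    x s = ⊤
  Approx ε (suc h) x s = (1ℚ - ε) * lo x ≤ tot (suc h) x s w × tot (suc h) x s w ≤ (1ℚ + ε) * hi x ×
                         Approx ε h (left x) (proj₁ s) × Approx ε h (right x) (proj₂ s)

-- Bucket 0 holds the weight 0, and bucket k + 1 the weights in [ μ ρᵏ , μ ρᵏ⁺¹ ).
grid : (μ ρ : ℚ) → ℕ → ℚ
grid μ ρ zero    = 0ℚ
grid μ ρ (suc k) = μ * ρ ^ k

module Buckets (μ ρ : ℚ) (1≤ρ : 1ℚ ≤ ρ) where

  G : ℕ → ℚ
  G = grid μ ρ

  0≤ρ : 0ℚ ≤ ρ
  0≤ρ = ℚₚ.≤-trans 0≤1 1≤ρ

  InBucket : ℕ → ℚ → Set
  InBucket k W = G k ≤ W × W < G (suc k)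

  -- A sum of item weights is 0 or at least the least positive weight, so that bucket 0 contains
  -- nothing but the weight 0. The sign of `μ` is left open here, hence the separate `0ℚ ≤ W`.
  Discrete : ℚ → Set
  Discrete W = W ≡ 0ℚ ⊎ (0ℚ ≤ W × μ ≤ W)

  discrete-0≤ : ∀ {W} → Discrete W → 0ℚ ≤ W
  discrete-0≤ (inj₁ refl)      = ℚₚ.≤-refl
  discrete-0≤ (inj₂ (0≤W , _)) = 0≤W

  discrete-+ : ∀ {W W′} → Discrete W → Discrete W′ → Discrete (W + W′)
  discrete-+ {W′ = W′} (inj₁ refl) d′ = subst Discrete (sym (ℚₚ.+-identityˡ W′)) d′
  discrete-+ (inj₂ (0≤W , μ≤W)) d′ = inj₂ (0≤+ 0≤W (discrete-0≤ d′) , ℚₚ.≤-trans μ≤W (≤+ˡ (discrete-0≤ d′)))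

  discrete-tot : ∀ {w} → (∀ y → Discrete (w y)) → ∀ h x s → Discrete (tot h x s w)
  discrete-tot d zero    x true    = d x
  discrete-tot d zero    x false   = inj₁ refl
  discrete-tot d (suc h) x (s , t) = discrete-+ (discrete-tot d h (left x) s) (discrete-tot d h (right x) t)

  -- Descend from the top until a grid point is at most `W`; the lowest grid point is 0, so the
  -- descent succeeds.
  find-bucket : ∀ k {W} → 0ℚ ≤ W → W < G k → ∃[ j ] (j ℕ.< k × InBucket j W)
  find-bucket zero    0≤W W<0 = ⊥-elim (<⇒≱ W<0 0≤W)
  find-bucket (suc k) {W} 0≤W W<G with G k ℚₚ.≤? W
  ... | yes G≤W = k , ℕₚ.≤-refl , G≤W , W<G
  ... | no  G≰W with find-bucket k 0≤W (ℚₚ.≰⇒> G≰W)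
  ...   | j , j<k , bucket = j , ℕₚ.m≤n⇒m≤1+n j<k , bucket

  -- The endpoints of a positive bucket have ratio `ρ`. In bucket 0 no ratio would be bounded, but
  -- there discreteness forces `W` to be 0.
  bucket-ratio : ∀ k {W W′} → Discrete W → Discrete W′ → InBucket k W → InBucket k W′ → W ≤ ρ * W′
  bucket-ratio k {W} {W′} (inj₁ refl) d′ _ _ = 0≤* 0≤ρ (discrete-0≤ d′)
  bucket-ratio zero {W} (inj₂ (_ , μ≤W)) d′ (_ , W<μ) _ = ⊥-elim (<⇒≱ (subst (W <_) (ℚₚ.*-identityʳ μ) W<μ) μ≤W)
  bucket-ratio (suc k) {W} {W′} (inj₂ _) d′ (_ , W<) (≤W′ , _) = begin
    W                     ≤⟨ ℚₚ.<⇒≤ W< ⟩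
    μ * (ρ * ρ ^ k)       ≡⟨ lemma μ ρ (ρ ^ k) ⟩
    ρ * (μ * ρ ^ k)       ≤⟨ *-monoˡ ρ 0≤ρ ≤W′ ⟩
    ρ * W′                ∎
    where
    open ℚₚ.≤-Reasoning
    lemma : ∀ μ ρ r → μ * (ρ * r) ≡ ρ * (μ * r)
    lemma = ring-solve ℚ-ring

  -- The index counts roundings. The relation is compatible with addition at a fixed index, so
  -- errors accumulate along a path but not across siblings.
  Close : ℕ → ℚ → ℚ → Set
  Close e A W = A ≤ ρ ^ e * W × W ≤ ρ ^ e * A

  close-refl : ∀ A → Close 0 A A
  close-refl A = ℚₚ.≤-reflexive (sym (ℚₚ.*-identityˡ A)) , ℚₚ.≤-reflexive (sym (ℚₚ.*-identityˡ A))

  close-+ : ∀ e {A W A′ W′} → Close e A W → Close e A′ W′ → Close e (A + A′) (W + W′)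
  close-+ e {A} {W} {A′} {W′} (A≤ , W≤) (A′≤ , W′≤) =
    ℚₚ.≤-trans (ℚₚ.+-mono-≤ A≤ A′≤) (ℚₚ.≤-reflexive (sym (ℚₚ.*-distribˡ-+ (ρ ^ e) W W′))) ,
    ℚₚ.≤-trans (ℚₚ.+-mono-≤ W≤ W′≤) (ℚₚ.≤-reflexive (sym (ℚₚ.*-distribˡ-+ (ρ ^ e) A A′)))

  close-bucket : ∀ e k {A W W′} → Discrete W → Discrete W′ → InBucket k W → InBucket k W′ →
                 Close e A W → Close (suc e) A W′
  close-bucket e k {A} {W} {W′} d d′ i i′ (A≤ , W≤) = (begin
    A                    ≤⟨ A≤ ⟩
    ρ ^ e * W            ≤⟨ *-monoˡ (ρ ^ e) (0≤^ 0≤ρ e) (bucket-ratio k d d′ i i′) ⟩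
    ρ ^ e * (ρ * W′)     ≡⟨ lemma (ρ ^ e) ρ W′ ⟩
    ρ * ρ ^ e * W′       ∎) , (begin
    W′                   ≤⟨ bucket-ratio k d′ d i′ i ⟩
    ρ * W                ≤⟨ *-monoˡ ρ 0≤ρ W≤ ⟩
    ρ * (ρ ^ e * A)      ≡⟨ ℚₚ.*-assoc ρ (ρ ^ e) A ⟨
    ρ * ρ ^ e * A        ∎)
    where
    open ℚₚ.≤-Reasoning
    lemma : ∀ r ρ W → r * (ρ * W) ≡ ρ * r * W
    lemma = ring-solve ℚ-ring

  module _ {ε : ℚ} (0≤ε : 0ℚ ≤ ε) {e : ℕ} (ρᵉ≤ : ρ ^ e ≤ 1ℚ + ε) where

    close-upper : ∀ {A W u} → 0ℚ ≤ A → Close e A W → A ≤ u → W ≤ (1ℚ + ε) * u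
    close-upper {A} {W} {u} 0≤A (_ , W≤) A≤u =
      ℚₚ.≤-trans W≤ (*-mono (0≤+ 0≤1 0≤ε) 0≤A ρᵉ≤ A≤u)

    -- In substance 1 - ε ≤ 1 / (1 + ε), applied to l ≤ (1 + ε) W. The case split on whether `l` or
    -- `W` is larger replaces the division and covers ε > 1 as well.
    close-lower : ∀ {A W l} → 0ℚ ≤ l → 0ℚ ≤ W → Close e A W → l ≤ A → (1ℚ - ε) * l ≤ W
    close-lower {A} {W} {l} 0≤l 0≤W (A≤ , _) l≤A with ℚₚ.≤-total l W
    ... | inj₁ l≤W = ℚₚ.≤-trans (≤-by (ε * l) (0≤* 0≤ε 0≤l) (lemma ε l)) l≤W
      where
      lemma : ∀ ε l → l ≡ (1ℚ - ε) * l + ε * l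
      lemma = ring-solve ℚ-ring
    ... | inj₂ W≤l = ≤-by ((1ℚ + ε) * W - l + ε * (l - W))
      (0≤+ (0≤- (ℚₚ.≤-trans l≤A (ℚₚ.≤-trans A≤ (*-monoʳ W 0≤W ρᵉ≤)))) (0≤* 0≤ε (0≤- W≤l))) (lemma ε l W)
      where
      lemma : ∀ ε l W → W ≡ (1ℚ - ε) * l + ((1ℚ + ε) * W - l + ε * (l - W))
      lemma = ring-solve ℚ-ring

-- The table of a node

-- Natural arrays of the program, besides those of the input and output.
#m′ #n′ #N #E #K #i #j #t #a #b #k #x : ℕ
#m′ = 3
#n′ = 4
#N  = 5
#E  = 6
#K  = 7
#i  = 8
#j  = 9
#t  = 10
#a  = 11
#b  = 12
#k  = 13
#x  = 14

-- Rational arrays.  Row x of $W, $V and $C is the table of node x: its k-th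
-- entry holds the weight, 1 + the value and the code of a selection of leaves
-- below x with weight in bucket k; it is empty when the $V-entry is 0.
$w $v $l $u $B $μ $G $W $V $C $lo $hi $eW $eV $eC $ρ $p $best $code : ℕ
$w    = 0
$v    = 1
$l    = 2
$u    = 3
$B    = 4
$μ    = 5
$G    = 6
$W    = 7
$V    = 8
$C    = 9
$lo   = 10
$hi   = 11
$eW   = 12
$eV   = 13
$eC   = 14
$ρ    = 15
$p    = 16
$best = 17
$code = 18

nodeE leftE rightE : Exp nat
nodeE  = scalar nat #x
leftE  = lit 2 :* nodeE
rightE = lit 1 :+ leftE

-- The machine has no logarithm, so the bucket of a weight is found by scanning all of them; this is
-- the third factor K in the cost of a merge. A candidate has a $V-value of at least 1, hence it
-- always beats an empty entry.
insertBody : Program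
insertBody =
  If (read rat $G (lit 0) (scalar nat #k) :≤ scalar rat $eW)
    (If (scalar rat $eW :< read rat $G (lit 0) (lit 1 :+ scalar nat #k))
      (If (read rat $V nodeE (scalar nat #k) :< scalar rat $eV)
        (write rat $W nodeE (scalar nat #k) (scalar rat $eW) ⨾
         write rat $V nodeE (scalar nat #k) (scalar rat $eV) ⨾
         write rat $C nodeE (scalar nat #k) (scalar rat $eC))
        skip) skip) skip

insert : Program
insert = Down #k (scalar nat #K) insertBody

mergeBody : ℚ → Program
mergeBody ε =
  If (lit 0ℚ :< read rat $V leftE (scalar nat #a))
    (If (lit 0ℚ :< read rat $V rightE (scalar nat #b))
      (assign rat $eW (read rat $W leftE (scalar nat #a) :+ read rat $W rightE (scalar nat #b)) ⨾
       -- Both summands carry the offset 1 that marks nonempty entries; the sum must carry it once.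
       assign rat $eV ((read rat $V leftE (scalar nat #a) :+ read rat $V rightE (scalar nat #b)) :- lit 1ℚ) ⨾
       assign rat $eC (read rat $C leftE (scalar nat #a) :+ read rat $C rightE (scalar nat #b)) ⨾
       -- The test is made at every node. Away from the categories the interval is [ 0 , B ], so it
       -- also keeps all weights within the range of the grid.
       If (lit (1ℚ - ε) :* scalar rat $lo :≤ scalar rat $eW)
         (If (scalar rat $eW :≤ lit (1ℚ + ε) :* scalar rat $hi) insert skip)
         skip)
      skip) skip

merge : ℚ → Program
merge ε = Down #a (scalar nat #K) (Down #b (scalar nat #K) (mergeBody ε))

cell : Memory → ℕ → ℕ → ℚ × ℚ × ℚ
cell M x k = M rat $W x k , M rat $V x k , M rat $C x k

writeCell : Memory → ℕ → ℕ → ℚ × ℚ × ℚ → Memory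
writeCell M x k (W , V , C) = update (update (update M rat $W x k W) rat $V x k V) rat $C x k C

cell-written : ∀ M x k e → cell (writeCell M x k e) x k ≡ e
cell-written M x k e rewrite ≡ᵇ-refl x | ≡ᵇ-refl k = refl

cell-unwritten : ∀ M x k e y j → (y ≡ x → j ≡ k → ⊥) → cell (writeCell M x k e) y j ≡ cell M y j
cell-unwritten M x k e y j ne with x ℕ.≡ᵇ y in eq₁ | k ℕ.≡ᵇ j in eq₂
... | false | _     = refl
... | true  | false = refl
... | true  | true  = ⊥-elim (ne (sym (≡ᵇ-sound x y eq₁)) (sym (≡ᵇ-sound k j eq₂)))

-- The numerals in the time bounds are the costs of straight-line code.
insertTime : ℕ → ℕ
insertTime K = downTime #k (scalar nat #K) K 67

mergeBodyTime : ℕ → ℕ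
mergeBodyTime K = 120 ℕ.+ (insertTime K ℕ.+ 1 ℕ.+ 1 ℕ.+ 1 ℕ.+ 1)

mergeTime : ℕ → ℕ
mergeTime K = downTime #a (scalar nat #K) K (downTime #b (scalar nat #K) K (mergeBodyTime K))

-- Category i is the node m + i, for m categories.
atCategory : (m x : ℕ) → ℚ → ℚ → ℚ
atCategory m x p q = if does (m ℕₚ.≤? x) then (if does (x ℕₚ.<? 2 ℕ.* m) then p else q) else q

-- A set of leaves is encoded in a single memory cell by the sum of their codes.
leafCode : ℕ → ℕ → ℚ
leafCode H y = ½ ^ (2 ℕ.^ suc H ℕ.∸ y)

leafCode-half : ∀ H {y} → y ℕ.< 2 ℕ.^ suc H → ½ * leafCode H (suc y) ≡ leafCode H y
leafCode-half H {y} y< = cong (½ ^_) (sym (ℕₚ.+-∸-assoc 1 y<))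

-- The padded problem as the tree sees it. The data are functions on all natural numbers, so that no
-- bounds on indices have to accompany the reads from memory.
record Setting : Set where
  field
    a b K   : ℕ
    w v l u : ℕ → ℚ
    μ ρ B ε : ℚ
    1≤ρ         : 1ℚ ≤ ρ
    w-discrete  : ∀ y → Buckets.Discrete μ ρ 1≤ρ (w y)
    0≤v         : ∀ y → 0ℚ ≤ v y
    0≤l         : ∀ i → 0ℚ ≤ l i
    0≤ε         : 0ℚ ≤ ε
    -- The leaves are rounded too, so a path from a leaf to the root meets one more rounding than
    -- the height of the root.
    ρᴴ≤         : ρ ^ suc (a ℕ.+ b) ≤ 1ℚ + ε
    -- Buckets 0 to K - 1 thus cover all weights that pass the relaxed capacity test.
    cap         : (1ℚ + ε) * B < grid μ ρ K

  H : ℕ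
  H = a ℕ.+ b

  lo hi c : ℕ → ℚ
  lo x = atCategory (2 ℕ.^ a) x (l (x ℕ.∸ 2 ℕ.^ a)) 0ℚ
  hi x = atCategory (2 ℕ.^ a) x (u (x ℕ.∸ 2 ℕ.^ a)) B
  c    = leafCode H

  0≤lo : ∀ x → 0ℚ ≤ lo x
  0≤lo x with does (2 ℕ.^ a ℕₚ.≤? x) | does (x ℕₚ.<? 2 ℕ.* 2 ℕ.^ a)
  ... | true  | true  = 0≤l (x ℕ.∸ 2 ℕ.^ a)
  ... | true  | false = ℚₚ.≤-refl
  ... | false | _     = ℚₚ.≤-refl

module Tables (S : Setting) where

  open Setting S hiding (a; b)
  open Buckets μ ρ 1≤ρ
  open Bounds w lo hi

  Grid : Memory → Set
  Grid M = M nat #K 0 0 ≡ K × (∀ k → k ℕ.≤ K → M rat $G 0 k ≡ G k)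

  Entry : ∀ h → ℕ → ℕ → ℚ × ℚ × ℚ → Set
  Entry h x k (W , V , C) = Σ[ s ∈ Sel h ]
    (tot h x s w ≡ W × 1ℚ + tot h x s v ≡ V × tot h x s c ≡ C × InBucket k W × Approx ε h x s)

  Sound : ∀ h → ℕ → Memory → Set
  Sound h x M = ∀ k → k ℕ.< K → 0ℚ < M rat $V x k → Entry h x k (cell M x k)

  -- Closeness of the weights is what makes this inductive: the stand-ins of two siblings then join
  -- to a stand-in of the pair. The index `suc h` counts the rounding at the leaf and one at each of
  -- the `h` levels above it.
  Complete : ∀ h → ℕ → Memory → Set
  Complete h x M = ∀ s → Exact h x s → tot h x s w ≤ B →
    ∃[ k ] (k ℕ.< K × 1ℚ + tot h x s v ≤ M rat $V x k × Close (suc h) (tot h x s w) (M rat $W x k))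

  -- The effect of an insertion in a form that composes. As values never decrease, a lower bound
  -- reached by one insertion outlasts the replacement of the entry by a better one.
  record RowStep (h x : ℕ) (M M′ : Memory) : Set where
    field
      others   : ∀ y k → y ≢ x → cell M′ y k ≡ cell M y k
      monotone : ∀ k → M rat $V x k ≤ M′ rat $V x k
      sound    : Sound h x M → Sound h x M′

  open RowStep

  rowStep-refl : ∀ {h x M} → RowStep h x M M
  rowStep-refl = record { others = λ _ _ _ → refl ; monotone = λ _ → ℚₚ.≤-refl ; sound = id }

  rowStep-trans : ∀ {h x M M′ M″} → RowStep h x M M′ → RowStep h x M′ M″ → RowStep h x M M″
  rowStep-trans f g = record
    { others   = λ y k y≢x → trans (others g y k y≢x) (others f y k y≢x)
    ; monotone = λ k → ℚₚ.≤-trans (monotone f k) (monotone g k)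
    ; sound    = sound g ∘ sound f }

  rowStep-cells : ∀ {h x M M′ M″} → RowStep h x M M′ → (∀ y k → cell M″ y k ≡ cell M′ y k) → RowStep h x M M″
  rowStep-cells {h} {x} {M′ = M′} {M″} f same = rowStep-trans f record
    { others   = λ y k _ → same y k
    ; monotone = λ k → ℚₚ.≤-reflexive (sym (cong (proj₁ ∘ proj₂) (same x k)))
    ; sound    = λ s k k<K 0<V → subst (Entry h x k) (sym (same x k))
                   (s k k<K (subst (0ℚ <_) (cong (proj₁ ∘ proj₂) (same x k)) 0<V)) }

  rowStep-write : ∀ {h x M} k e → M rat $V x k ≤ proj₁ (proj₂ e) → Entry h x k e →
                  RowStep h x M (writeCell M x k e)
  rowStep-write {h} {x} {M} k e V≤ entry = record
    { others   = λ y j y≢x → cell-unwritten M x k e y j λ y≡x _ → y≢x y≡x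
    ; monotone = mono
    ; sound    = snd }
    where
    mono : ∀ j → M rat $V x j ≤ writeCell M x k e rat $V x j
    mono j with j ℕₚ.≟ k
    ... | yes refl = subst (M rat $V x k ≤_) (sym (cong (proj₁ ∘ proj₂) (cell-written M x k e))) V≤
    ... | no  j≢k  = ℚₚ.≤-reflexive (sym (cong (proj₁ ∘ proj₂) (cell-unwritten M x k e x j λ _ → j≢k)))
    snd : Sound h x M → Sound h x (writeCell M x k e)
    snd s j j<K 0<V with j ℕₚ.≟ k
    ... | yes refl = subst (Entry h x k) (sym (cell-written M x k e)) entry
    ... | no  j≢k  = subst (Entry h x j) (sym same) (s j j<K (subst (0ℚ <_) (cong (proj₁ ∘ proj₂) same) 0<V))
      where
      same = cell-unwritten M x k e x j λ _ → j≢k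

  run-insert : ∀ {h x M W V C} → Grid M → M nat #x 0 0 ≡ x →
    M rat $eW 0 0 ≡ W → M rat $eV 0 0 ≡ V → M rat $eC 0 0 ≡ C →
    (∀ k → InBucket k W → Entry h x k (W , V , C)) →
    Run insert M (insertTime K)
      (λ M′ → RowStep h x M M′ × (∀ k → k ℕ.< K → InBucket k W → V ≤ M′ rat $V x k))
  run-insert {h} {x} {M₀} {W} {V} {C} grid₀ x≡₀ W≡₀ V≡₀ C≡₀ entry =
    run-weaken ℕₚ.≤-refl (λ { M′ _ ((_ , _ , _ , _ , _ , r) , q) → r , q })
      (run-for P Q K refl (proj₁ grid₀) (grid₀ , x≡₀ , W≡₀ , V≡₀ , C≡₀ , rowStep-cells rowStep-refl λ _ _ → refl) body)
    where
    P : Memory → Set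
    P M = Grid M × M nat #x 0 0 ≡ x × M rat $eW 0 0 ≡ W × M rat $eV 0 0 ≡ V × M rat $eC 0 0 ≡ C × RowStep h x M₀ M
    Q : ℕ → Memory → Set
    Q k M = InBucket k W → V ≤ M rat $V x k
    body : ∀ k M → k ℕ.< K → P M →
           Run insertBody (update M nat #k 0 0 k) 67 (λ M′ → P M′ × Q k M′ × (∀ j → j ℕ.< K → Q j M → Q j M′))
    body k M k<K ((K≡ , G≡) , refl , refl , refl , refl , r) = run-if
      (λ t₁ → run-if
        (λ t₂ → run-if
          (λ t₃ → let step = rowStep-write {M = M} k (W , V , C) (ℚₚ.<⇒≤ (<-true t₃)) (entry k (bucket t₁ t₂)) in
            run-write-seq (run-write-seq (run-write
              ( ((K≡ , G≡) , refl , refl , refl , refl , rowStep-cells (rowStep-trans r step) λ _ _ → refl)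
              , (λ _ → ℚₚ.≤-reflexive (sym (cong (proj₁ ∘ proj₂) (cell-written M x k (W , V , C)))))
              , λ j _ q i → ℚₚ.≤-trans (q i) (monotone step j) ))))
          (λ t₃ → run-skip (p , (λ _ → <-false t₃) , λ _ _ q → q)))
        (λ t₂ → run-skip (p , (λ { (_ , W<) → ⊥-elim (<⇒≱ W< (subst (_≤ W) (G≡ (suc k) k<K) (<-false t₂))) }) , λ _ _ q → q)))
      (λ t₁ → run-skip (p , (λ { (≤W , _) → ⊥-elim (<⇒≱ (subst (W <_) (G≡ k (ℕₚ.<⇒≤ k<K)) (≤-false t₁)) ≤W) }) , λ _ _ q → q))
      where
      p : P (update M nat #k 0 0 k)
      p = (K≡ , G≡) , refl , refl , refl , refl , rowStep-cells r λ _ _ → refl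
      bucket : _ → _ → InBucket k W
      bucket t₁ t₂ = subst (_≤ W) (G≡ k (ℕₚ.<⇒≤ k<K)) (≤-true t₁) , subst (W <_) (G≡ (suc k) k<K) (<-true t₂)

  weight value code : ℚ × ℚ × ℚ → ℚ
  weight = proj₁
  value  = proj₁ ∘ proj₂
  code   = proj₂ ∘ proj₂

  join : ℚ × ℚ × ℚ → ℚ × ℚ × ℚ → ℚ × ℚ × ℚ
  join e e′ = weight e + weight e′ , value e + value e′ - 1ℚ , code e + code e′

  -- The contribution of one pair of child entries. It speaks of the value in the bucket and not of
  -- the entry itself, which a more valuable pair may have taken over.
  Covered : ℕ → ℚ × ℚ × ℚ → ℚ × ℚ × ℚ → Memory → Set
  Covered x e e′ M = 0ℚ < value e → 0ℚ < value e′ →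
    (1ℚ - ε) * lo x ≤ weight (join e e′) → weight (join e e′) ≤ (1ℚ + ε) * hi x →
    ∀ k → k ℕ.< K → InBucket k (weight (join e e′)) → value (join e e′) ≤ M rat $V x k

  covered-mono : ∀ {h x M M′} e e′ → RowStep h x M M′ → Covered x e e′ M → Covered x e e′ M′
  covered-mono e e′ r q p p′ l u k k<K i = ℚₚ.≤-trans (q p p′ l u k k<K i) (monotone r k)

  join-entry : ∀ {h x k j j′ e e′} → (1ℚ - ε) * lo x ≤ weight (join e e′) → weight (join e e′) ≤ (1ℚ + ε) * hi x →
               Entry h (left x) j e → Entry h (right x) j′ e′ → InBucket k (weight (join e e′)) →
               Entry (suc h) x k (join e e′)
  join-entry {h} {x} l u (s , refl , refl , refl , _ , ok) (t , refl , refl , refl , _ , ok′) i =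
    (s , t) , refl , lemma (tot h (left x) s v) (tot h (right x) t v) , refl , i , l , u , ok , ok′
    where
    lemma : ∀ p q → 1ℚ + (p + q) ≡ (1ℚ + p) + (1ℚ + q) - 1ℚ
    lemma = ring-solve ℚ-ring

  run-mergeBody : ∀ {h x a b M} → Grid M → M nat #x 0 0 ≡ x → M nat #a 0 0 ≡ a → M nat #b 0 0 ≡ b →
    M rat $lo 0 0 ≡ lo x → M rat $hi 0 0 ≡ hi x →
    Sound h (left x) M → Sound h (right x) M → a ℕ.< K → b ℕ.< K →
    Run (mergeBody ε) M (mergeBodyTime K)
      (λ M′ → RowStep (suc h) x M M′ × Covered x (cell M (left x) a) (cell M (right x) b) M′)
  run-mergeBody {h} {x} {a} {b} {M} grid refl refl refl lo≡ hi≡ soundˡ soundʳ a<K b<K = run-if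
    (λ t₁ → run-if
      (λ t₂ → run-write-seq (run-write-seq (run-write-seq (run-if
        (λ t₃ → run-if
          (λ t₄ → run-weaken ℕₚ.≤-refl
            (λ M′ _ (r , q) → rowStep-trans (rowStep-cells rowStep-refl λ _ _ → refl) r , λ _ _ _ _ → q)
            (run-insert {x = x} {W = weight e} {value e} {code e} grid refl refl refl refl
              λ k → join-entry {h} {x} {k} {a} {b} (subst (λ z → (1ℚ - ε) * z ≤ weight e) lo≡ (≤-true t₃))
                               (subst (λ z → weight e ≤ (1ℚ + ε) * z) hi≡ (≤-true t₄))
                               (soundˡ a a<K (<-true t₁)) (soundʳ b b<K (<-true t₂))))
          (λ t₄ → run-skip (rowStep-cells rowStep-refl (λ _ _ → refl) ,
             λ _ _ _ u → ⊥-elim (<⇒≱ (subst (λ z → (1ℚ + ε) * z < weight e) hi≡ (≤-false t₄)) u))))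
        (λ t₃ → run-skip (rowStep-cells rowStep-refl (λ _ _ → refl) ,
           λ _ _ l _ → ⊥-elim (<⇒≱ (subst (λ z → weight e < (1ℚ - ε) * z) lo≡ (≤-false t₃)) l)))))))
      (λ t₂ → run-skip (rowStep-refl , λ _ p → ⊥-elim (<⇒≱ p (<-false t₂)))))
    (λ t₁ → run-skip (rowStep-refl , λ p → ⊥-elim (<⇒≱ p (<-false t₁))))
    where
    e = join (cell M (left x) a) (cell M (right x) b)

  Good : ∀ h → ℕ → Memory → Set
  Good h x M = Sound h x M × Complete h x M

  entry-discrete : ∀ h x k {e} → Entry h x k e → Discrete (weight e)
  entry-discrete h x k (s , w≡ , _) = subst Discrete w≡ (discrete-tot w-discrete h x s)

  entry-bucket : ∀ h x k {e} → Entry h x k e → InBucket k (weight e)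
  entry-bucket h x k (_ , _ , _ , _ , i , _) = i

  0<1+tot : ∀ h x s → 0ℚ < 1ℚ + tot h x s v
  0<1+tot h x s = ℚₚ.<-≤-trans 0<1 (≤+ˡ (0≤tot 0≤v h x s))

  -- Rounding costs one factor ρ: the entry that supersedes W lies in the same bucket.
  settle : ∀ {h x k M W V} e s → Sound h x M → k ℕ.< K → Discrete W → InBucket k W →
           V ≤ M rat $V x k → 1ℚ + tot h x s v ≤ V → Close e (tot h x s w) W →
           1ℚ + tot h x s v ≤ M rat $V x k × Close (suc e) (tot h x s w) (M rat $W x k)
  settle {h} {x} {k} {M} e s sound k<K d i V≤ tot≤V close =
    tot≤ , close-bucket e k d (entry-discrete h x k entry) i (entry-bucket h x k entry) close
    where
    tot≤ = ℚₚ.≤-trans tot≤V V≤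
    entry = sound k k<K (ℚₚ.<-≤-trans (0<1+tot h x s) tot≤)

  ρ^≤ : ∀ {h} → h ℕ.≤ H → ρ ^ suc h ≤ 1ℚ + ε
  ρ^≤ h≤H = ℚₚ.≤-trans (^-monoʳ 1≤ρ (s≤s h≤H)) ρᴴ≤

  -- An exact selection splits into two exact ones, whose stand-ins are joined. Their total weight
  -- is within a factor ρʰ⁺¹ of the exact one, so the pair passes the relaxed tests and is offered
  -- to its bucket. Whatever occupies that bucket in the end is at least as valuable and differs by
  -- one more factor `ρ`.
  merge-complete : ∀ {h x M M′} → h ℕ.≤ H → Good h (left x) M → Good h (right x) M → Sound (suc h) x M′ →
                   (∀ a → a ℕ.< K → ∀ b → b ℕ.< K → Covered x (cell M (left x) a) (cell M (right x) b) M′) →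
                   Complete (suc h) x M′
  merge-complete {h} {x} {M} {M′} h≤H (soundˡ , completeˡ) (soundʳ , completeʳ) sound cov (s , t) (l≤ , ≤u , ex , ex′) ≤B
    with completeˡ s ex (ℚₚ.≤-trans (≤+ˡ (0≤tot 0≤w h (right x) t)) ≤B)
       | completeʳ t ex′ (ℚₚ.≤-trans (≤+ʳ (0≤tot 0≤w h (left x) s)) ≤B)
    where
    0≤w : ∀ y → 0ℚ ≤ w y
    0≤w y = discrete-0≤ (w-discrete y)
  ... | a , a<K , Va , closeˡ | b , b<K , Vb , closeʳ =
    k , k<K , settle {x = x} {M = M′} (suc h) (s , t) sound k<K d i
                (cov a a<K b b<K 0<Va 0<Vb (close-lower 0≤ε {suc h} (ρ^≤ h≤H) (0≤lo x) (discrete-0≤ d) close l≤)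
                  (close-upper 0≤ε {suc h} (ρ^≤ h≤H) 0≤A close ≤u) k k<K i)
                (≤-by (value eˡ - (1ℚ + tot h (left x) s v) + (value eʳ - (1ℚ + tot h (right x) t v)))
                  (0≤+ (0≤- Va) (0≤- Vb)) (lemma (tot h (left x) s v) (tot h (right x) t v) (value eˡ) (value eʳ)))
                close
    where
    eˡ = cell M (left x) a
    eʳ = cell M (right x) b
    0<Va = ℚₚ.<-≤-trans (0<1+tot h (left x) s) Va
    0<Vb = ℚₚ.<-≤-trans (0<1+tot h (right x) t) Vb
    d : Discrete (weight (join eˡ eʳ))
    d = discrete-+ (entry-discrete h (left x) a (soundˡ a a<K 0<Va)) (entry-discrete h (right x) b (soundʳ b b<K 0<Vb))
    close : Close (suc h) (tot (suc h) x (s , t) w) (weight (join eˡ eʳ))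
    close = close-+ (suc h) closeˡ closeʳ
    0≤A : 0ℚ ≤ tot (suc h) x (s , t) w
    0≤A = discrete-0≤ (discrete-tot w-discrete (suc h) x (s , t))
    -- The exact weight is at most `B`, so the weight of the stand-ins is at most (1 + ε) B, which
    -- `cap` places below the top of the grid.
    bucket = find-bucket K (discrete-0≤ d) (ℚₚ.≤-<-trans (close-upper 0≤ε {suc h} (ρ^≤ h≤H) 0≤A close ≤B) cap)
    k = proj₁ bucket
    k<K = proj₁ (proj₂ bucket)
    i = proj₂ (proj₂ bucket)
    lemma : ∀ p q V V′ → V + V′ - 1ℚ ≡ 1ℚ + (p + q) + (V - (1ℚ + p) + (V′ - (1ℚ + q)))
    lemma = ring-solve ℚ-ring

  -- Cells outside the input start as 0, and 0 marks an empty entry; thanks to the offset 1 on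
  -- values, the tables need no initialisation.
  Empty : ℕ → Memory → Set
  Empty x M = ∀ k → M rat $V x k ≡ 0ℚ

  empty-sound : ∀ {h x M} → Empty x M → Sound h x M
  empty-sound empty k _ 0<V = ⊥-elim (ℚₚ.<-irrefl refl (subst (0ℚ <_) (empty k) 0<V))

  x<left : ∀ {x} → 1 ℕ.≤ x → x ℕ.< left x
  x<left {x} 1≤x = ℕₚ.m<m+n x (ℕₚ.≤-trans 1≤x (ℕₚ.≤-reflexive (sym (ℕₚ.+-identityʳ x))))

  left≢ : ∀ {x} → 1 ℕ.≤ x → left x ≢ x
  left≢ 1≤x eq = ℕₚ.<-irrefl (sym eq) (x<left 1≤x)

  right≢ : ∀ {x} → 1 ℕ.≤ x → right x ≢ x
  right≢ 1≤x eq = ℕₚ.<-irrefl (sym eq) (ℕₚ.m≤n⇒m≤1+n (x<left 1≤x))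

  sound-cells : ∀ {h x M M′} → (∀ k → cell M′ x k ≡ cell M x k) → Sound h x M → Sound h x M′
  sound-cells {h} {x} same s k k<K 0<V =
    subst (Entry h x k) (sym (same k)) (s k k<K (subst (0ℚ <_) (cong value (same k)) 0<V))

  complete-cells : ∀ {h x M M′} → (∀ k → cell M′ x k ≡ cell M x k) → Complete h x M → Complete h x M′
  complete-cells {h} {x} same c s ex ≤B with c s ex ≤B
  ... | k , k<K , V≥ , close = k , k<K , subst (λ e → 1ℚ + tot h x s v ≤ value e × Close (suc h) (tot h x s w) (weight e))
                                          (sym (same k)) (V≥ , close)

  run-merge : ∀ {h x M} → h ℕ.≤ H → 1 ℕ.≤ x → Grid M → M nat #x 0 0 ≡ x → M rat $lo 0 0 ≡ lo x → M rat $hi 0 0 ≡ hi x →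
              Good h (left x) M → Good h (right x) M → Empty x M →
              Run (merge ε) M (mergeTime K) (λ M′ → (∀ y k → y ≢ x → cell M′ y k ≡ cell M y k) × Good (suc h) x M′)
  run-merge {h} {x} {M₀} h≤H 1≤x grid₀ x≡₀ lo≡₀ hi≡₀ goodˡ goodʳ empty =
    run-weaken ℕₚ.≤-refl
      (λ { M′ _ ((_ , _ , _ , _ , r) , q) → others r ,
             sound r (empty-sound {M = M₀} empty) ,
             merge-complete {M = M₀} {M′ = M′} h≤H goodˡ goodʳ (sound r (empty-sound {M = M₀} empty)) q })
      (run-for P Q K refl (proj₁ grid₀) (grid₀ , x≡₀ , lo≡₀ , hi≡₀ , rowStep-cells rowStep-refl λ _ _ → refl) outer)
    where
    P : Memory → Set
    P M = Grid M × M nat #x 0 0 ≡ x × M rat $lo 0 0 ≡ lo x × M rat $hi 0 0 ≡ hi x × RowStep (suc h) x M₀ M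
    R : ℕ → ℕ → Memory → Set
    R a b M = Covered x (cell M₀ (left x) a) (cell M₀ (right x) b) M
    Q : ℕ → Memory → Set
    Q a M = ∀ b → b ℕ.< K → R a b M
    outer : ∀ a M → a ℕ.< K → P M →
            Run (Down #b (scalar nat #K) (mergeBody ε)) (update M nat #a 0 0 a) (downTime #b (scalar nat #K) K (mergeBodyTime K))
              (λ M′ → P M′ × Q a M′ × (∀ a′ → a′ ℕ.< K → Q a′ M → Q a′ M′))
    outer a M₁ a<K (grid₁ , x≡₁ , lo≡₁ , hi≡₁ , r₁) =
      run-weaken ℕₚ.≤-refl
        (λ { M′ _ ((grid , x≡ , lo≡ , hi≡ , _ , r) , q) →
               (grid , x≡ , lo≡ , hi≡ , rowStep-trans r₁ r) , q ,
               λ a′ _ q′ b b<K → covered-mono (cell M₀ (left x) a′) (cell M₀ (right x) b) r (q′ b b<K) })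
        (run-for P′ (R a) K refl (proj₁ grid₁)
          (grid₁ , x≡₁ , lo≡₁ , hi≡₁ , refl , rowStep-cells rowStep-refl λ _ _ → refl) inner)
      where
      P′ : Memory → Set
      P′ M = Grid M × M nat #x 0 0 ≡ x × M rat $lo 0 0 ≡ lo x × M rat $hi 0 0 ≡ hi x × M nat #a 0 0 ≡ a × RowStep (suc h) x M₁ M
      inner : ∀ b M → b ℕ.< K → P′ M →
              Run (mergeBody ε) (update M nat #b 0 0 b) (mergeBodyTime K)
                (λ M′ → P′ M′ × R a b M′ × (∀ b′ → b′ ℕ.< K → R a b′ M → R a b′ M′))
      inner b M b<K ((K≡ , G≡) , x≡ , lo≡ , hi≡ , a≡ , r) =
        run-weaken ℕₚ.≤-refl
          (λ { M′ (frame f) (step , cov) → let step′ = rowStep-trans (rowStep-cells rowStep-refl λ _ _ → refl) step in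
                 ( (trans (f nat #K refl 0 0) K≡ , λ k k≤K → trans (f rat $G refl 0 k) (G≡ k k≤K))
                 , trans (f nat #x refl 0 0) x≡ , trans (f rat $lo refl 0 0) lo≡ , trans (f rat $hi refl 0 0) hi≡
                 , trans (f nat #a refl 0 0) a≡ , rowStep-trans r step′ )
                 , subst₂ (λ e e′ → Covered x e e′ M′) (sameˡ a) (sameʳ b) cov
                 , λ b′ _ q → covered-mono (cell M₀ (left x) a) (cell M₀ (right x) b′) step′ q })
          (run-mergeBody (K≡ , G≡) x≡ a≡ refl lo≡ hi≡
            (sound-cells {M = M₀} {M} sameˡ (proj₁ goodˡ)) (sound-cells {M = M₀} {M} sameʳ (proj₁ goodʳ)) a<K b<K)
        where
        total = rowStep-trans r₁ r
        sameˡ : ∀ k → cell M (left x) k ≡ cell M₀ (left x) k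
        sameˡ k = others total (left x) k (left≢ 1≤x)
        sameʳ : ∀ k → cell M (right x) k ≡ cell M₀ (right x) k
        sameʳ k = others total (right x) k (right≢ 1≤x)

-- Filling the tables

each : Program → Program
each c = Down #i (scalar nat #m′) (Down #j (scalar nat #n′) c)

eachTime : ℕ → ℕ → ℕ → ℕ
eachTime m n T = downTime #i (scalar nat #m′) m (downTime #j (scalar nat #n′) n T)

-- Descending b levels in heap numbering multiplies the number of a node by 2ᵇ; the category itself
-- is node 2ᵃ + i.
leaf : ℕ → ℕ → ℕ → ℕ → ℕ
leaf a b i j = (2 ℕ.^ a ℕ.+ i) ℕ.* 2 ℕ.^ b ℕ.+ j

2^suc : ∀ k → 2 ℕ.^ suc k ≡ 2 ℕ.^ k ℕ.+ 2 ℕ.^ k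
2^suc k = cong (2 ℕ.^ k ℕ.+_) (ℕₚ.+-identityʳ (2 ℕ.^ k))

leaf-wrap : ∀ a b i → leaf a b i (2 ℕ.^ b) ≡ leaf a b (suc i) 0
leaf-wrap a b i = lemma (2 ℕ.^ a) i (2 ℕ.^ b)
  where
  lemma : ∀ A i N → (A ℕ.+ i) ℕ.* N ℕ.+ N ≡ (A ℕ.+ (1 ℕ.+ i)) ℕ.* N ℕ.+ 0
  lemma = ℕ-solve

leaf-first : ∀ a b → leaf a b 0 0 ≡ 2 ℕ.^ (a ℕ.+ b)
leaf-first a b = begin
  (2 ℕ.^ a ℕ.+ 0) ℕ.* 2 ℕ.^ b ℕ.+ 0   ≡⟨ lemma (2 ℕ.^ a) (2 ℕ.^ b) ⟩
  2 ℕ.^ a ℕ.* 2 ℕ.^ b                 ≡⟨ ℕₚ.^-distribˡ-+-* 2 a b ⟨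
  2 ℕ.^ (a ℕ.+ b)                     ∎
  where
  open ≡-Reasoning
  lemma : ∀ A N → (A ℕ.+ 0) ℕ.* N ℕ.+ 0 ≡ A ℕ.* N
  lemma = ℕ-solve

leaf-end : ∀ a b → leaf a b (2 ℕ.^ a) 0 ≡ 2 ℕ.^ suc (a ℕ.+ b)
leaf-end a b = begin
  (2 ℕ.^ a ℕ.+ 2 ℕ.^ a) ℕ.* 2 ℕ.^ b ℕ.+ 0   ≡⟨ lemma (2 ℕ.^ a) (2 ℕ.^ b) ⟩
  2 ℕ.* (2 ℕ.^ a ℕ.* 2 ℕ.^ b)               ≡⟨ cong (2 ℕ.*_) (ℕₚ.^-distribˡ-+-* 2 a b) ⟨
  2 ℕ.* 2 ℕ.^ (a ℕ.+ b)                     ∎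
  where
  open ≡-Reasoning
  lemma : ∀ A N → (A ℕ.+ A) ℕ.* N ℕ.+ 0 ≡ 2 ℕ.* (A ℕ.* N)
  lemma = ℕ-solve

leaf< : ∀ a b {i j} → i ℕ.< 2 ℕ.^ a → j ℕ.< 2 ℕ.^ b → leaf a b i j ℕ.< 2 ℕ.^ suc (a ℕ.+ b)
leaf< a b {i} {j} i< j< = begin-strict
  leaf a b i j               <⟨ ℕₚ.+-monoʳ-< _ j< ⟩
  leaf a b i (2 ℕ.^ b)       ≡⟨ leaf-wrap a b i ⟩
  leaf a b (suc i) 0         ≤⟨ ℕₚ.+-monoˡ-≤ 0 (ℕₚ.*-monoˡ-≤ (2 ℕ.^ b) (ℕₚ.+-monoʳ-≤ (2 ℕ.^ a) i<)) ⟩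
  leaf a b (2 ℕ.^ a) 0       ≡⟨ leaf-end a b ⟩
  2 ℕ.^ suc (a ℕ.+ b)        ∎
  where open ℕₚ.≤-Reasoning

≤leaf : ∀ a b i j → 2 ℕ.^ (a ℕ.+ b) ℕ.≤ leaf a b i j
≤leaf a b i j = begin
  2 ℕ.^ (a ℕ.+ b)   ≡⟨ leaf-first a b ⟨
  leaf a b 0 0      ≤⟨ ℕₚ.+-mono-≤ (ℕₚ.*-monoˡ-≤ (2 ℕ.^ b) (ℕₚ.+-monoʳ-≤ (2 ℕ.^ a) z≤n)) z≤n ⟩
  leaf a b i j      ∎
  where open ℕₚ.≤-Reasoning

-- The nested descending loops visit consecutive leaf numbers, from 2ᵃ⁺ᵇ⁺¹ - 1 down to 2ᵃ⁺ᵇ; where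
-- the row changes, `leaf-wrap` closes the gap. Hence one invariant, indexed by leaf numbers, serves
-- both loops.
run-each : ∀ {c M T} a b (I : ℕ → Memory → Set) →
  writes c nat #i ≡ false → writes c nat #j ≡ false → writes c nat #m′ ≡ false → writes c nat #n′ ≡ false →
  (∀ x M k → I x M → I x (update M nat #i 0 0 k)) → (∀ x M k → I x M → I x (update M nat #j 0 0 k)) →
  M nat #m′ 0 0 ≡ 2 ℕ.^ a → M nat #n′ 0 0 ≡ 2 ℕ.^ b → I (2 ℕ.^ suc (a ℕ.+ b)) M →
  (∀ i j M → i ℕ.< 2 ℕ.^ a → j ℕ.< 2 ℕ.^ b → M nat #i 0 0 ≡ i → M nat #j 0 0 ≡ j →
     M nat #m′ 0 0 ≡ 2 ℕ.^ a → M nat #n′ 0 0 ≡ 2 ℕ.^ b → I (suc (leaf a b i j)) M → Run c M T (I (leaf a b i j))) →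
  Run (each c) M (eachTime (2 ℕ.^ a) (2 ℕ.^ b) T) (I (2 ℕ.^ (a ℕ.+ b)))
run-each {c} {M₀} {T} a b I safe-i safe-j safe-m safe-n stable-i stable-j m≡ n≡ start step =
  run-weaken ℕₚ.≤-refl (λ { M _ (_ , _ , i) → subst (λ x → I x M) (leaf-first a b) i })
    (run-down P (2 ℕ.^ a) safe-i m≡
      (m≡ , n≡ , stable-i _ M₀ _ (subst (λ x → I x M₀) (sym (leaf-end a b)) start)) outer)
  where
  P : ℕ → Memory → Set
  P i M = M nat #m′ 0 0 ≡ 2 ℕ.^ a × M nat #n′ 0 0 ≡ 2 ℕ.^ b × I (leaf a b i 0) M
  outer : ∀ i M → i ℕ.< 2 ℕ.^ a → P (suc i) M →
          Run (Down #j (scalar nat #n′) c) (update M nat #i 0 0 i) (downTime #j (scalar nat #n′) (2 ℕ.^ b) T) (P i)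
  outer i M i< (m≡ , n≡ , inv) =
    run-weaken ℕₚ.≤-refl (λ { _ _ (m≡ , n≡ , _ , inv) → m≡ , n≡ , inv })
      (run-down Q (2 ℕ.^ b) safe-j n≡
        (m≡ , n≡ , refl , stable-j _ _ _ (stable-i _ _ _ (subst (λ x → I x M) (sym (leaf-wrap a b i)) inv))) inner)
    where
    Q : ℕ → Memory → Set
    Q j M = M nat #m′ 0 0 ≡ 2 ℕ.^ a × M nat #n′ 0 0 ≡ 2 ℕ.^ b × M nat #i 0 0 ≡ i × I (leaf a b i j) M
    inner : ∀ j M → j ℕ.< 2 ℕ.^ b → Q (suc j) M → Run c (update M nat #j 0 0 j) T (Q j)
    inner j M j< (m≡ , n≡ , i≡ , inv) =
      run-weaken ℕₚ.≤-refl
        (λ { M′ (frame f) inv′ → trans (f nat #m′ safe-m 0 0) m≡ , trans (f nat #n′ safe-n 0 0) n≡ ,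
                                 trans (f nat #i safe-i 0 0) i≡ , inv′ })
        (step i j (update M nat #j 0 0 j) i< j< i≡ refl m≡ n≡
          (stable-j _ M j (subst (λ x → I x M) (ℕₚ.+-suc ((2 ℕ.^ a ℕ.+ i) ℕ.* 2 ℕ.^ b) j) inv)))

leafIndex : Exp nat
leafIndex = (scalar nat #m′ :+ scalar nat #i) :* scalar nat #n′ :+ scalar nat #j

leafBody : Program
leafBody =
  -- Going down by one leaf halves the code, so no powers need to be computed; before the last leaf
  -- the variable holds 1.
  assign rat $p (lit ½ :* scalar rat $p) ⨾
  assign nat #x leafIndex ⨾
  -- The candidate that leaves the item out; its value 0 is stored as 1. The candidate that takes
  -- the item follows after the insertion.
  assign rat $eW (lit 0ℚ) ⨾
  assign rat $eV (lit 1ℚ) ⨾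
  assign rat $eC (lit 0ℚ) ⨾
  insert ⨾
  assign rat $eW (read rat $w (scalar nat #i) (scalar nat #j)) ⨾
  assign rat $eV (lit 1ℚ :+ read rat $v (scalar nat #i) (scalar nat #j)) ⨾
  assign rat $eC (scalar rat $p) ⨾
  insert

leafTime : ℕ → ℕ
leafTime K = 38 ℕ.+ (insertTime K ℕ.+ (28 ℕ.+ insertTime K))

module Leaves (S : Setting) where

  open Setting S hiding (a; b)
  open Tables S
  open Buckets μ ρ 1≤ρ
  open Bounds w lo hi
  open RowStep

  run-leaf : ∀ {i j y M} → Grid M → M nat #i 0 0 ≡ i → M nat #j 0 0 ≡ j → eval leafIndex M ≡ y →
             M rat $w i j ≡ w y → M rat $v i j ≡ v y → ½ * M rat $p 0 0 ≡ c y → Empty y M →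
             Run leafBody M (leafTime K)
               (λ M′ → (∀ z k → z ≢ y → cell M′ z k ≡ cell M z k) × Good 0 y M′ × M′ rat $p 0 0 ≡ c y)
  run-leaf {i} {j} {y} {M} (K≡ , G≡) refl refl y≡ w≡ v≡ p≡ empty =
    run-write-seq (run-write-seq (run-write-seq (run-write-seq (run-write-seq (run-seq
      (run-insert {0} {y} (K≡ , G≡) y≡ refl refl refl (λ k i → false , refl , refl , refl , i , tt))
      λ { M₁ (frame f) (r₁ , q₁) → run-write-seq (run-write-seq (run-write-seq (run-weaken ℕₚ.≤-refl
          (λ { M₂ (frame g) (r₂ , q₂) →
             finish M₁ M₂ (rowStep-trans (rowStep-cells (rowStep-refl {0} {y} {M}) λ _ _ → refl) r₁) q₁
               (rowStep-trans (rowStep-cells (rowStep-refl {0} {y} {M₁}) λ _ _ → refl) r₂) q₂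
               (g rat $p refl 0 0) (trans (f rat $p refl 0 0) p≡) })
          (run-insert {0} {y} {W = w y} {1ℚ + v y} {c y}
             (trans (f nat #K refl 0 0) K≡ , λ k k≤K → trans (f rat $G refl 0 k) (G≡ k k≤K))
             (trans (f nat #x refl 0 0) y≡)
             (trans (cong₂ (M₁ rat $w) (f nat #i refl 0 0) (f nat #j refl 0 0)) (trans (f rat $w refl _ _) w≡))
             (cong (_+_ 1ℚ) (trans (cong₂ (M₁ rat $v) (f nat #i refl 0 0) (f nat #j refl 0 0)) (trans (f rat $v refl _ _) v≡)))
             (trans (f rat $p refl 0 0) p≡)
             (λ k i → true , refl , refl , refl , i , tt))))) })))))
    where
    complete : ∀ {M′} → Sound 0 y M′ → (∀ k → k ℕ.< K → InBucket k 0ℚ → 1ℚ ≤ M′ rat $V y k) →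
               (∀ k → k ℕ.< K → InBucket k (w y) → 1ℚ + v y ≤ M′ rat $V y k) → Complete 0 y M′
    complete {M′} snd none item s _ ≤B = k , k<K ,
      settle {x = y} {M = M′} 0 s snd k<K d b (covers s b) ℚₚ.≤-refl (close-refl (tot 0 y s w))
      where
      d : Discrete (tot 0 y s w)
      d = discrete-tot w-discrete 0 y s
      bucket = find-bucket K (discrete-0≤ d) (ℚₚ.≤-<-trans
        (close-upper 0≤ε {0} (≤+ˡ 0≤ε) (discrete-0≤ d) (close-refl (tot 0 y s w)) ≤B) cap)
      k = proj₁ bucket
      k<K = proj₁ (proj₂ bucket)
      b = proj₂ (proj₂ bucket)
      covers : ∀ s → InBucket k (tot 0 y s w) → 1ℚ + tot 0 y s v ≤ M′ rat $V y k
      covers true  = item k k<K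
      covers false = none k k<K
    finish : ∀ M₁ M₂ → RowStep 0 y M M₁ → (∀ k → k ℕ.< K → InBucket k 0ℚ → 1ℚ ≤ M₁ rat $V y k) →
             RowStep 0 y M₁ M₂ → (∀ k → k ℕ.< K → InBucket k (w y) → 1ℚ + v y ≤ M₂ rat $V y k) →
             M₂ rat $p 0 0 ≡ M₁ rat $p 0 0 → M₁ rat $p 0 0 ≡ c y →
             (∀ z k → z ≢ y → cell M₂ z k ≡ cell M z k) × Good 0 y M₂ × M₂ rat $p 0 0 ≡ c y
    finish M₁ M₂ r₁ q₁ r₂ q₂ p₂ p₁ =
      others r , (snd , complete {M₂} snd (λ k k<K b → ℚₚ.≤-trans (q₁ k k<K b) (monotone r₂ k)) q₂) , trans p₂ p₁
      where
      r : RowStep 0 y M M₂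
      r = rowStep-trans r₁ r₂
      snd : Sound 0 y M₂
      snd = sound r (empty-sound {M = M} empty)

-- Levels of the heap numbering

Level : ℕ → ℕ → Set
Level d x = 2 ℕ.^ d ℕ.≤ x × x ℕ.< 2 ℕ.^ suc d

2^-cancel-< : ∀ {d e} → 2 ℕ.^ d ℕ.< 2 ℕ.^ e → d ℕ.< e
2^-cancel-< {d} {e} lt with d ℕₚ.<? e
... | yes d<e = d<e
... | no  d≮e = ⊥-elim (ℕₚ.<⇒≱ lt (ℕₚ.^-monoʳ-≤ 2 (ℕₚ.≮⇒≥ d≮e)))

level-≤ : ∀ {d e x} → Level d x → Level e x → d ℕ.≤ e
level-≤ {d} {e} (d≤ , _) (_ , <e) = ℕₚ.≤-pred (2^-cancel-< {d} {suc e} (ℕₚ.≤-<-trans d≤ <e))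

level-unique : ∀ {d e x} → Level d x → Level e x → d ≡ e
level-unique l l′ = ℕₚ.≤-antisym (level-≤ l l′) (level-≤ l′ l)

level-exists : ∀ x → ∃[ d ] Level d (suc x)
level-exists zero    = 0 , s≤s z≤n , s≤s (s≤s z≤n)
level-exists (suc x) with level-exists x
... | d , d≤ , <d with suc (suc x) ℕₚ.<? 2 ℕ.^ suc d
...   | yes lt = d , ℕₚ.m≤n⇒m≤1+n d≤ , lt
...   | no  ge = suc d , ℕₚ.≮⇒≥ ge ,
        ℕₚ.≤-<-trans <d (ℕₚ.^-monoʳ-< 2 (s≤s (s≤s z≤n)) {suc d} (ℕₚ.n<1+n (suc d)))

level-left : ∀ d x → Level d x → Level (suc d) (left x)
level-left d x (d≤ , <d) = ℕₚ.*-monoʳ-≤ 2 d≤ , ℕₚ.*-monoʳ-< 2 <d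

level-right : ∀ d x → Level d x → Level (suc d) (right x)
level-right d x (d≤ , <d) = ℕₚ.m≤n⇒m≤1+n (ℕₚ.*-monoʳ-≤ 2 d≤) ,
  ℕₚ.≤-trans (ℕₚ.≤-reflexive (cong suc (sym (ℕₚ.+-suc x (x ℕ.+ 0))))) (ℕₚ.*-monoʳ-≤ 2 <d)

free : Program
free = assign rat $lo (lit 0ℚ) ⨾ assign rat $hi (scalar rat $B)

setBounds : Program
setBounds =
  If (scalar nat #m′ :≤ nodeE)
    (If (nodeE :< lit 2 :* scalar nat #m′)
      (assign rat $lo (read rat $l (nodeE :- scalar nat #m′) (lit 0)) ⨾
       assign rat $hi (read rat $u (nodeE :- scalar nat #m′) (lit 0)))
      free)
    free

nodeBody : ℚ → Program
nodeBody ε = assign nat #x (lit 1 :+ scalar nat #t) ⨾ setBounds ⨾ merge ε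

fillLeaves : Program
fillLeaves = assign rat $p (lit 1ℚ) ⨾ each leafBody

-- There are N leaves, so the inner nodes are 1 to N - 1 and the body works on the counter plus 1.
-- Both children are filled, or are leaves, before their parent is reached.
fillNodes : ℚ → Program
fillNodes ε = Down #t (scalar nat #N :- lit 1) (nodeBody ε)

run-setBounds : ∀ {m x} {l u : ℕ → ℚ} {B M} → M nat #m′ 0 0 ≡ m → M nat #x 0 0 ≡ x → (∀ i → M rat $l i 0 ≡ l i) →
  (∀ i → M rat $u i 0 ≡ u i) → M rat $B 0 0 ≡ B →
  Run setBounds M 62 (λ M′ → M′ rat $lo 0 0 ≡ atCategory m x (l (x ℕ.∸ m)) 0ℚ ×
                             M′ rat $hi 0 0 ≡ atCategory m x (u (x ℕ.∸ m)) B)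
run-setBounds {m} {x} {l} {u} {M = M} refl refl l≡ u≡ refl = run-if
  (λ t₁ → run-if
    (λ t₂ → run-write-seq (run-write
      ( trans (l≡ (x ℕ.∸ m)) (sym (inside t₁ t₂ (l (x ℕ.∸ m)) 0ℚ))
      , trans (u≡ (x ℕ.∸ m)) (sym (inside t₁ t₂ (u (x ℕ.∸ m)) (M rat $B 0 0))))))
    (λ t₂ → run-write-seq (run-write (sym (above t₁ t₂ (l (x ℕ.∸ m)) 0ℚ) , sym (above t₁ t₂ (u (x ℕ.∸ m)) (M rat $B 0 0))))))
  (λ t₁ → run-write-seq (run-write (sym (below t₁ (l (x ℕ.∸ m)) 0ℚ) , sym (below t₁ (u (x ℕ.∸ m)) (M rat $B 0 0)))))
  where
  inside : does (m ℕₚ.≤? x) ≡ true → does (x ℕₚ.<? 2 ℕ.* m) ≡ true → ∀ p q → atCategory m x p q ≡ p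
  inside t₁ t₂ p q rewrite t₁ | t₂ = refl
  above : does (m ℕₚ.≤? x) ≡ true → does (x ℕₚ.<? 2 ℕ.* m) ≡ false → ∀ p q → atCategory m x p q ≡ q
  above t₁ t₂ p q rewrite t₁ | t₂ = refl
  below : does (m ℕₚ.≤? x) ≡ false → ∀ p q → atCategory m x p q ≡ q
  below t₁ p q rewrite t₁ = refl

module Filling (S : Setting) where

  open Setting S
  open Tables S
  open Leaves S
  open Buckets μ ρ 1≤ρ
  open Bounds w lo hi

  -- One loop invariant has to range over nodes of all heights, so the height is hidden. It is
  -- recovered from the number of the node by `level-unique`.
  GoodNode : ℕ → Memory → Set
  GoodNode x M = Σ[ d ∈ ℕ ] Σ[ h ∈ ℕ ] (d ℕ.+ h ≡ H × Level d x × Good h x M)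

  Rows : ℕ → Memory → Set
  Rows x M = (∀ y → x ℕ.≤ y → y ℕ.< 2 ℕ.^ suc H → GoodNode y M) × (∀ y → y ℕ.< x → Empty y M)

  rows-step : ∀ x M M′ → Rows (suc x) M → (∀ z k → z ≢ x → cell M′ z k ≡ cell M z k) → GoodNode x M′ → Rows x M′
  rows-step x M M′ (good , empty) same new = above , λ y y<x k →
    trans (cong value (same y k (ℕₚ.<⇒≢ y<x))) (empty y (ℕₚ.m≤n⇒m≤1+n y<x) k)
    where
    above : ∀ y → x ℕ.≤ y → y ℕ.< 2 ℕ.^ suc H → GoodNode y M′
    above y x≤y y< with y ℕₚ.≟ x
    ... | yes refl = new
    ... | no  y≢x with good y (ℕₚ.≤∧≢⇒< x≤y (y≢x ∘ sym)) y<
    ...   | d , h , d+h≡H , level , snd , cmp = d , h , d+h≡H , level ,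
            sound-cells {M = M} {M′} (λ k → same y k y≢x) snd , complete-cells {M = M} {M′} (λ k → same y k y≢x) cmp

  node-good : ∀ {x M y} d h → Rows x M → x ℕ.≤ y → d ℕ.+ h ≡ H → Level d y → Good h y M
  node-good {M = M} {y} d h (good , _) x≤y d+h≡H level
    with good y x≤y (ℕₚ.<-≤-trans (proj₂ level) (ℕₚ.^-monoʳ-≤ 2 (s≤s (ℕₚ.≤-trans (ℕₚ.m≤m+n d h) (ℕₚ.≤-reflexive d+h≡H)))))
  ... | d′ , h′ , d′+h′≡H , level′ , g with level-unique {d} {d′} level level′
  ...   | refl = subst (λ h → Good h y M) (ℕₚ.+-cancelˡ-≡ d h′ h (trans d′+h′≡H (sym d+h≡H))) g

  Leaf-inputs : Memory → Set
  Leaf-inputs M = ∀ i j → i ℕ.< 2 ℕ.^ a → j ℕ.< 2 ℕ.^ b →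
    M rat $w i j ≡ w (leaf a b i j) × M rat $v i j ≡ v (leaf a b i j)

  run-fillLeaves : ∀ {M} → Grid M → M nat #m′ 0 0 ≡ 2 ℕ.^ a → M nat #n′ 0 0 ≡ 2 ℕ.^ b → Leaf-inputs M →
    (∀ x → Empty x M) →
    Run fillLeaves M (4 ℕ.+ eachTime (2 ℕ.^ a) (2 ℕ.^ b) (leafTime K)) (Rows (2 ℕ.^ H))
  run-fillLeaves {M₀} grid₀ m≡₀ n≡₀ in₀ empty₀ = run-write-seq (run-weaken ℕₚ.≤-refl (λ { _ _ (_ , _ , rows , _) → rows })
    (run-each a b I refl refl refl refl (λ _ _ _ i → i) (λ _ _ _ i → i) m≡₀ n≡₀
      (grid₀ , in₀ , ((λ y ≤y y< → ⊥-elim (ℕₚ.<⇒≱ y< ≤y)) , λ y _ → empty₀ y) ,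
        sym (cong (½ ^_) (ℕₚ.n∸n≡0 (2 ℕ.^ suc H)))) step))
    where
    I : ℕ → Memory → Set
    I y M = Grid M × Leaf-inputs M × Rows y M × M rat $p 0 0 ≡ c y
    step : ∀ i j M → i ℕ.< 2 ℕ.^ a → j ℕ.< 2 ℕ.^ b → M nat #i 0 0 ≡ i → M nat #j 0 0 ≡ j →
           M nat #m′ 0 0 ≡ 2 ℕ.^ a → M nat #n′ 0 0 ≡ 2 ℕ.^ b → I (suc (leaf a b i j)) M →
           Run leafBody M (leafTime K) (I (leaf a b i j))
    step i j M i< j< i≡ j≡ m≡ n≡ (grid , ins , rows , p≡) =
      run-weaken ℕₚ.≤-refl
        (λ { M′ (frame f) (same , good , p≡′) →
               ((trans (f nat #K refl 0 0) (proj₁ grid)) , λ k k≤K → trans (f rat $G refl 0 k) (proj₂ grid k k≤K)) ,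
               (λ i j i< j< → trans (f rat $w refl i j) (proj₁ (ins i j i< j<)) , trans (f rat $v refl i j) (proj₂ (ins i j i< j<))) ,
               rows-step y M M′ rows same (H , 0 , ℕₚ.+-identityʳ H , (≤leaf a b i j , leaf< a b i< j<) , good) , p≡′ })
        (run-leaf {i} {j} {y} grid i≡ j≡
          (cong₂ ℕ._+_ (cong₂ ℕ._*_ (cong₂ ℕ._+_ m≡ i≡) n≡) j≡)
          (proj₁ (ins i j i< j<)) (proj₂ (ins i j i< j<))
          (trans (cong (½ *_) p≡) (leafCode-half H (leaf< a b i< j<)))
          (proj₂ rows y ℕₚ.≤-refl))
      where
      y = leaf a b i j

  Node-inputs : Memory → Set
  Node-inputs M = Grid M × M nat #m′ 0 0 ≡ 2 ℕ.^ a × (∀ i → M rat $l i 0 ≡ l i) × (∀ i → M rat $u i 0 ≡ u i) ×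
                  M rat $B 0 0 ≡ B

  nodeTime : ℕ
  nodeTime = 8 ℕ.+ (62 ℕ.+ mergeTime K)

  run-fillNodes : ∀ {M} → Node-inputs M → M nat #N 0 0 ≡ 2 ℕ.^ H → Rows (2 ℕ.^ H) M →
    Run (fillNodes ε) M (downTime #t (scalar nat #N :- lit 1) (2 ℕ.^ H ℕ.∸ 1) nodeTime) (Good H 1)
  run-fillNodes {M₀} in₀ N≡₀ rows₀ = run-weaken ℕₚ.≤-refl
    (λ { M′ _ (_ , rows) → node-good {M = M′} 0 H rows ℕₚ.≤-refl refl (s≤s z≤n , s≤s (s≤s z≤n)) })
    (run-down I (2 ℕ.^ H ℕ.∸ 1) refl (cong (ℕ._∸ 1) N≡₀)
      (in₀ , subst (λ x → Rows x M₀) (sym (ℕₚ.m+[n∸m]≡n (ℕₚ.m^n>0 2 H))) rows₀) step)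
    where
    I : ℕ → Memory → Set
    I t M = Node-inputs M × Rows (suc t) M
    step : ∀ t M → t ℕ.< 2 ℕ.^ H ℕ.∸ 1 → I (suc t) M → Run (nodeBody ε) (update M nat #t 0 0 t) nodeTime (I t)
    step t M t< (((K≡ , G≡) , m≡ , l≡ , u≡ , B≡) , rows) with level-exists t
    ... | d , level = go (H ℕ.∸ suc d) (trans (ℕₚ.+-suc d _) (ℕₚ.m+[n∸m]≡n d<H))
      where
      x = suc t
      x< : x ℕ.< 2 ℕ.^ H
      x< = ℕₚ.≤-trans (s≤s t<) (ℕₚ.≤-reflexive (ℕₚ.m+[n∸m]≡n (ℕₚ.m^n>0 2 H)))
      d<H : d ℕ.< H
      d<H = 2^-cancel-< {d} {H} (ℕₚ.≤-<-trans (proj₁ level) x<)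
      go : ∀ h → d ℕ.+ suc h ≡ H → Run (nodeBody ε) (update M nat #t 0 0 t) nodeTime (I t)
      go h d+1+h≡H = run-write-seq (run-seq
        (run-setBounds {l = l} {u} m≡ refl l≡ u≡ B≡)
        λ { M₁ (frame f) (lo≡ , hi≡) →
          let same : ∀ y k → cell M₁ y k ≡ cell M y k
              same y k = cong₂ _,_ (f rat $W refl y k) (cong₂ _,_ (f rat $V refl y k) (f rat $C refl y k))
              goodˡ = node-good {M = M} (suc d) h rows (x<left (s≤s z≤n)) (trans (sym (ℕₚ.+-suc d h)) d+1+h≡H) (level-left d x level)
              goodʳ = node-good {M = M} (suc d) h rows (ℕₚ.m≤n⇒m≤1+n (x<left (s≤s z≤n))) (trans (sym (ℕₚ.+-suc d h)) d+1+h≡H) (level-right d x level)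
          in run-weaken ℕₚ.≤-refl
            (λ { M₂ (frame g) (same′ , good) →
              ( ( (trans (g nat #K refl 0 0) (trans (f nat #K refl 0 0) K≡)
                  , λ k k≤K → trans (g rat $G refl 0 k) (trans (f rat $G refl 0 k) (G≡ k k≤K)))
                , trans (g nat #m′ refl 0 0) (trans (f nat #m′ refl 0 0) m≡)
                , (λ i → trans (g rat $l refl i 0) (trans (f rat $l refl i 0) (l≡ i)))
                , (λ i → trans (g rat $u refl i 0) (trans (f rat $u refl i 0) (u≡ i)))
                , trans (g rat $B refl 0 0) (trans (f rat $B refl 0 0) B≡))
              , rows-step x M M₂ rows (λ y k y≢x → trans (same′ y k y≢x) (same y k)) (d , suc h , d+1+h≡H , level , good) ) })
            (run-merge {h} {x} (ℕₚ.≤-trans (ℕₚ.≤-trans (ℕₚ.n≤1+n h) (ℕₚ.m≤n+m (suc h) d)) (ℕₚ.≤-reflexive d+1+h≡H)) (s≤s z≤n)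
              (trans (f nat #K refl 0 0) K≡ , λ k k≤K → trans (f rat $G refl 0 k) (G≡ k k≤K))
              (f nat #x refl 0 0) lo≡ hi≡
              (sound-cells {M = M} {M₁} (same (left x)) (proj₁ goodˡ) , complete-cells {M = M} {M₁} (same (left x)) (proj₂ goodˡ))
              (sound-cells {M = M} {M₁} (same (right x)) (proj₁ goodʳ) , complete-cells {M = M} {M₁} (same (right x)) (proj₂ goodʳ))
              (λ k → trans (cong value (same x k)) (proj₂ rows x ℕₚ.≤-refl k))) })

-- Padding, the least positive weight and the buckets

double : ℕ → Exp nat → Program
double d e = While (scalar nat d :< e)
  (assign nat d (scalar nat d :+ scalar nat d) ⨾ assign nat #E (scalar nat #E :+ lit 1))

doubleTime : ℕ → Exp nat → ℕ → ℕ
doubleTime d e L = loopTime (scalar nat d :< e) L 18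

run-double : ∀ {d e s L U c a M} → (d ℕ.≡ᵇ #E) ≡ false → (#E ℕ.≡ᵇ d) ≡ false →
  (∀ M x y → eval e (update (update M nat d 0 0 x) nat #E 0 0 y) ≡ eval e M) →
  eval e M ≡ s → s ℕ.≤ L → 2 ℕ.* s ℕ.≤ U →
  M nat d 0 0 ≡ 2 ℕ.^ a → M nat #E 0 0 ≡ c ℕ.+ a → 2 ℕ.^ a ℕ.≤ U →
  Run (double d e) M (doubleTime d e L)
    (λ M′ → ∃[ a′ ] (a ℕ.≤ a′ × s ℕ.≤ 2 ℕ.^ a′ × M′ nat d 0 0 ≡ 2 ℕ.^ a′ × M′ nat #E 0 0 ≡ c ℕ.+ a′ × 2 ℕ.^ a′ ℕ.≤ U))
run-double {d} {e} {s} {L} {U} {c} {a} {M₀} d≢E E≢d stable s≡ s≤L 2s≤U d≡ E≡ a≤U =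
  run-weaken ℕₚ.≤-refl
    (λ { M _ (k , (a′ , a≤a′ , _ , s≡ , d≡ , E≡ , ≤U) , t) →
           a′ , a≤a′ , subst₂ ℕ._≤_ s≡ d≡ (<ℕ-false t) , d≡ , E≡ , ≤U })
    (run-while I L step (a , ℕₚ.≤-refl , ℕₚ.m^n>0 2 a , s≡ , d≡ , E≡ , a≤U))
  where
  I : ℕ → Memory → Set
  -- Since `k` stays below the current power and a round starts only while this power is below `s`,
  -- there are at most `s` rounds. This linear bound is crude but cheap enough.
  I k M = ∃[ a′ ] (a ℕ.≤ a′ × k ℕ.< 2 ℕ.^ a′ × eval e M ≡ s × M nat d 0 0 ≡ 2 ℕ.^ a′ × M nat #E 0 0 ≡ c ℕ.+ a′ × 2 ℕ.^ a′ ℕ.≤ U)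
  step : ∀ k M → I k M → evalTest (scalar nat d :< e) M ≡ true → k ℕ.< L × Run _ M 18 (I (suc k))
  step k M (a′ , a≤a′ , k< , s≡ , d≡ , E≡ , ≤U) t =
    ℕₚ.<-≤-trans (ℕₚ.<-trans k< below) s≤L ,
    run-write-seq (run-write
      ( suc a′ , ℕₚ.m≤n⇒m≤1+n a≤a′
      , ℕₚ.≤-trans (ℕₚ.+-mono-≤ (ℕₚ.m^n>0 2 a′) k<) (ℕₚ.≤-reflexive (sym (2^suc a′)))
      , trans (stable M _ _) s≡
      , trans new-d (trans (cong₂ ℕ._+_ d≡ d≡) (sym (2^suc a′)))
      , trans new-E (trans (cong (ℕ._+ 1) E≡) (trans (ℕₚ.+-comm (c ℕ.+ a′) 1) (sym (ℕₚ.+-suc c a′))))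
      , ℕₚ.≤-trans (ℕₚ.*-monoʳ-≤ 2 (ℕₚ.<⇒≤ below)) 2s≤U))
    where
    below : 2 ℕ.^ a′ ℕ.< s
    below = subst₂ ℕ._<_ d≡ s≡ (<ℕ-true t)
    M₁ = update M nat d 0 0 (M nat d 0 0 ℕ.+ M nat d 0 0)
    new-d : update M₁ nat #E 0 0 (M₁ nat #E 0 0 ℕ.+ 1) nat d 0 0 ≡ M nat d 0 0 ℕ.+ M nat d 0 0
    new-d rewrite E≢d | ≡ᵇ-refl d = refl
    new-E : M₁ nat #E 0 0 ℕ.+ 1 ≡ M nat #E 0 0 ℕ.+ 1
    new-E rewrite d≢E = refl

sizeE : Exp nat
sizeE = read nat 1 (scalar nat #i) (lit 0)

padding : Program
padding =
  -- Starting at 2 and not at 1 makes `a` and `b` positive, so that categories are neither the root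
  -- nor leaves. Accordingly a + b + 1 starts at 3.
  assign nat #m′ (lit 2) ⨾ assign nat #n′ (lit 2) ⨾ assign nat #E (lit 3) ⨾
  double #m′ (scalar nat 0) ⨾
  Down #i (scalar nat 0) (double #n′ sizeE)

paddingTime : ℕ → ℕ → ℕ
paddingTime m n = 4 ℕ.+ (4 ℕ.+ (4 ℕ.+ (doubleTime #m′ (scalar nat 0) m ℕ.+ downTime #i (scalar nat 0) m (doubleTime #n′ sizeE n))))

-- The padded numbers 2ᵃ and 2ᵇ of categories and of items in each of them.
record Padded (m n : ℕ) (size : ℕ → ℕ) (a b : ℕ) : Set where
  field
    1≤a    : 1 ℕ.≤ a
    1≤b    : 1 ℕ.≤ b
    m≤     : m ℕ.≤ 2 ℕ.^ a
    ≤2m    : 2 ℕ.^ a ℕ.≤ 2 ℕ.* m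
    size≤  : ∀ i → i ℕ.< m → size i ℕ.≤ 2 ℕ.^ b
    ≤2n    : 2 ℕ.^ b ℕ.≤ 2 ℕ.* n

run-padding : ∀ {m n size M} → 1 ℕ.≤ m → 1 ℕ.≤ n → (∀ i → size i ℕ.≤ n) → M nat 0 0 0 ≡ m → (∀ i → M nat 1 i 0 ≡ size i) →
  Run padding M (paddingTime m n) (λ M′ → ∃[ a ] ∃[ b ] (Padded m n size a b ×
    M′ nat #m′ 0 0 ≡ 2 ℕ.^ a × M′ nat #n′ 0 0 ≡ 2 ℕ.^ b × M′ nat #E 0 0 ≡ suc (a ℕ.+ b)))
run-padding {m} {n} {size} {M₀} 1≤m 1≤n size≤n m≡ size≡ = run-write-seq (run-write-seq (run-write-seq (run-seq
  (run-double {#m′} {scalar nat 0} {m} {m} {2 ℕ.* m} {2} {1} refl refl (λ _ _ _ → refl) m≡ ℕₚ.≤-refl ℕₚ.≤-refl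
    refl refl (ℕₚ.*-monoʳ-≤ 2 1≤m))
  λ { M₁ (frame f) (a , 1≤a , m≤ , m′≡ , E≡ , ≤2m) → run-weaken ℕₚ.≤-refl
    (λ { M₂ (frame g) (b , 1≤b , n′≡ , E≡′ , ≤2n , _ , size≤) → a , b ,
           record { 1≤a = 1≤a ; 1≤b = 1≤b ; m≤ = m≤ ; ≤2m = ≤2m ; size≤ = λ i → size≤ i z≤n ; ≤2n = ≤2n } ,
           trans (g nat #m′ refl 0 0) m′≡ , n′≡ , E≡′ })
    (run-down (I a) m refl (trans (f nat 0 refl 0 0) m≡)
      (1 , ℕₚ.≤-refl , f nat #n′ refl 0 0 , trans E≡ (sym (ℕₚ.+-comm (suc a) 1)) , ℕₚ.*-monoʳ-≤ 2 1≤n ,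
       (λ i → trans (f nat 1 refl i 0) (size≡ i)) , λ i m≤i i<m → ⊥-elim (ℕₚ.<⇒≱ i<m m≤i))
      (step a)) })))
  where
  I : ℕ → ℕ → Memory → Set
  I a k M = ∃[ b ] (1 ℕ.≤ b × M nat #n′ 0 0 ≡ 2 ℕ.^ b × M nat #E 0 0 ≡ suc a ℕ.+ b × 2 ℕ.^ b ℕ.≤ 2 ℕ.* n ×
                    (∀ i → M nat 1 i 0 ≡ size i) × (∀ i → k ℕ.≤ i → i ℕ.< m → size i ℕ.≤ 2 ℕ.^ b))
  step : ∀ a k M → k ℕ.< m → I a (suc k) M → Run (double #n′ sizeE) (update M nat #i 0 0 k) (doubleTime #n′ sizeE n) (I a k)
  step a k M k<m (b , 1≤b , n′≡ , E≡ , ≤2n , size≡ , size≤) = run-weaken ℕₚ.≤-refl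
    (λ { M₁ (frame f) (b′ , b≤b′ , new , n′≡ , E≡ , ≤2n) → b′ , ℕₚ.≤-trans 1≤b b≤b′ , n′≡ , E≡ , ≤2n ,
           (λ i → trans (f nat 1 refl i 0) (size≡ i)) , all b′ b≤b′ new })
    (run-double {#n′} {sizeE} {size k} {n} {2 ℕ.* n} {suc a} {b} refl refl (λ _ _ _ → refl) (size≡ k) (size≤n k)
      (ℕₚ.*-monoʳ-≤ 2 (size≤n k)) n′≡ E≡ ≤2n)
    where
    all : ∀ b′ → b ℕ.≤ b′ → size k ℕ.≤ 2 ℕ.^ b′ → ∀ i → k ℕ.≤ i → i ℕ.< m → size i ℕ.≤ 2 ℕ.^ b′
    all b′ b≤b′ new i k≤i i<m with k ℕₚ.≟ i
    ... | yes refl = new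
    ... | no  k≢i  = ℕₚ.≤-trans (size≤ i (ℕₚ.≤∧≢⇒< k≤i k≢i) i<m) (ℕₚ.^-monoʳ-≤ 2 b≤b′)

-- The least positive weight

minBody : Program
minBody =
  If (lit 0ℚ :< item)
    -- The initial value 0 means that no positive weight has been met so far.
    (If (scalar rat $μ :≤ lit 0ℚ) (assign rat $μ item)
      (If (item :< scalar rat $μ) (assign rat $μ item) skip))
    skip
  where item = read rat $w (scalar nat #i) (scalar nat #j)

run-min : ∀ {M} a b (w : ℕ → ℕ → ℚ) (wl : ℕ → ℚ) → (∀ i j → i ℕ.< 2 ℕ.^ a → j ℕ.< 2 ℕ.^ b → w i j ≡ wl (leaf a b i j)) →
  M nat #m′ 0 0 ≡ 2 ℕ.^ a → M nat #n′ 0 0 ≡ 2 ℕ.^ b → (∀ i j → M rat $w i j ≡ w i j) → M rat $μ 0 0 ≡ 0ℚ →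
  Run (each minBody) M (eachTime (2 ℕ.^ a) (2 ℕ.^ b) 50)
    (λ M′ → (∀ y → 2 ℕ.^ (a ℕ.+ b) ℕ.≤ y → y ℕ.< 2 ℕ.^ suc (a ℕ.+ b) → 0ℚ < wl y → 0ℚ < M′ rat $μ 0 0 × M′ rat $μ 0 0 ≤ wl y) ×
            (M′ rat $μ 0 0 ≡ 0ℚ ⊎ ∃[ i ] ∃[ j ] M′ rat $μ 0 0 ≡ w i j))
run-min {M₀} a b w wl w≡wl m≡₀ n≡₀ w≡₀ μ≡₀ = run-weaken ℕₚ.≤-refl (λ { _ _ (_ , low , att) → low , att })
  (run-each a b I refl refl refl refl (λ _ _ _ i → i) (λ _ _ _ i → i) m≡₀ n≡₀
    (w≡₀ , (λ y ≤y y< → ⊥-elim (ℕₚ.<⇒≱ y< ≤y)) , inj₁ μ≡₀) step)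
  where
  Low : ℕ → ℚ → Set
  Low y μ = ∀ z → y ℕ.≤ z → z ℕ.< 2 ℕ.^ suc (a ℕ.+ b) → 0ℚ < wl z → 0ℚ < μ × μ ≤ wl z
  Attained : ℚ → Set
  Attained μ = μ ≡ 0ℚ ⊎ ∃[ i ] ∃[ j ] μ ≡ w i j
  I : ℕ → Memory → Set
  I y M = (∀ i j → M rat $w i j ≡ w i j) × Low y (M rat $μ 0 0) × Attained (M rat $μ 0 0)
  extend-low : ∀ {y μ μ′} → (0ℚ < μ → 0ℚ < μ′ × μ′ ≤ μ) → (0ℚ < wl y → 0ℚ < μ′ × μ′ ≤ wl y) → Low (suc y) μ → Low y μ′
  extend-low {y} old new low z y≤z z< 0<w with y ℕₚ.≟ z
  ... | yes refl = new 0<w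
  ... | no  y≢z with low z (ℕₚ.≤∧≢⇒< y≤z y≢z) z< 0<w
  ...   | 0<μ , μ≤w with old 0<μ
  ...     | 0<μ′ , μ′≤μ = 0<μ′ , ℚₚ.≤-trans μ′≤μ μ≤w
  step : ∀ i j M → i ℕ.< 2 ℕ.^ a → j ℕ.< 2 ℕ.^ b → M nat #i 0 0 ≡ i → M nat #j 0 0 ≡ j →
         M nat #m′ 0 0 ≡ 2 ℕ.^ a → M nat #n′ 0 0 ≡ 2 ℕ.^ b → I (suc (leaf a b i j)) M →
         Run minBody M 50 (I (leaf a b i j))
  step i j M i< j< refl refl _ _ (w≡ , low , att) = run-if
    (λ t₁ → run-if
      (λ t₂ → run-write (w≡ , extend-low (λ 0<μ → ⊥-elim (<⇒≱ 0<μ (≤-true t₂))) (λ _ → <-true t₁ , item≤) low , inj₂ (i , j , w≡ i j)))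
      (λ t₂ → run-if
        (λ t₃ → run-write (w≡ , extend-low (λ _ → <-true t₁ , ℚₚ.<⇒≤ (<-true t₃)) (λ _ → <-true t₁ , item≤) low , inj₂ (i , j , w≡ i j)))
        (λ t₃ → run-skip (w≡ , extend-low (λ 0<μ → 0<μ , ℚₚ.≤-refl) (λ _ → ≤-false t₂ , ℚₚ.≤-trans (<-false t₃) item≤) low , att))))
    (λ t₁ → run-skip (w≡ , extend-low (λ 0<μ → 0<μ , ℚₚ.≤-refl)
      (λ 0<w → ⊥-elim (<⇒≱ (subst (0ℚ <_) (sym item≡) 0<w) (<-false t₁))) low , att))
    where
    item≡ : M rat $w i j ≡ wl (leaf a b i j)
    item≡ = trans (w≡ i j) (w≡wl i j i< j<)
    item≤ : M rat $w i j ≤ wl (leaf a b i j)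
    item≤ = ℚₚ.≤-reflexive item≡

-- The grid of bucket boundaries

gridLoop : ℚ → Program
gridLoop ε = While (read rat $G (lit 0) (scalar nat #K) :≤ lit (1ℚ + ε) :* scalar rat $B)
  (write rat $G (lit 0) (lit 1 :+ scalar nat #K) (read rat $G (lit 0) (scalar nat #K) :* scalar rat $ρ) ⨾
   assign nat #K (lit 1 :+ scalar nat #K))

makeGrid : ℚ → Program
makeGrid ε = write rat $G (lit 0) (lit 1) (scalar rat $μ) ⨾ assign nat #K (lit 1) ⨾ gridLoop ε

makeGridTime : ℕ → ℕ
-- A literal costs 1 whatever its value, so `1ℚ` may replace `1ℚ + ε`, and the bound is independent
-- of ε.
makeGridTime k = 6 ℕ.+ (4 ℕ.+ loopTime (read rat $G (lit 0) (scalar nat #K) :≤ lit 1ℚ :* scalar rat $B) k 24)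

bucketCount : ∀ {μ ρ} → 0ℚ < μ → 1ℚ < ρ → ∀ x → ∃[ k ] (x < μ * ρ ^ k × (∀ j → j ℕ.< k → μ * ρ ^ j ≤ x))
bucketCount {μ} {ρ} 0<μ 1<ρ x = proj₁ found , proj₁ (proj₂ found) , λ j j<k → ℚₚ.≮⇒≥ (proj₂ (proj₂ found) j j<k)
  where
  large : ∃[ k ] div x μ < ρ ^ k
  large = archimedean-^ 1<ρ (div x μ)
  x< : x < μ * ρ ^ proj₁ large
  x< = subst (_< μ * ρ ^ proj₁ large) (trans (ℚₚ.*-comm μ (div x μ)) (div-* x (λ μ≡0 → ℚₚ.<-irrefl (sym μ≡0) 0<μ)))
         (ℚₚ.*-monoʳ-<-pos μ {{ℚ.positive 0<μ}} (proj₂ large))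
  found = least {λ k → x < μ * ρ ^ k} (λ k → x ℚₚ.<? μ * ρ ^ k) (proj₁ large) x<

run-makeGrid : ∀ {ε μ ρ B k M} → (1ℚ + ε) * B < μ * ρ ^ k → (∀ j → j ℕ.< k → μ * ρ ^ j ≤ (1ℚ + ε) * B) →
  M rat $μ 0 0 ≡ μ → M rat $ρ 0 0 ≡ ρ → M rat $B 0 0 ≡ B → M rat $G 0 0 ≡ 0ℚ →
  Run (makeGrid ε) M (makeGridTime k) (λ M′ → M′ nat #K 0 0 ≡ suc k × (∀ j → j ℕ.≤ suc k → M′ rat $G 0 j ≡ grid μ ρ j))
run-makeGrid {ε} {μ} {ρ} {B} {k₀} {M₀} beyond within μ≡₀ ρ≡₀ B≡₀ G0≡₀ =
  run-write-seq (run-write-seq (run-weaken ℕₚ.≤-refl finish (run-while I k₀ step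
    (z≤n , refl , ρ≡₀ , B≡₀ , start))))
  where
  I : ℕ → Memory → Set
  I k M = k ℕ.≤ k₀ × M nat #K 0 0 ≡ suc k × M rat $ρ 0 0 ≡ ρ × M rat $B 0 0 ≡ B × (∀ j → j ℕ.≤ suc k → M rat $G 0 j ≡ grid μ ρ j)
  start : ∀ j → j ℕ.≤ 1 → update M₀ rat $G 0 1 (M₀ rat $μ 0 0) rat $G 0 j ≡ grid μ ρ j
  start zero          _ = G0≡₀
  start (suc zero)    _ = trans μ≡₀ (sym (ℚₚ.*-identityʳ μ))
  start (suc (suc j)) (s≤s ())
  finish : ∀ M → _ → ∃[ k ] (I k M × evalTest (read rat $G (lit 0) (scalar nat #K) :≤ lit (1ℚ + ε) :* scalar rat $B) M ≡ false) →
           M nat #K 0 0 ≡ suc k₀ × (∀ j → j ℕ.≤ suc k₀ → M rat $G 0 j ≡ grid μ ρ j)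
  finish M _ (k , (k≤ , K≡ , ρ≡ , refl , G≡) , t) with k ℕₚ.≟ k₀
  ... | yes refl = K≡ , G≡
  ... | no  k≢k₀ = ⊥-elim (<⇒≱ (≤-false t) (subst (_≤ (1ℚ + ε) * M rat $B 0 0)
                     (sym (trans (cong (M rat $G 0) K≡) (G≡ (suc k) ℕₚ.≤-refl))) (within k (ℕₚ.≤∧≢⇒< k≤ k≢k₀))))
  step : ∀ k M → I k M → evalTest (read rat $G (lit 0) (scalar nat #K) :≤ lit (1ℚ + ε) :* scalar rat $B) M ≡ true →
         k ℕ.< k₀ × Run _ M 24 (I (suc k))
  step k M (k≤ , K≡ , ρ≡ , refl , G≡) t = k<k₀ , run-write-seq (run-write
    (k<k₀ , cong suc K≡ , ρ≡ , refl , new))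
    where
    top : M rat $G 0 (M nat #K 0 0) ≡ μ * ρ ^ k
    top = trans (cong (M rat $G 0) K≡) (G≡ (suc k) ℕₚ.≤-refl)
    k<k₀ : k ℕ.< k₀
    k<k₀ = ℕₚ.≤∧≢⇒< k≤ λ { refl → <⇒≱ beyond (subst (_≤ (1ℚ + ε) * M rat $B 0 0) top (≤-true t)) }
    next : M rat $G 0 (M nat #K 0 0) * M rat $ρ 0 0 ≡ μ * ρ ^ suc k
    next = trans (cong₂ _*_ top ρ≡) (lemma μ ρ (ρ ^ k))
      where
      lemma : ∀ μ ρ r → μ * r * ρ ≡ μ * (ρ * r)
      lemma = ring-solve ℚ-ring
    new : ∀ j → j ℕ.≤ suc (suc k) →
          update M rat $G 0 (suc (M nat #K 0 0)) (M rat $G 0 (M nat #K 0 0) * M rat $ρ 0 0) rat $G 0 j ≡ grid μ ρ j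
    new j j≤ with j ℕₚ.≟ suc (M nat #K 0 0)
    ... | yes refl rewrite ≡ᵇ-refl (M nat #K 0 0) = trans next (cong (grid μ ρ) (sym (cong suc K≡)))
    ... | no  j≢ rewrite ≡ᵇ-false (j≢ ∘ sym) =
      G≡ j (ℕₚ.≤-pred (ℕₚ.≤∧≢⇒< j≤ λ j≡ → j≢ (trans j≡ (cong suc (sym K≡)))))

-- Reading off the solution

bestBody : Program
bestBody =
  If (scalar rat $best :< read rat $V (lit 1) (scalar nat #k))
    (assign rat $best (read rat $V (lit 1) (scalar nat #k)) ⨾
     assign rat $code (read rat $C (lit 1) (scalar nat #k)))
    skip

findBest : Program
findBest = Down #k (scalar nat #K) bestBody

run-findBest : ∀ {K k M} → M nat #K 0 0 ≡ K → M rat $best 0 0 ≡ 0ℚ → k ℕ.< K → 0ℚ < M rat $V 1 k →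
  Run findBest M (downTime #k (scalar nat #K) K 27)
    (λ M′ → ∃[ j ] (j ℕ.< K × 0ℚ < M rat $V 1 j × (∀ i → i ℕ.< K → M rat $V 1 i ≤ M rat $V 1 j) × M′ rat $code 0 0 ≡ M rat $C 1 j))
run-findBest {K} {k₀} {M₀} K≡ best≡ k₀<K 0<V = run-weaken ℕₚ.≤-refl finish
  (run-down I K refl K≡ ((λ _ → refl) , (λ _ → refl) , (λ j K≤j j<K → ⊥-elim (ℕₚ.<⇒≱ j<K K≤j)) ,
    inj₁ best≡) step)
  where
  Found : ℚ → ℚ → Set
  Found best code = best ≡ 0ℚ ⊎ ∃[ j ] (j ℕ.< K × 0ℚ < M₀ rat $V 1 j × best ≡ M₀ rat $V 1 j × code ≡ M₀ rat $C 1 j)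
  I : ℕ → Memory → Set
  I k M = (∀ j → M rat $V 1 j ≡ M₀ rat $V 1 j) × (∀ j → M rat $C 1 j ≡ M₀ rat $C 1 j) ×
          (∀ j → k ℕ.≤ j → j ℕ.< K → M₀ rat $V 1 j ≤ M rat $best 0 0) × Found (M rat $best 0 0) (M rat $code 0 0)
  finish : ∀ M → _ → I 0 M → _
  finish M _ (_ , _ , max , inj₁ best≡0) = ⊥-elim (<⇒≱ 0<V (subst (_ ≤_) best≡0 (max k₀ z≤n k₀<K)))
  finish M _ (_ , _ , max , inj₂ (j , j<K , 0<V , best≡V , code≡)) =
    j , j<K , 0<V , (λ i i<K → subst (_ ≤_) best≡V (max i z≤n i<K)) , code≡
  0≤best : ∀ {best code} → Found best code → 0ℚ ≤ best
  0≤best (inj₁ refl) = ℚₚ.≤-refl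
  0≤best (inj₂ (_ , _ , 0<V , best≡V , _)) = ℚₚ.<⇒≤ (subst (0ℚ <_) (sym best≡V) 0<V)
  max-step : ∀ {k x y} → M₀ rat $V 1 k ≤ y → x ≤ y → (∀ j → suc k ℕ.≤ j → j ℕ.< K → M₀ rat $V 1 j ≤ x) →
             ∀ j → k ℕ.≤ j → j ℕ.< K → M₀ rat $V 1 j ≤ y
  max-step {k} new x≤y max j k≤j j<K with k ℕₚ.≟ j
  ... | yes refl = new
  ... | no  k≢j  = ℚₚ.≤-trans (max j (ℕₚ.≤∧≢⇒< k≤j k≢j) j<K) x≤y
  step : ∀ k M → k ℕ.< K → I (suc k) M → Run bestBody (update M nat #k 0 0 k) 27 (I k)
  step k M k<K (V≡ , C≡ , max , found) = run-if
    (λ t → run-write-seq (run-write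
      ( V≡ , C≡ , max-step (ℚₚ.≤-reflexive (sym (V≡ k))) (ℚₚ.<⇒≤ (<-true t)) max
      , inj₂ (k , k<K , subst (0ℚ <_) (V≡ k) (ℚₚ.≤-<-trans (0≤best found) (<-true t)) , V≡ k , C≡ k))))
    (λ t → run-skip (V≡ , C≡ , max-step (subst (_≤ M rat $best 0 0) (V≡ k) (<-false t)) ℚₚ.≤-refl max , found))

-- The inverse of `leaf`, used to transport item data to leaf numbers in the proof; the program
-- itself works with the loop counters.
rowOf colOf : ℕ → ℕ → ℕ → ℕ
rowOf a b z = (z DM./ 2 ℕ.^ b) {{ℕₚ.m^n≢0 2 b}} ℕ.∸ 2 ℕ.^ a
colOf a b z = (z DM.% 2 ℕ.^ b) {{ℕₚ.m^n≢0 2 b}}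

colOf-leaf : ∀ a b i {j} → j ℕ.< 2 ℕ.^ b → colOf a b (leaf a b i j) ≡ j
colOf-leaf a b i {j} j< = begin
  leaf a b i j DM.% 2 ℕ.^ b                              ≡⟨ cong (DM._% 2 ℕ.^ b) (ℕₚ.+-comm _ j) ⟩
  (j ℕ.+ (2 ℕ.^ a ℕ.+ i) ℕ.* 2 ℕ.^ b) DM.% 2 ℕ.^ b       ≡⟨ DM.[m+kn]%n≡m%n j (2 ℕ.^ a ℕ.+ i) (2 ℕ.^ b) ⟩
  j DM.% 2 ℕ.^ b                                         ≡⟨ DM.m<n⇒m%n≡m j< ⟩
  j                                                      ∎
  where
  open ≡-Reasoning
  instance nonZero = ℕₚ.m^n≢0 2 b

rowOf-leaf : ∀ a b i {j} → j ℕ.< 2 ℕ.^ b → rowOf a b (leaf a b i j) ≡ i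
rowOf-leaf a b i {j} j< = trans (cong (ℕ._∸ 2 ℕ.^ a) quotient) (ℕₚ.m+n∸m≡n (2 ℕ.^ a) i)
  where
  open ≡-Reasoning
  instance nonZero = ℕₚ.m^n≢0 2 b
  x = 2 ℕ.^ a ℕ.+ i
  quotient : leaf a b i j DM./ 2 ℕ.^ b ≡ x
  quotient = begin
    (x ℕ.* 2 ℕ.^ b ℕ.+ j) DM./ 2 ℕ.^ b                  ≡⟨ DM.+-distrib-/-∣ˡ j (n∣m*n x) ⟩
    x ℕ.* 2 ℕ.^ b DM./ 2 ℕ.^ b ℕ.+ j DM./ 2 ℕ.^ b       ≡⟨ cong₂ ℕ._+_ (DM.m*n/n≡m x (2 ℕ.^ b)) (DM.m<n⇒m/n≡0 j<) ⟩
    x ℕ.+ 0                                             ≡⟨ ℕₚ.+-identityʳ x ⟩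
    x                                                   ∎

leaf-injective : ∀ a b {i j i′ j′} → j ℕ.< 2 ℕ.^ b → j′ ℕ.< 2 ℕ.^ b → leaf a b i j ≡ leaf a b i′ j′ → i ≡ i′ × j ≡ j′
leaf-injective a b {i} {j} {i′} {j′} j< j′< eq =
  trans (sym (rowOf-leaf a b i j<)) (trans (cong (rowOf a b) eq) (rowOf-leaf a b i′ j′<)) ,
  trans (sym (colOf-leaf a b i j<)) (trans (cong (colOf a b) eq) (colOf-leaf a b i′ j′<))

-- Unpacking the code of a set

decodeBody : Program
decodeBody =
  assign rat $p (lit ½ :* scalar rat $p) ⨾
  If (scalar rat $p :≤ scalar rat $code)
    (write nat 2 (scalar nat #i) (scalar nat #j) (lit 1) ⨾
     assign rat $code (scalar rat $code :- scalar rat $p))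
    skip

decode : Program
decode = assign rat $p (lit 1ℚ) ⨾ each decodeBody

0≤½ : 0ℚ ≤ ½
0≤½ = ℚ.*≤* (ℤ.+≤+ z≤n)

leafCode-double : ∀ H {y} → y ℕ.< 2 ℕ.^ suc H → leafCode H y + leafCode H y ≡ leafCode H (suc y)
leafCode-double H {y} y< = trans (cong₂ _+_ (sym (leafCode-half H y<)) (sym (leafCode-half H y<))) (lemma (leafCode H (suc y)))
  where
  lemma : ∀ x → ½ * x + ½ * x ≡ x
  lemma x = trans (sym (ℚₚ.*-distribʳ-+ x ½ ½)) (ℚₚ.*-identityˡ x)

module Decoding (a b : ℕ) (φ : ℕ → Bool) where

  H N : ℕ
  H = a ℕ.+ b
  N = 2 ℕ.^ H

  codeSum : ℕ → ℚ
  codeSum p = rsum p (λ q → pick (φ (N ℕ.+ q)) (leafCode H (N ℕ.+ q)))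

  0≤leafCode : ∀ y → 0ℚ ≤ leafCode H y
  0≤leafCode y = 0≤^ 0≤½ (2 ℕ.^ suc H ℕ.∸ y)

  0≤codeSum : ∀ p → 0ℚ ≤ codeSum p
  0≤codeSum zero    = ℚₚ.≤-refl
  0≤codeSum (suc p) = 0≤+ (0≤codeSum p) (0≤pick (φ (N ℕ.+ p)) (0≤leafCode (N ℕ.+ p)))

  pick≤ : ∀ s {x} → 0ℚ ≤ x → pick s x ≤ x
  pick≤ true  _   = ℚₚ.≤-refl
  pick≤ false 0≤x = 0≤x

  -- Hence the set is read off its code greedily, starting from the last leaf,
  -- whose code is the largest.
  codeSum< : ∀ p → N ℕ.+ p ℕ.≤ 2 ℕ.^ suc H → codeSum p < leafCode H (N ℕ.+ p)
  codeSum< zero    _ = 0<^ (ℚ.*<* (ℤ.+<+ (s≤s z≤n))) (2 ℕ.^ suc H ℕ.∸ (N ℕ.+ 0))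
  codeSum< (suc p) N+p< = subst (codeSum (suc p) <_)
    (trans (leafCode-double H y<) (cong (leafCode H) (sym (ℕₚ.+-suc N p))))
    (ℚₚ.+-mono-<-≤ (codeSum< p (ℕₚ.<⇒≤ y<)) (pick≤ (φ (N ℕ.+ p)) (0≤leafCode (N ℕ.+ p))))
    where
    y< : N ℕ.+ p ℕ.< 2 ℕ.^ suc H
    y< = ℕₚ.≤-trans (ℕₚ.≤-reflexive (sym (ℕₚ.+-suc N p))) N+p<

  InRange : ℕ → ℕ → Set
  InRange i j = i ℕ.< 2 ℕ.^ a × j ℕ.< 2 ℕ.^ b

  run-decode : ∀ {M} → M nat #m′ 0 0 ≡ 2 ℕ.^ a → M nat #n′ 0 0 ≡ 2 ℕ.^ b → (∀ i j → M nat 2 i j ≡ 0) →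
    M rat $code 0 0 ≡ codeSum N →
    Run decode M (4 ℕ.+ eachTime (2 ℕ.^ a) (2 ℕ.^ b) 35)
      (λ M′ → ∀ i j → InRange i j → (M′ nat 2 i j ℕ.≡ᵇ 1) ≡ φ (leaf a b i j))
  run-decode {M₀} m≡₀ n≡₀ out≡₀ code≡₀ = run-write-seq (run-weaken ℕₚ.≤-refl
    (λ { M _ (_ , _ , _ , _ , done , _) i j r → done i j r (≤leaf a b i j) })
    (run-each a b I refl refl refl refl (λ _ _ _ i → i) (λ _ _ _ i → i) m≡₀ n≡₀
      (N , sym (2^suc H) , code≡₀ , sym (cong (½ ^_) (ℕₚ.n∸n≡0 (2 ℕ.^ suc H))) ,
        (λ { i j (i< , j<) ≤y → ⊥-elim (ℕₚ.<⇒≱ (leaf< a b i< j<) ≤y) }) , λ i j _ _ → out≡₀ i j) step))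
    where
    I : ℕ → Memory → Set
    I y M = ∃[ p ] (N ℕ.+ p ≡ y × M rat $code 0 0 ≡ codeSum p × M rat $p 0 0 ≡ leafCode H y ×
              (∀ i j → InRange i j → y ℕ.≤ leaf a b i j → (M nat 2 i j ℕ.≡ᵇ 1) ≡ φ (leaf a b i j)) ×
              (∀ i j → InRange i j → leaf a b i j ℕ.< y → M nat 2 i j ≡ 0))
    step : ∀ i j M → i ℕ.< 2 ℕ.^ a → j ℕ.< 2 ℕ.^ b → M nat #i 0 0 ≡ i → M nat #j 0 0 ≡ j →
           M nat #m′ 0 0 ≡ 2 ℕ.^ a → M nat #n′ 0 0 ≡ 2 ℕ.^ b → I (suc (leaf a b i j)) M →
           Run decodeBody M 35 (I (leaf a b i j))
    step i j M i< j< refl refl _ _ (zero , N+0≡ , _) =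
      ⊥-elim (ℕₚ.<-irrefl (trans (sym (ℕₚ.+-identityʳ N)) N+0≡) (s≤s (≤leaf a b i j)))
    step i j M i< j< refl refl _ _ (suc p , N+p≡ , code≡ , p≡ , done , todo) = run-write-seq (run-if
      (λ t → run-write-seq (run-write (p , N+p≡y , taken t , pw , (λ i′ j′ r → written t i′ j′ r) , (λ i′ j′ r → unwritten i′ j′ r))))
      (λ t → run-skip (p , N+p≡y , skipped t , pw ,
        (λ i′ j′ r y≤ → same (selected-false t) i′ j′ r y≤) , λ i′ j′ r y′<y → todo i′ j′ r (ℕₚ.m≤n⇒m≤1+n y′<y))))
      where
      y = leaf a b i j
      y<end : y ℕ.< 2 ℕ.^ suc H
      y<end = leaf< a b i< j<
      N+p≡y : N ℕ.+ p ≡ y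
      N+p≡y = ℕₚ.suc-injective (trans (sym (ℕₚ.+-suc N p)) N+p≡)
      pw : ½ * M rat $p 0 0 ≡ leafCode H y
      pw = trans (cong (½ *_) p≡) (leafCode-half H y<end)
      code≡′ : M rat $code 0 0 ≡ codeSum p + pick (φ y) (leafCode H y)
      code≡′ = trans code≡ (cong (λ z → codeSum p + pick (φ z) (leafCode H z)) N+p≡y)
      below : codeSum p < leafCode H y
      below = subst (λ z → codeSum p < leafCode H z) N+p≡y (codeSum< p (ℕₚ.≤-trans (ℕₚ.≤-reflexive N+p≡y) (ℕₚ.<⇒≤ y<end)))
      selected-true : does (½ * M rat $p 0 0 ℚₚ.≤? M rat $code 0 0) ≡ true → φ y ≡ true
      selected-true t = go (φ y) refl
        where
        go : ∀ s → φ y ≡ s → φ y ≡ true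
        go true  eq = eq
        go false eq = ⊥-elim (<⇒≱ below (subst₂ _≤_ pw
          (trans code≡′ (trans (cong (λ s → codeSum p + pick s (leafCode H y)) eq) (ℚₚ.+-identityʳ (codeSum p)))) (≤-true t)))
      selected-false : does (½ * M rat $p 0 0 ℚₚ.≤? M rat $code 0 0) ≡ false → φ y ≡ false
      selected-false t = go (φ y) refl
        where
        go : ∀ s → φ y ≡ s → φ y ≡ false
        go false eq = eq
        go true  eq = ⊥-elim (<⇒≱ (subst₂ _<_ (trans code≡′ (cong (λ s → codeSum p + pick s (leafCode H y)) eq)) pw (≤-false t))
                        (≤+ʳ (0≤codeSum p)))
      taken : does (½ * M rat $p 0 0 ℚₚ.≤? M rat $code 0 0) ≡ true → M rat $code 0 0 - ½ * M rat $p 0 0 ≡ codeSum p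
      taken t = trans (cong₂ _-_ (trans code≡′ (cong (λ s → codeSum p + pick s (leafCode H y)) (selected-true t))) pw)
                      (lemma (codeSum p) (leafCode H y))
        where
        lemma : ∀ x y → x + y - y ≡ x
        lemma = ring-solve ℚ-ring
      skipped : does (½ * M rat $p 0 0 ℚₚ.≤? M rat $code 0 0) ≡ false → M rat $code 0 0 ≡ codeSum p
      skipped t = trans code≡′ (trans (cong (λ s → codeSum p + pick s (leafCode H y)) (selected-false t)) (ℚₚ.+-identityʳ (codeSum p)))
      written : does (½ * M rat $p 0 0 ℚₚ.≤? M rat $code 0 0) ≡ true → ∀ i′ j′ → InRange i′ j′ → y ℕ.≤ leaf a b i′ j′ →
                (update M nat 2 i j 1 nat 2 i′ j′ ℕ.≡ᵇ 1) ≡ φ (leaf a b i′ j′)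
      written t i′ j′ r y≤ with i ℕ.≡ᵇ i′ in eq₁ | j ℕ.≡ᵇ j′ in eq₂
      ... | true | true = sym (trans (cong φ (sym (cong₂ (leaf a b) (≡ᵇ-sound i i′ eq₁) (≡ᵇ-sound j j′ eq₂)))) (selected-true t))
      ... | true | false = done i′ j′ r (ℕₚ.≤∧≢⇒< y≤ λ eq →
              diff eq₂ (proj₂ (leaf-injective a b j< (proj₂ r) eq)))
        where
        diff : ∀ {x z} → (x ℕ.≡ᵇ z) ≡ false → x ≡ z → ⊥
        diff {x} eq refl with trans (sym (≡ᵇ-refl x)) eq
        ... | ()
      ... | false | _ = done i′ j′ r (ℕₚ.≤∧≢⇒< y≤ λ eq →
              diff eq₁ (proj₁ (leaf-injective a b j< (proj₂ r) eq)))
        where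
        diff : ∀ {x z} → (x ℕ.≡ᵇ z) ≡ false → x ≡ z → ⊥
        diff {x} eq refl with trans (sym (≡ᵇ-refl x)) eq
        ... | ()
      unwritten : ∀ i′ j′ → InRange i′ j′ → leaf a b i′ j′ ℕ.< y → update M nat 2 i j 1 nat 2 i′ j′ ≡ 0
      unwritten i′ j′ r y′<y with i ℕ.≡ᵇ i′ in eq₁ | j ℕ.≡ᵇ j′ in eq₂
      ... | true  | true  = ⊥-elim (ℕₚ.<-irrefl (cong₂ (leaf a b) (sym (≡ᵇ-sound i i′ eq₁)) (sym (≡ᵇ-sound j j′ eq₂))) y′<y)
      ... | true  | false = todo i′ j′ r (ℕₚ.m≤n⇒m≤1+n y′<y)
      ... | false | _     = todo i′ j′ r (ℕₚ.m≤n⇒m≤1+n y′<y)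
      same : φ y ≡ false → ∀ i′ j′ → InRange i′ j′ → y ℕ.≤ leaf a b i′ j′ → (M nat 2 i′ j′ ℕ.≡ᵇ 1) ≡ φ (leaf a b i′ j′)
      same off i′ j′ r y≤ with y ℕₚ.≟ leaf a b i′ j′
      ... | yes eq = trans (cong (ℕ._≡ᵇ 1) (todo i′ j′ r (s≤s (ℕₚ.≤-reflexive (sym eq))))) (trans (sym off) (cong φ eq))
      ... | no  ne = done i′ j′ r (ℕₚ.≤∧≢⇒< y≤ ne)

-- Instances as trees

extend-toℕ : ∀ {A : Set} {k} (d : A) (f : Fin k → A) i → extend d f (toℕ i) ≡ f i
extend-toℕ {k = k} d f i with toℕ i ℕₚ.<? k
... | yes i<k = cong f (fromℕ<-toℕ i i<k)
... | no  i≮k = ⊥-elim (i≮k (toℕ<n i))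

extend-outside : ∀ {A : Set} {k} (d : A) (f : Fin k → A) {i} → k ℕ.≤ i → extend d f i ≡ d
extend-outside {k = k} d f {i} k≤i with i ℕₚ.<? k
... | yes i<k = ⊥-elim (ℕₚ.<⇒≱ i<k k≤i)
... | no  _   = refl

extend-all : ∀ {A : Set} {k} (P : A → Set) (d : A) (f : Fin k → A) → P d → (∀ i → P (f i)) → ∀ i → P (extend d f i)
extend-all {k = k} P d f Pd Pf i with i ℕₚ.<? k
... | yes i<k = Pf (fromℕ< i<k)
... | no  _   = Pd

pick-0 : ∀ s → pick s 0ℚ ≡ 0ℚ
pick-0 true  = refl
pick-0 false = refl

size≤n : ∀ {k} (f : Fin k → ℕ) i → f i ℕ.≤ foldr ℕ._⊔_ 0 f
size≤n {suc k} f Fin.zero    = ℕₚ.m≤m⊔n (f Fin.zero) _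
size≤n {suc k} f (Fin.suc i) = ℕₚ.≤-trans (size≤n (f ∘ Fin.suc) i) (ℕₚ.m≤n⊔m (f Fin.zero) _)

atCategory-inside : ∀ m i {p q} → i ℕ.< m → atCategory m (m ℕ.+ i) p q ≡ p
atCategory-inside m i i<m
  rewrite dec-true (m ℕₚ.≤? m ℕ.+ i) (ℕₚ.m≤m+n m i)
        | dec-true (m ℕ.+ i ℕₚ.<? 2 ℕ.* m) (ℕₚ.+-monoʳ-< m (ℕₚ.<-≤-trans i<m (ℕₚ.m≤m+n m 0))) = refl

atCategory-below : ∀ m x {p q} → x ℕ.< m → atCategory m x p q ≡ q
atCategory-below m x x<m rewrite dec-false (m ℕₚ.≤? x) (ℕₚ.<⇒≱ x<m) = refl

atCategory-above : ∀ m x {p q} → 2 ℕ.* m ℕ.≤ x → atCategory m x p q ≡ q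
atCategory-above m x 2m≤x
  rewrite dec-true (m ℕₚ.≤? x) (ℕₚ.≤-trans (ℕₚ.m≤m+n m _) 2m≤x)
        | dec-false (x ℕₚ.<? 2 ℕ.* m) (ℕₚ.≤⇒≯ 2m≤x) = refl

module Flatten (I : Instance) (a b : ℕ)
  (padded : Padded (Instance.m I) (Instance.n I) (extend 0 (Instance.size I)) a b) where

  open Instance I
  open Padded padded

  -- Spelled exactly like the layout of the input arrays, so that the initial memory agrees with it
  -- by definition.
  pad : ((i : Fin m) → Fin (size i) → ℚ) → ℕ → ℕ → ℚ
  pad f i j = extend 0ℚ (λ k → extend 0ℚ (f k) j) i

  flat : ((i : Fin m) → Fin (size i) → ℚ) → ℕ → ℚ
  flat f y = pad f (rowOf a b y) (colOf a b y)

  flat-leaf : ∀ f i j → j ℕ.< 2 ℕ.^ b → flat f (leaf a b i j) ≡ pad f i j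
  flat-leaf f i j j< = cong₂ (pad f) (rowOf-leaf a b i j<) (colOf-leaf a b i j<)

  pad-item : ∀ f i j → pad f (toℕ i) (toℕ j) ≡ f i j
  pad-item f i j = trans (extend-toℕ 0ℚ (λ k → extend 0ℚ (f k) (toℕ j)) i) (extend-toℕ 0ℚ (f i) j)

  pad-row : ∀ f {i} j → m ℕ.≤ i → pad f i j ≡ 0ℚ
  pad-row f j m≤i = extend-outside 0ℚ (λ k → extend 0ℚ (f k) j) m≤i

  pad-col : ∀ f i {j} → size i ℕ.≤ j → pad f (toℕ i) j ≡ 0ℚ
  pad-col f i {j} s≤j = trans (extend-toℕ 0ℚ (λ k → extend 0ℚ (f k) j) i) (extend-outside 0ℚ (f i) s≤j)

  pad-all : (P : ℚ → Set) → ∀ f → P 0ℚ → (∀ i j → P (f i j)) → ∀ i j → P (pad f i j)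
  pad-all P f P0 Pf i j = extend-all P 0ℚ (λ k → extend 0ℚ (f k) j) P0 (λ k → extend-all P 0ℚ (f k) P0 (Pf k) j) i

  size≤2ᵇ : ∀ i → size i ℕ.≤ 2 ℕ.^ b
  size≤2ᵇ i = ℕₚ.≤-trans (ℕₚ.≤-reflexive (sym (extend-toℕ 0 size i))) (size≤ (toℕ i) (toℕ<n i))

  category : (φ : ℕ → Bool) → ((i : Fin m) → Fin (size i) → ℚ) → ℕ → ℚ
  category φ f i = tot b (2 ℕ.^ a ℕ.+ i) (tab b (2 ℕ.^ a ℕ.+ i) φ) (flat f)

  category-rsum : ∀ φ f i → category φ f i ≡ rsum (2 ℕ.^ b) (λ p → pick (φ (leaf a b i p)) (pad f i p))
  category-rsum φ f i = trans (tot-tab b (2 ℕ.^ a ℕ.+ i) φ (flat f))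
    (rsum-cong (2 ℕ.^ b) λ p p< → cong (pick (φ (leaf a b i p))) (flat-leaf f i p p<))

  category-outside : ∀ φ f i → m ℕ.≤ i → category φ f i ≡ 0ℚ
  category-outside φ f i m≤i = trans (category-rsum φ f i)
    (rsum-0 (2 ℕ.^ b) λ p _ → trans (cong (pick (φ (leaf a b i p))) (pad-row f p m≤i)) (pick-0 (φ (leaf a b i p))))

  module _ (S : Selection) (φ : ℕ → Bool) (agrees : ∀ i j → φ (leaf a b (toℕ i) (toℕ j)) ≡ lookup (S i) j) where

    -- `agrees` fixes the bits of genuine items. Those of padding leaves are arbitrary, as padding
    -- has weight and value 0; a decoded set may therefore contain padding leaves.
    category-sum : ∀ f i → category φ f (toℕ i) ≡ Σ∈ (S i) (f i)
    category-sum f i = begin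
      category φ f (toℕ i)                ≡⟨ category-rsum φ f (toℕ i) ⟩
      rsum (2 ℕ.^ b) g                    ≡⟨ rsum-pad g (size≤2ᵇ i) (λ p s≤p → trans (cong (pick (φ (leaf a b (toℕ i) p))) (pad-col f i s≤p))
                                                                                (pick-0 (φ (leaf a b (toℕ i) p)))) ⟩
      rsum (size i) g                     ≡⟨ ∑≡rsum (size i) g ⟨
      (∑[ j < size i ] g (toℕ j))         ≡⟨ sum-cong-≗ (λ j → cong₂ pick (agrees i j) (pad-item f i j)) ⟩
      Σ∈ (S i) (f i)                      ∎
      where
      open ≡-Reasoning
      g : ℕ → ℚ
      g p = pick (φ (leaf a b (toℕ i) p)) (pad f (toℕ i) p)

    total-sum : ∀ f → tot (a ℕ.+ b) 1 (tab (a ℕ.+ b) 1 φ) (flat f) ≡ (∑[ i < m ] Σ∈ (S i) (f i))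
    total-sum f = begin
      tot (a ℕ.+ b) 1 (tab (a ℕ.+ b) 1 φ) (flat f)
        ≡⟨ tot-tab (a ℕ.+ b) 1 φ (flat f) ⟩
      rsum (2 ℕ.^ (a ℕ.+ b)) (λ p → g (1 ℕ.* 2 ℕ.^ (a ℕ.+ b) ℕ.+ p))
        ≡⟨ cong (λ N → rsum N (λ p → g (1 ℕ.* N ℕ.+ p))) (ℕₚ.^-distribˡ-+-* 2 a b) ⟩
      rsum (2 ℕ.^ a ℕ.* 2 ℕ.^ b) (λ p → g (1 ℕ.* (2 ℕ.^ a ℕ.* 2 ℕ.^ b) ℕ.+ p))
        ≡⟨ rsum-* (2 ℕ.^ a) (2 ℕ.^ b) (λ p → g (1 ℕ.* (2 ℕ.^ a ℕ.* 2 ℕ.^ b) ℕ.+ p)) ⟩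
      rsum (2 ℕ.^ a) (λ i → rsum (2 ℕ.^ b) (λ p → g (1 ℕ.* (2 ℕ.^ a ℕ.* 2 ℕ.^ b) ℕ.+ (i ℕ.* 2 ℕ.^ b ℕ.+ p))))
        ≡⟨ rsum-cong (2 ℕ.^ a) (λ i _ → trans (rsum-cong (2 ℕ.^ b) (λ p _ → cong g (index (2 ℕ.^ a) i (2 ℕ.^ b) p)))
                                              (sym (tot-tab b (2 ℕ.^ a ℕ.+ i) φ (flat f)))) ⟩
      rsum (2 ℕ.^ a) (category φ f)
        ≡⟨ rsum-pad (category φ f) m≤ (category-outside φ f) ⟩
      rsum m (category φ f)
        ≡⟨ ∑≡rsum m (category φ f) ⟨
      (∑[ i < m ] category φ f (toℕ i))
        ≡⟨ sum-cong-≗ (category-sum f) ⟩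
      (∑[ i < m ] Σ∈ (S i) (f i)) ∎
      where
      open ≡-Reasoning
      g : ℕ → ℚ
      g y = pick (φ y) (flat f y)
      index : ∀ A i N p → 1 ℕ.* (A ℕ.* N) ℕ.+ (i ℕ.* N ℕ.+ p) ≡ (A ℕ.+ i) ℕ.* N ℕ.+ p
      index = ℕ-solve

  -- Feasible selections meet the exact bounds of all nodes

  bits : Selection → ℕ → Bool
  bits S y = extend false (λ k → extend false (lookup (S k)) (colOf a b y)) (rowOf a b y)

  bits-agree : ∀ S i j → bits S (leaf a b (toℕ i) (toℕ j)) ≡ lookup (S i) j
  bits-agree S i j = begin
    bits S (leaf a b (toℕ i) (toℕ j))
      ≡⟨ cong₂ (λ r c → extend false (λ k → extend false (lookup (S k)) c) r) (rowOf-leaf a b (toℕ i) j<) (colOf-leaf a b (toℕ i) j<) ⟩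
    extend false (λ k → extend false (lookup (S k)) (toℕ j)) (toℕ i)
      ≡⟨ extend-toℕ false (λ k → extend false (lookup (S k)) (toℕ j)) i ⟩
    extend false (lookup (S i)) (toℕ j)
      ≡⟨ extend-toℕ false (lookup (S i)) j ⟩
    lookup (S i) j ∎
    where
    open ≡-Reasoning
    j< : toℕ j ℕ.< 2 ℕ.^ b
    j< = ℕₚ.<-≤-trans (toℕ<n j) (size≤2ᵇ i)

  lˡ uˡ : ℕ → ℚ
  lˡ = extend 0ℚ l
  uˡ = extend 0ℚ u

  loˡ hiˡ : ℕ → ℚ
  loˡ x = atCategory (2 ℕ.^ a) x (lˡ (x ℕ.∸ 2 ℕ.^ a)) 0ℚ
  hiˡ x = atCategory (2 ℕ.^ a) x (uˡ (x ℕ.∸ 2 ℕ.^ a)) B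

  open Bounds (flat w) loˡ hiˡ

  lo-category : ∀ i → i ℕ.< 2 ℕ.^ a → loˡ (2 ℕ.^ a ℕ.+ i) ≡ lˡ i
  lo-category i i< = trans (atCategory-inside (2 ℕ.^ a) i i<) (cong lˡ (ℕₚ.m+n∸m≡n (2 ℕ.^ a) i))

  hi-category : ∀ i → i ℕ.< 2 ℕ.^ a → hiˡ (2 ℕ.^ a ℕ.+ i) ≡ uˡ i
  hi-category i i< = trans (atCategory-inside (2 ℕ.^ a) i i<) (cong uˡ (ℕₚ.m+n∸m≡n (2 ℕ.^ a) i))

  flat-all : (P : ℚ → Set) → ∀ f → P 0ℚ → (∀ i j → P (f i j)) → ∀ y → P (flat f y)
  flat-all P f P0 Pf y = pad-all P f P0 Pf (rowOf a b y) (colOf a b y)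

  0≤flat-w : ∀ y → 0ℚ ≤ flat w y
  0≤flat-w = flat-all (0ℚ ≤_) w ℚₚ.≤-refl w≥0

  module _ (S : Selection) (feasible : Feasible S) where

    open Feasible feasible

    private
      φ : ℕ → Bool
      φ = bits S

      weightAt : ℕ → ℕ → ℚ
      weightAt h x = tot h x (tab h x φ) (flat w)

      0≤weightAt : ∀ h x → 0ℚ ≤ weightAt h x
      0≤weightAt h x = 0≤tot 0≤flat-w h x (tab h x φ)

    total≤B : weightAt (a ℕ.+ b) 1 ≤ B
    total≤B = subst (_≤ B) (sym (total-sum S φ (bits-agree S) w)) capacity

    free-exact : ∀ h x → (∀ p q → atCategory (2 ℕ.^ a) x p q ≡ q) → weightAt (suc h) x ≤ B →
                 Exact h (left x) (tab h (left x) φ) → Exact h (right x) (tab h (right x) φ) → Exact (suc h) x (tab (suc h) x φ)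
    free-exact h x at ≤B exˡ exʳ =
      subst (_≤ weightAt (suc h) x) (sym (at (lˡ (x ℕ.∸ 2 ℕ.^ a)) 0ℚ)) (0≤weightAt (suc h) x) ,
      subst (weightAt (suc h) x ≤_) (sym (at (uˡ (x ℕ.∸ 2 ℕ.^ a)) B)) ≤B , exˡ , exʳ

    left≤ : ∀ h x → weightAt (suc h) x ≤ B → weightAt h (left x) ≤ B
    left≤ h x = ℚₚ.≤-trans (≤+ˡ (0≤weightAt h (right x)))

    right≤ : ∀ h x → weightAt (suc h) x ≤ B → weightAt h (right x) ≤ B
    right≤ h x = ℚₚ.≤-trans (≤+ʳ (0≤weightAt h (left x)))

    -- Below the categories the interval is [ 0 , B ], and by nonnegativity no subtree outweighs the
    -- whole.
    exact-below : ∀ h x → 2 ℕ.* 2 ℕ.^ a ℕ.≤ x → weightAt h x ≤ B → Exact h x (tab h x φ)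
    exact-below zero    x _ _ = tt
    exact-below (suc h) x 2m≤x ≤B = free-exact h x (λ p q → atCategory-above (2 ℕ.^ a) x 2m≤x) ≤B
      (exact-below h (left x) 2m≤2x (left≤ h x ≤B)) (exact-below h (right x) (ℕₚ.m≤n⇒m≤1+n 2m≤2x) (right≤ h x ≤B))
      where
      2m≤2x : 2 ℕ.* 2 ℕ.^ a ℕ.≤ left x
      2m≤2x = ℕₚ.≤-trans 2m≤x (ℕₚ.m≤m+n x _)

    category-bounds : ∀ i → lˡ i ≤ category φ w i × category φ w i ≤ uˡ i
    category-bounds i with i ℕₚ.<? m
    -- A padding category has weight 0, and both of its bounds default to 0.
    ... | no  i≮m = ℚₚ.≤-reflexive (sym none) , ℚₚ.≤-reflexive none
      where none = category-outside φ w i (ℕₚ.≮⇒≥ i≮m)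
    ... | yes i<m = subst₂ (λ j x → l (fromℕ< i<m) ≤ category φ w j × category φ w j ≤ x) (toℕ-fromℕ< i<m) refl
      (subst (λ x → l i′ ≤ x × x ≤ u i′) (sym (category-sum S φ (bits-agree S) w i′)) (lower i′ , upper i′))
      where i′ = fromℕ< i<m

    exact-node : ∀ h x → 2 ℕ.* 2 ℕ.^ a ℕ.≤ left x → weightAt h x ≤ B → loˡ x ≤ weightAt h x → weightAt h x ≤ hiˡ x →
                 Exact h x (tab h x φ)
    exact-node zero    x _ _ _ _ = tt
    exact-node (suc h) x 2m≤2x ≤B lo≤ ≤hi = lo≤ , ≤hi ,
      exact-below h (left x) 2m≤2x (left≤ h x ≤B) , exact-below h (right x) (ℕₚ.m≤n⇒m≤1+n 2m≤2x) (right≤ h x ≤B)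

    exact-category : ∀ i → i ℕ.< 2 ℕ.^ a → weightAt b (2 ℕ.^ a ℕ.+ i) ≤ B →
                     Exact b (2 ℕ.^ a ℕ.+ i) (tab b (2 ℕ.^ a ℕ.+ i) φ)
    exact-category i i< ≤B = exact-node b (2 ℕ.^ a ℕ.+ i) (ℕₚ.*-monoʳ-≤ 2 (ℕₚ.m≤m+n (2 ℕ.^ a) i)) ≤B
      (subst (_≤ category φ w i) (sym (lo-category i i<)) (proj₁ (category-bounds i)))
      (subst (category φ w i ≤_) (sym (hi-category i i<)) (proj₂ (category-bounds i)))

    -- The two inequalities say that the descendants of `x` by k levels are categories. They pass to
    -- both children, and for positive `k` they place `x` itself above the categories.
    exact-above : ∀ k x → 2 ℕ.^ a ℕ.≤ x ℕ.* 2 ℕ.^ k → suc x ℕ.* 2 ℕ.^ k ℕ.≤ 2 ℕ.* 2 ℕ.^ a →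
                  weightAt (k ℕ.+ b) x ≤ B → Exact (k ℕ.+ b) x (tab (k ℕ.+ b) x φ)
    exact-above zero x m≤ ≤2m ≤B = subst (λ x → Exact b x (tab b x φ)) m+i≡x
      (exact-category (x ℕ.∸ 2 ℕ.^ a)
        (ℕₚ.+-cancelˡ-< (2 ℕ.^ a) _ _ (subst₂ ℕ._<_ (sym m+i≡x) (cong (2 ℕ.^ a ℕ.+_) (ℕₚ.+-identityʳ (2 ℕ.^ a)))
          (ℕₚ.≤-trans (ℕₚ.≤-reflexive (sym (ℕₚ.*-identityʳ (suc x)))) ≤2m)))
        (subst (λ x → weightAt b x ≤ B) (sym m+i≡x) ≤B))
      where
      m+i≡x : 2 ℕ.^ a ℕ.+ (x ℕ.∸ 2 ℕ.^ a) ≡ x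
      m+i≡x = ℕₚ.m+[n∸m]≡n (ℕₚ.≤-trans m≤ (ℕₚ.≤-reflexive (ℕₚ.*-identityʳ x)))
    exact-above (suc k) x m≤ ≤2m ≤B = free-exact (k ℕ.+ b) x (λ p q → atCategory-below (2 ℕ.^ a) x x<m) ≤B
      (exact-above k (left x) (ℕₚ.≤-trans m≤ (ℕₚ.≤-reflexive (sym (leaves-left x k))))
        (ℕₚ.≤-trans (ℕₚ.*-monoˡ-≤ (2 ℕ.^ k) (ℕₚ.n≤1+n (suc (left x)))) end≤) (left≤ (k ℕ.+ b) x ≤B))
      (exact-above k (right x)
        (ℕₚ.≤-trans m≤ (ℕₚ.≤-trans (ℕₚ.m≤m+n _ (2 ℕ.^ k)) (ℕₚ.≤-reflexive (sym (leaves-right x k))))) end≤ (right≤ (k ℕ.+ b) x ≤B))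
      where
      end≤ : suc (right x) ℕ.* 2 ℕ.^ k ℕ.≤ 2 ℕ.* 2 ℕ.^ a
      end≤ = ℕₚ.≤-trans (ℕₚ.≤-reflexive (end-right x (2 ℕ.^ k))) ≤2m
      x<m : x ℕ.< 2 ℕ.^ a
      x<m = ℕₚ.*-cancelˡ-≤ 2 (begin
        2 ℕ.* suc x                  ≡⟨ ℕₚ.*-comm 2 (suc x) ⟩
        suc x ℕ.* 2                  ≤⟨ ℕₚ.*-monoʳ-≤ (suc x) (ℕₚ.*-monoʳ-≤ 2 (ℕₚ.m^n>0 2 k)) ⟩
        suc x ℕ.* 2 ℕ.^ suc k        ≤⟨ ≤2m ⟩
        2 ℕ.* 2 ℕ.^ a                ∎)
        where open ℕₚ.≤-Reasoning

    exact-root : Exact (a ℕ.+ b) 1 (tab (a ℕ.+ b) 1 φ)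
    exact-root = exact-above a 1 (ℕₚ.≤-reflexive (sym (ℕₚ.+-identityʳ (2 ℕ.^ a)))) ℕₚ.≤-refl total≤B

  -- Relaxed bounds of the nodes, read back as bounds of the instance

  approx-node : ∀ {ε} h x s → 1 ℕ.≤ h → Approx ε h x s →
                (1ℚ - ε) * loˡ x ≤ tot h x s (flat w) × tot h x s (flat w) ≤ (1ℚ + ε) * hiˡ x
  approx-node (suc h) x s _ (lo≤ , ≤hi , _) = lo≤ , ≤hi

  approx-descend : ∀ {ε} φ k x → Approx ε (k ℕ.+ b) x (tab (k ℕ.+ b) x φ) → ∀ i → i ℕ.< 2 ℕ.^ k →
                   Approx ε b (x ℕ.* 2 ℕ.^ k ℕ.+ i) (tab b (x ℕ.* 2 ℕ.^ k ℕ.+ i) φ)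
  approx-descend {ε} φ zero x ok zero i< =
    subst (λ x → Approx ε b x (tab b x φ)) (sym (trans (ℕₚ.+-identityʳ (x ℕ.* 1)) (ℕₚ.*-identityʳ x))) ok
  approx-descend φ zero x ok (suc i) (s≤s ())
  approx-descend {ε} φ (suc k) x (_ , _ , okˡ , okʳ) i i< with i ℕₚ.<? 2 ℕ.^ k
  ... | yes i<k = subst (λ x → Approx ε b x (tab b x φ)) (cong (ℕ._+ i) (leaves-left x k)) (approx-descend φ k (left x) okˡ i i<k)
  ... | no  i≮k = subst (λ x → Approx ε b x (tab b x φ)) eq (approx-descend φ k (right x) okʳ (i ℕ.∸ 2 ℕ.^ k) i′<)
    where
    k+i′ : 2 ℕ.^ k ℕ.+ (i ℕ.∸ 2 ℕ.^ k) ≡ i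
    k+i′ = ℕₚ.m+[n∸m]≡n (ℕₚ.≮⇒≥ i≮k)
    i′< : i ℕ.∸ 2 ℕ.^ k ℕ.< 2 ℕ.^ k
    i′< = ℕₚ.+-cancelˡ-< (2 ℕ.^ k) _ _ (subst₂ ℕ._<_ (sym k+i′) (2^suc k) i<)
    eq : right x ℕ.* 2 ℕ.^ k ℕ.+ (i ℕ.∸ 2 ℕ.^ k) ≡ x ℕ.* 2 ℕ.^ suc k ℕ.+ i
    eq = trans (cong (ℕ._+ (i ℕ.∸ 2 ℕ.^ k)) (leaves-right x k)) (trans (ℕₚ.+-assoc (x ℕ.* 2 ℕ.^ suc k) _ _) (cong (x ℕ.* 2 ℕ.^ suc k ℕ.+_) k+i′))

  module _ {ε} (φ : ℕ → Bool) (S : Selection) (agrees : ∀ i j → φ (leaf a b (toℕ i) (toℕ j)) ≡ lookup (S i) j)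
           (ok : Approx ε (a ℕ.+ b) 1 (tab (a ℕ.+ b) 1 φ)) where

    approx-category : ∀ i → (1ℚ - ε) * l i ≤ categoryWeight S i × categoryWeight S i ≤ (1ℚ + ε) * u i
    approx-category i =
      subst₂ _≤_ (cong ((1ℚ - ε) *_) (trans (lo-category (toℕ i) i<) (extend-toℕ 0ℚ l i))) (category-sum S φ agrees w i) (proj₁ bounds) ,
      subst₂ _≤_ (category-sum S φ agrees w i) (cong ((1ℚ + ε) *_) (trans (hi-category (toℕ i) i<) (extend-toℕ 0ℚ u i))) (proj₂ bounds)
      where
      i< : toℕ i ℕ.< 2 ℕ.^ a
      i< = ℕₚ.<-≤-trans (toℕ<n i) m≤
      x = 2 ℕ.^ a ℕ.+ toℕ i
      bounds : (1ℚ - ε) * loˡ x ≤ category φ w (toℕ i) × category φ w (toℕ i) ≤ (1ℚ + ε) * hiˡ x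
      bounds = approx-node b x (tab b x φ) 1≤b (subst (λ x → Approx ε b x (tab b x φ))
        (cong (ℕ._+ toℕ i) (ℕₚ.+-identityʳ (2 ℕ.^ a))) (approx-descend φ a 1 ok (toℕ i) i<))

    approx-total : totalWeight S ≤ (1ℚ + ε) * B
    approx-total = subst₂ _≤_ (total-sum S φ agrees w)
      (cong ((1ℚ + ε) *_) (atCategory-below (2 ℕ.^ a) 1 (ℕₚ.^-monoʳ-< 2 (s≤s (s≤s z≤n)) {0} {a} 1≤a)))
      (proj₂ (approx-node (a ℕ.+ b) 1 (tab (a ℕ.+ b) 1 φ) (ℕₚ.≤-trans 1≤a (ℕₚ.m≤m+n a b)) ok))

-- Correctness of the program

solve : ℚ → Program
solve ε = fillLeaves ⨾ fillNodes ε ⨾ findBest ⨾ decode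

κ : ℚ → ℚ
κ ε = div ε (1ℚ + ε)

ratioE : ℚ → Exp rat
ratioE ε = lit 1ℚ :+ lit (κ ε) :/ embed (scalar nat #E)

afterMin afterPadding program : ℚ → Program
afterMin ε = makeGrid ε ⨾ solve ε
afterPadding ε = assign nat #N (scalar nat #m′ :* scalar nat #n′) ⨾ assign rat $ρ (ratioE ε) ⨾ each minBody ⨾ afterMin ε
program ε = padding ⨾ afterPadding ε

ratio : ℚ → ℕ → ℚ
ratio ε E = 1ℚ + div (κ ε) (fromℕ E)

pos-quotient : ∀ {x y z} → x * y ≡ z → 0ℚ < y → 0ℚ < z → 0ℚ < x
pos-quotient {x} {y} {z} xy≡z 0<y 0<z = ℚₚ.*-cancelʳ-<-nonNeg y {{ℚ.nonNegative (ℚₚ.<⇒≤ 0<y)}}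
  (subst₂ _<_ (sym (ℚₚ.*-zeroˡ y)) (sym xy≡z) 0<z)

-- (1 + κ / E) ^ E ≤ 1 / (1 - κ) = 1 + ε.
module Ratio (ε : ℚ) (0<ε : 0ℚ < ε) (E-1 : ℕ) where

  E : ℕ
  E = suc E-1

  δ ρ : ℚ
  δ = div (κ ε) (fromℕ E)
  ρ = ratio ε E

  0<1+ε : 0ℚ < 1ℚ + ε
  0<1+ε = ℚₚ.<-≤-trans 0<1 (≤+ˡ (ℚₚ.<⇒≤ 0<ε))

  0<E : 0ℚ < fromℕ E
  0<E = ℚₚ.<-≤-trans 0<1 (1≤fromℕ {E} (s≤s z≤n))

  κ*[1+ε] : κ ε * (1ℚ + ε) ≡ ε
  κ*[1+ε] = div-* ε (λ eq → ℚₚ.<-irrefl (sym eq) 0<1+ε)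

  δ*E : δ * fromℕ E ≡ κ ε
  δ*E = div-* (κ ε) (λ eq → ℚₚ.<-irrefl (sym eq) 0<E)

  0<κ : 0ℚ < κ ε
  0<κ = pos-quotient κ*[1+ε] 0<1+ε 0<ε

  0<δ : 0ℚ < δ
  0<δ = pos-quotient δ*E 0<E 0<κ

  1<ρ : 1ℚ < ρ
  1<ρ = subst (_< ρ) (ℚₚ.+-identityʳ 1ℚ) (ℚₚ.+-monoʳ-< 1ℚ 0<δ)

  1≤ρ : 1ℚ ≤ ρ
  1≤ρ = ℚₚ.<⇒≤ 1<ρ

  ρᴱ≤ : ρ ^ E ≤ 1ℚ + ε
  ρᴱ≤ = begin
    -- Since κ (1 + ε) = ε, the product (1 - κ)(1 + ε) is 1. The ring solver cannot use that
    -- equation, so a correction term is added that it makes vanish in the next step.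
    ρ ^ E                                          ≡⟨ lemma (ρ ^ E) (κ ε) ε ⟩
    (ρ ^ E * (1ℚ - κ ε)) * (1ℚ + ε) + ρ ^ E * (κ ε * (1ℚ + ε) - ε)
      ≡⟨ cong (λ x → (ρ ^ E * (1ℚ - κ ε)) * (1ℚ + ε) + ρ ^ E * (x - ε)) κ*[1+ε] ⟩
    (ρ ^ E * (1ℚ - κ ε)) * (1ℚ + ε) + ρ ^ E * (ε - ε)
      ≡⟨ lemma′ (ρ ^ E * (1ℚ - κ ε)) (ρ ^ E) ε ⟩
    (ρ ^ E * (1ℚ - κ ε)) * (1ℚ + ε)
      ≡⟨ cong (λ x → (ρ ^ E * (1ℚ - x)) * (1ℚ + ε)) (trans (sym δ*E) (ℚₚ.*-comm δ (fromℕ E))) ⟩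
    (ρ ^ E * (1ℚ - fromℕ E * δ)) * (1ℚ + ε)        ≤⟨ *-monoʳ (1ℚ + ε) (ℚₚ.<⇒≤ 0<1+ε) (^-inverse-bernoulli (ℚₚ.<⇒≤ 0<δ) E) ⟩
    1ℚ * (1ℚ + ε)                                  ≡⟨ ℚₚ.*-identityˡ (1ℚ + ε) ⟩
    1ℚ + ε                                         ∎
    where
    open ℚₚ.≤-Reasoning
    lemma : ∀ r κ ε → r ≡ (r * (1ℚ - κ)) * (1ℚ + ε) + r * (κ * (1ℚ + ε) - ε)
    lemma = ring-solve ℚ-ring
    lemma′ : ∀ x r ε → x * (1ℚ + ε) + r * (ε - ε) ≡ x * (1ℚ + ε)
    lemma′ = ring-solve ℚ-ring

  -- By Bernoulli's inequality ρᶜᴱ ≥ 1 + c κ, and (1 + ε) κ = ε. This converts logarithms to base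
  -- `ρ` into logarithms to base 1 + ε at the price of a factor c E.
  ≤ρᶜᴱ : ∀ c → 1ℚ + ε ≤ fromℕ c → 1ℚ + ε ≤ ρ ^ (c ℕ.* E)
  ≤ρᶜᴱ c ≤c = begin
    1ℚ + ε                              ≡⟨ cong (_+_ 1ℚ) (trans (sym κ*[1+ε]) (ℚₚ.*-comm (κ ε) (1ℚ + ε))) ⟩
    1ℚ + (1ℚ + ε) * κ ε                 ≤⟨ ℚₚ.+-monoʳ-≤ 1ℚ (*-monoʳ (κ ε) (ℚₚ.<⇒≤ 0<κ) ≤c) ⟩
    1ℚ + fromℕ c * κ ε                  ≡⟨ cong (λ x → 1ℚ + fromℕ c * x) (sym δ*E) ⟩
    1ℚ + fromℕ c * (δ * fromℕ E)        ≡⟨ cong (_+_ 1ℚ) (lemma (fromℕ c) δ (fromℕ E)) ⟩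
    1ℚ + fromℕ c * fromℕ E * δ          ≡⟨ cong (λ x → 1ℚ + x * δ) (fromℕ-* c E) ⟨
    1ℚ + fromℕ (c ℕ.* E) * δ            ≤⟨ bernoulli (ℚₚ.<⇒≤ 0<δ) (c ℕ.* E) ⟩
    ρ ^ (c ℕ.* E)                       ∎
    where
    open ℚₚ.≤-Reasoning
    lemma : ∀ c δ E → c * (δ * E) ≡ c * E * δ
    lemma = ring-solve ℚ-ring

solveTime : ℕ → ℕ → ℕ → ℕ
solveTime a b K =
  4 ℕ.+ eachTime (2 ℕ.^ a) (2 ℕ.^ b) (leafTime K) ℕ.+
  (downTime #t (scalar nat #N :- lit 1) (2 ℕ.^ (a ℕ.+ b) ℕ.∸ 1) (8 ℕ.+ (62 ℕ.+ mergeTime K)) ℕ.+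
  (downTime #k (scalar nat #K) K 27 ℕ.+
  (4 ℕ.+ eachTime (2 ℕ.^ a) (2 ℕ.^ b) 35)))

afterMinTime : ℕ → ℕ → ℕ → ℕ
afterMinTime a b k = makeGridTime k ℕ.+ solveTime a b (suc k)

afterPaddingTime : ℕ → ℕ → ℕ → ℕ
afterPaddingTime a b k = 10 ℕ.+ (11 ℕ.+ (eachTime (2 ℕ.^ a) (2 ℕ.^ b) 50 ℕ.+ afterMinTime a b k))

record BucketCount (I : Instance) (ε : ℚ) (E : ℕ) : Set where
  open Instance I
  field
    k        : ℕ
    μ        : ℚ
    0<μ      : 0ℚ < μ
    attained : ∃[ i ] ∃[ j ] w i j ≡ μ
    within   : ∀ j → j ℕ.< k → μ * ratio ε E ^ j ≤ (1ℚ + ε) * B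
    beyond   : (1ℚ + ε) * B < μ * ratio ε E ^ k

1+-cancel-≤ : ∀ {x y} → 1ℚ + x ≤ 1ℚ + y → x ≤ y
1+-cancel-≤ {x} {y} le = ≤-by (1ℚ + y - (1ℚ + x)) (0≤- le) (lemma x y)
  where
  lemma : ∀ x y → y ≡ x + (1ℚ + y - (1ℚ + x))
  lemma = ring-solve ℚ-ring

module Solve (I : Instance) (ε : ℚ) (0<ε : 0ℚ < ε) (feasible : ∃[ S ] Instance.Feasible I S) (a b : ℕ)
  (padded : Padded (Instance.m I) (Instance.n I) (extend 0 (Instance.size I)) a b)
  (bc : BucketCount I ε (suc (a ℕ.+ b))) (minimal : ∀ i j → 0ℚ < Instance.w I i j → BucketCount.μ bc ≤ Instance.w I i j)
  where

  open Instance I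
  open BucketCount bc
  open Flatten I a b padded
  open Ratio ε 0<ε (a ℕ.+ b)

  discrete : ∀ y → Buckets.Discrete μ ρ 1≤ρ (flat w y)
  discrete = flat-all (Buckets.Discrete μ ρ 1≤ρ) w (inj₁ refl) item
    where
    item : ∀ i j → Buckets.Discrete μ ρ 1≤ρ (w i j)
    item i j with w i j ℚₚ.≤? 0ℚ
    ... | yes w≤0 = inj₁ (ℚₚ.≤-antisym w≤0 (w≥0 i j))
    ... | no  w≰0 = inj₂ (w≥0 i j , minimal i j (ℚₚ.≰⇒> w≰0))

  setting : Setting
  setting = record
    { a = a ; b = b ; K = suc k ; w = flat w ; v = flat v ; l = lˡ ; u = uˡ ; μ = μ ; ρ = ρ ; B = B ; ε = ε
    ; 1≤ρ = 1≤ρ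
    ; w-discrete = discrete
    ; 0≤v = flat-all (0ℚ ≤_) v ℚₚ.≤-refl v≥0
    ; 0≤l = extend-all (0ℚ ≤_) 0ℚ l ℚₚ.≤-refl l≥0
    ; 0≤ε = ℚₚ.<⇒≤ 0<ε
    ; ρᴴ≤ = ρᴱ≤
    ; cap = beyond }

  open Setting setting using (H; lo; hi; c)
  open Tables setting
  open Filling setting
  open Bounds (flat w) lo hi

  N : ℕ
  N = 2 ℕ.^ H

  tot-code : ∀ φ → tot H 1 (tab H 1 φ) c ≡ Decoding.codeSum a b φ N
  tot-code φ = trans (tot-tab H 1 φ c) (rsum-cong N λ p _ →
    cong (λ N → pick (φ (N ℕ.+ p)) (c (N ℕ.+ p))) (ℕₚ.+-identityʳ (2 ℕ.^ H)))

  Prepared : Memory → Set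
  Prepared M = M nat #n′ 0 0 ≡ 2 ℕ.^ b × M nat #N 0 0 ≡ N × Node-inputs M ×
    (∀ i j → M rat $w i j ≡ pad w i j) × (∀ i j → M rat $v i j ≡ pad v i j) ×
    (∀ x → Empty x M) × M rat $best 0 0 ≡ 0ℚ × (∀ i j → M nat 2 i j ≡ 0)

  correct : ∀ {M j} φ (S : Selection) → (∀ i j → φ (leaf a b (toℕ i) (toℕ j)) ≡ lookup (S i) j) →
    Complete H 1 M → (∀ i → i ℕ.< suc k → M rat $V 1 i ≤ M rat $V 1 j) →
    1ℚ + tot H 1 (tab H 1 φ) (flat v) ≡ M rat $V 1 j → Approx ε H 1 (tab H 1 φ) → IsApproximateSolution ε S
  correct {M} {j} φ S agrees complete max value≡ ok = record
    { value    = optimal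
    ; lower    = λ i → proj₁ (approx-category φ S agrees ok i)
    ; upper    = λ i → proj₂ (approx-category φ S agrees ok i)
    ; capacity = approx-total φ S agrees ok }
    where
    dominated : ∀ S* → Feasible S* → totalValue S* ≤ totalValue S
    dominated S* feas = bound (complete (tab H 1 (bits S*)) (exact-root S* feas) (total≤B S* feas))
      where
      open ℚₚ.≤-Reasoning
      bound : ∃[ i ] (i ℕ.< suc k × 1ℚ + tot H 1 (tab H 1 (bits S*)) (flat v) ≤ M rat $V 1 i × _) → totalValue S* ≤ totalValue S
      bound (i , i< , V≥ , _) = 1+-cancel-≤ (begin
        1ℚ + totalValue S*                               ≡⟨ cong (_+_ 1ℚ) (total-sum S* (bits S*) (bits-agree S*) v) ⟨
        1ℚ + tot H 1 (tab H 1 (bits S*)) (flat v)        ≤⟨ V≥ ⟩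
        M rat $V 1 i                                     ≤⟨ max i i< ⟩
        M rat $V 1 j                                     ≡⟨ value≡ ⟨
        1ℚ + tot H 1 (tab H 1 φ) (flat v)                ≡⟨ cong (_+_ 1ℚ) (total-sum S φ agrees v) ⟩
        1ℚ + totalValue S                                ∎)
    optimal : ∀ opt → IsOptimalValue opt → opt ≤ totalValue S
    optimal opt isOpt = subst (_≤ totalValue S) (proj₂ (proj₂ best)) (dominated (proj₁ best) (proj₁ (proj₂ best)))
      where best = IsOptimalValue.attained isOpt

  run-solve : ∀ {M} → Prepared M → Run (solve ε) M (solveTime a b (suc k)) (λ M′ → IsApproximateSolution ε (output I M′))
  run-solve {M₀} (n≡ , N≡ , inputs@((K≡ , G≡) , m≡ , l≡ , u≡ , B≡) , w≡ , v≡ , empty , best≡ , out≡) = run-seq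
    (run-fillLeaves (K≡ , G≡) m≡ n≡
      (λ i j i< j< → trans (w≡ i j) (sym (flat-leaf w i j j<)) , trans (v≡ i j) (sym (flat-leaf v i j j<))) empty)
    λ { M₁ (frame f) rows → run-seq
      (run-fillNodes ((trans (f nat #K refl 0 0) K≡ , λ k k≤ → trans (f rat $G refl 0 k) (G≡ k k≤)) ,
          trans (f nat #m′ refl 0 0) m≡ , (λ i → trans (f rat $l refl i 0) (l≡ i)) ,
          (λ i → trans (f rat $u refl i 0) (u≡ i)) , trans (f rat $B refl 0 0) B≡)
        (trans (f nat #N refl 0 0) N≡) rows)
      λ { M₂ (frame g) good → finish M₂ good
            (trans (g nat #K refl 0 0) (trans (f nat #K refl 0 0) K≡))
            (trans (g nat #m′ refl 0 0) (trans (f nat #m′ refl 0 0) m≡))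
            (trans (g nat #n′ refl 0 0) (trans (f nat #n′ refl 0 0) n≡))
            (trans (g rat $best refl 0 0) (trans (f rat $best refl 0 0) best≡))
            (λ i j → trans (g nat 2 refl i j) (trans (f nat 2 refl i j) (out≡ i j))) } }
    where
    finish : ∀ M → Good H 1 M → M nat #K 0 0 ≡ suc k → M nat #m′ 0 0 ≡ 2 ℕ.^ a → M nat #n′ 0 0 ≡ 2 ℕ.^ b →
             M rat $best 0 0 ≡ 0ℚ → (∀ i j → M nat 2 i j ≡ 0) →
             Run (findBest ⨾ decode) M (downTime #k (scalar nat #K) (suc k) 27 ℕ.+ (4 ℕ.+ eachTime (2 ℕ.^ a) (2 ℕ.^ b) 35))
               (λ M′ → IsApproximateSolution ε (output I M′))
    finish M (snd , complete) K≡ m≡ n≡ best≡ out≡ = search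
      -- The assumed feasible solution witnesses a nonempty entry at the root, so the search for the
      -- best entry cannot fail.
      (complete (tab H 1 (bits (proj₁ feasible))) (exact-root (proj₁ feasible) (proj₂ feasible)) (total≤B (proj₁ feasible) (proj₂ feasible)))
      where
      last : ∀ M′ → Frame findBest M M′ → ∀ j → (∀ i → i ℕ.< suc k → M rat $V 1 i ≤ M rat $V 1 j) →
             M′ rat $code 0 0 ≡ M rat $C 1 j → Entry H 1 j (cell M 1 j) →
             Run decode M′ (4 ℕ.+ eachTime (2 ℕ.^ a) (2 ℕ.^ b) 35) (λ M″ → IsApproximateSolution ε (output I M″))
      last M′ (frame f) j max code≡ (s , _ , value≡ , code≡′ , _ , ok) = decoded (tab-surjective H 1 s)
        where
        decoded : ∃[ φ ] tab H 1 φ ≡ s → Run decode M′ (4 ℕ.+ eachTime (2 ℕ.^ a) (2 ℕ.^ b) 35) (λ M″ → IsApproximateSolution ε (output I M″))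
        decoded (φ , tab≡s) = run-weaken ℕₚ.≤-refl
          (λ M″ _ done → correct {M} {j} φ (output I M″)
            (λ i j → trans (sym (done (toℕ i) (toℕ j) (ℕₚ.<-≤-trans (toℕ<n i) (Padded.m≤ padded) , ℕₚ.<-≤-trans (toℕ<n j) (size≤2ᵇ i))))
                           (sym (lookup∘tabulate (λ j → M″ nat 2 (toℕ i) (toℕ j) ℕ.≡ᵇ 1) j)))
            complete max (trans (cong (λ s → 1ℚ + tot H 1 s (flat v)) tab≡s) value≡) (subst (Approx ε H 1) (sym tab≡s) ok))
          (Decoding.run-decode a b φ (trans (f nat #m′ refl 0 0) m≡) (trans (f nat #n′ refl 0 0) n≡)
            (λ i j → trans (f nat 2 refl i j) (out≡ i j))
            (trans code≡ (trans (sym code≡′) (trans (cong (λ s → tot H 1 s c) (sym tab≡s)) (tot-code φ)))))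
      search : ∃[ i ] (i ℕ.< suc k × 1ℚ + tot H 1 (tab H 1 (bits (proj₁ feasible))) (flat v) ≤ M rat $V 1 i × _) → _
      search (i , i< , V≥ , _) = run-seq
        (run-findBest {suc k} {i} K≡ best≡ i< (ℚₚ.<-≤-trans (0<1+tot H 1 (tab H 1 (bits (proj₁ feasible)))) V≥))
        λ { M′ (frame f) (j , j<K , 0<V , max , code≡) → last M′ (frame f) j max code≡ (snd j j<K 0<V) }

-- The time of the second program depends on quantities known only in the intermediate memory, such
-- as the number of buckets; `x` carries them out of the run.
run-seq-Σ : ∀ {X : Set} {T₂ : X → ℕ} {c d M T₁} {P Q : Memory → Set} → Run c M T₁ P →
            (∀ M₁ → Frame c M M₁ → P M₁ → Σ[ x ∈ X ] Run d M₁ (T₂ x) Q) → Σ[ x ∈ X ] Run (c ⨾ d) M (T₁ ℕ.+ T₂ x) Q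
run-seq-Σ (M₁ , t₁ , C , t₁≤ , p) next with next M₁ (frame-rule C) p
... | x , M₂ , t₂ , D , t₂≤ , q = x , M₂ , _ , ⇓seq C D , ℕₚ.+-mono-≤ t₁≤ t₂≤ , q

module Whole (I : Instance) (ε : ℚ) (0<ε : 0ℚ < ε) (feasible : ∃[ S ] Instance.Feasible I S) where

  open Instance I

  size̲ : ℕ → ℕ
  size̲ = extend 0 size

  i₀ : Fin m
  i₀ = proj₁ some-w>0

  j₀ : Fin (size i₀)
  j₀ = proj₁ (proj₂ some-w>0)

  1≤m : 1 ℕ.≤ m
  1≤m = ℕₚ.≤-trans (s≤s z≤n) (toℕ<n i₀)

  1≤n : 1 ℕ.≤ n
  1≤n = ℕₚ.≤-trans (ℕₚ.≤-trans (s≤s z≤n) (toℕ<n j₀)) (size≤n size i₀)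

  Approximates : Memory → Set
  Approximates M = IsApproximateSolution ε (output I M)

  module Padded-instance (a b : ℕ) (padded : Padded m n size̲ a b) where

    open Flatten I a b padded
    open Ratio ε 0<ε (a ℕ.+ b) using (ρ; 1<ρ)

    Bucket-count : Set
    Bucket-count = BucketCount I ε (suc (a ℕ.+ b))

    Smallest : ℚ → Set
    Smallest μ = (∀ y → 2 ℕ.^ (a ℕ.+ b) ℕ.≤ y → y ℕ.< 2 ℕ.^ suc (a ℕ.+ b) → 0ℚ < flat w y → 0ℚ < μ × μ ≤ flat w y) ×
                 (μ ≡ 0ℚ ⊎ ∃[ i ] ∃[ j ] μ ≡ pad w i j)

    flat-item : ∀ i j → flat w (leaf a b (toℕ i) (toℕ j)) ≡ w i j
    flat-item i j = trans (flat-leaf w (toℕ i) (toℕ j) (ℕₚ.<-≤-trans (toℕ<n j) (size≤2ᵇ i))) (pad-item w i j)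

    smallest-item : ∀ {μ} → Smallest μ → ∀ i j → 0ℚ < w i j → 0ℚ < μ × μ ≤ w i j
    smallest-item {μ} (low , _) i j 0<w = subst (λ x → 0ℚ < μ × μ ≤ x) (flat-item i j)
      (low (leaf a b (toℕ i) (toℕ j)) (≤leaf a b (toℕ i) (toℕ j))
        (leaf< a b (ℕₚ.<-≤-trans (toℕ<n i) (Padded.m≤ padded)) (ℕₚ.<-≤-trans (toℕ<n j) (size≤2ᵇ i)))
        (subst (0ℚ <_) (sym (flat-item i j)) 0<w))

    smallest-pos : ∀ {μ} → Smallest μ → 0ℚ < μ
    smallest-pos s = proj₁ (smallest-item s i₀ j₀ (proj₂ (proj₂ some-w>0)))

    smallest-attained : ∀ {μ} → Smallest μ → ∃[ i ] ∃[ j ] w i j ≡ μ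
    smallest-attained s@(_ , inj₁ μ≡0) = ⊥-elim (ℚₚ.<-irrefl (sym μ≡0) (smallest-pos s))
    smallest-attained {μ} s@(_ , inj₂ (i , j , μ≡)) = subst (λ x → ∃[ i ] ∃[ j ] w i j ≡ x) (sym μ≡)
      -- A padding cell holds 0, which positivity rules out; so the least weight belongs to a
      -- genuine item.
      (pad-all (λ x → 0ℚ < x → ∃[ i ] ∃[ j ] w i j ≡ x) w (λ 0<0 → ⊥-elim (ℚₚ.<-irrefl refl 0<0)) (λ i j _ → i , j , refl) i j
        (subst (0ℚ <_) μ≡ (smallest-pos s)))

    bucket-count : ∀ {μ} → Smallest μ → Bucket-count
    bucket-count {μ} s = record
      { k = proj₁ count ; μ = μ ; 0<μ = smallest-pos s ; attained = smallest-attained s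
      ; within = proj₂ (proj₂ count) ; beyond = proj₁ (proj₂ count) }
      where count = bucketCount (smallest-pos s) 1<ρ ((1ℚ + ε) * B)

    record Ready (M : Memory) : Set where
      field
        m≡     : M nat #m′ 0 0 ≡ 2 ℕ.^ a
        n≡     : M nat #n′ 0 0 ≡ 2 ℕ.^ b
        N≡     : M nat #N 0 0 ≡ 2 ℕ.^ a ℕ.* 2 ℕ.^ b
        out≡   : ∀ i j → M nat 2 i j ≡ 0
        w≡     : ∀ i j → M rat $w i j ≡ pad w i j
        v≡     : ∀ i j → M rat $v i j ≡ pad v i j
        l≡     : ∀ i → M rat $l i 0 ≡ lˡ i
        u≡     : ∀ i → M rat $u i 0 ≡ uˡ i
        B≡     : M rat $B 0 0 ≡ B
        ρ≡     : M rat $ρ 0 0 ≡ ρ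
        G≡     : M rat $G 0 0 ≡ 0ℚ
        empty  : ∀ x k → M rat $V x k ≡ 0ℚ
        best≡  : M rat $best 0 0 ≡ 0ℚ

    run-afterMin : ∀ {M} → Ready M → Smallest (M rat $μ 0 0) →
      Σ[ bc ∈ Bucket-count ] Run (afterMin ε) M (afterMinTime a b (BucketCount.k bc)) Approximates
    run-afterMin {M} ready s = bucket-count s , run-seq
      (run-makeGrid {ε} (BucketCount.beyond (bucket-count s)) (BucketCount.within (bucket-count s)) refl ρ≡ B≡ G≡)
      λ { M₁ (frame f) (K≡ , G≡′) → Solve.run-solve I ε 0<ε feasible a b padded (bucket-count s)
            (λ i j 0<w → proj₂ (smallest-item s i j 0<w))
            ( trans (f nat #n′ refl 0 0) n≡
            , trans (f nat #N refl 0 0) (trans N≡ (sym (ℕₚ.^-distribˡ-+-* 2 a b)))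
            , ((K≡ , G≡′) , trans (f nat #m′ refl 0 0) m≡ , (λ i → trans (f rat $l refl i 0) (l≡ i)) ,
                (λ i → trans (f rat $u refl i 0) (u≡ i)) , trans (f rat $B refl 0 0) B≡)
            , (λ i j → trans (f rat $w refl i j) (w≡ i j))
            , (λ i j → trans (f rat $v refl i j) (v≡ i j))
            , (λ x k → trans (f rat $V refl x k) (empty x k))
            , trans (f rat $best refl 0 0) best≡
            , (λ i j → trans (f nat 2 refl i j) (out≡ i j))) }
      where open Ready ready

    run-afterPadding : ∀ {M} → Frame padding (input I) M → M nat #m′ 0 0 ≡ 2 ℕ.^ a → M nat #n′ 0 0 ≡ 2 ℕ.^ b →
      M nat #E 0 0 ≡ suc (a ℕ.+ b) →
      Σ[ bc ∈ Bucket-count ] Run (afterPadding ε) M (afterPaddingTime a b (BucketCount.k bc)) Approximates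
    run-afterPadding {M} (frame f) m≡ n≡ E≡ = assigned (run-seq-Σ
      (run-min a b (pad w) (flat w) (λ i j i< j< → sym (flat-leaf w i j j<)) m≡ n≡ (λ i j → f rat $w refl i j) (f rat $μ refl 0 0))
      λ { M₁ (frame g) s → run-afterMin {M₁} (record
            { m≡ = trans (g nat #m′ refl 0 0) m≡
            ; n≡ = trans (g nat #n′ refl 0 0) n≡
            ; N≡ = trans (g nat #N refl 0 0) (cong₂ ℕ._*_ m≡ n≡)
            ; out≡ = λ i j → trans (g nat 2 refl i j) (trans (f nat 2 refl i j) refl)
            ; w≡ = λ i j → trans (g rat $w refl i j) (f rat $w refl i j)
            ; v≡ = λ i j → trans (g rat $v refl i j) (f rat $v refl i j)
            ; l≡ = λ i → trans (g rat $l refl i 0) (f rat $l refl i 0)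
            ; u≡ = λ i → trans (g rat $u refl i 0) (f rat $u refl i 0)
            ; B≡ = trans (g rat $B refl 0 0) (f rat $B refl 0 0)
            ; ρ≡ = trans (g rat $ρ refl 0 0) (cong (ratio ε) E≡)
            ; G≡ = trans (g rat $G refl 0 0) (f rat $G refl 0 0)
            ; empty = λ x k → trans (g rat $V refl x k) (f rat $V refl x k)
            ; best≡ = trans (g rat $best refl 0 0) (f rat $best refl 0 0) }) s })
      where
      assigned : Σ[ bc ∈ Bucket-count ] Run (each minBody ⨾ afterMin ε) _ (eachTime (2 ℕ.^ a) (2 ℕ.^ b) 50 ℕ.+ afterMinTime a b (BucketCount.k bc)) Approximates → _
      assigned (bc , r) = bc , run-write-seq (run-write-seq r)

  record Sizes : Set where
    field
      a b     : ℕ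
      padded  : Padded m n size̲ a b
      buckets : BucketCount I ε (suc (a ℕ.+ b))

    time : ℕ
    time = afterPaddingTime a b (BucketCount.k buckets)

  run-program : Σ[ s ∈ Sizes ] Run (program ε) (input I) (paddingTime m n ℕ.+ Sizes.time s) Approximates
  run-program = run-seq-Σ (run-padding 1≤m 1≤n (extend-all (ℕ._≤ n) 0 size z≤n (size≤n size)) refl (λ i → refl))
    λ { M f (a , b , padded , m≡ , n≡ , E≡) →
          assemble a b padded (Padded-instance.run-afterPadding a b padded f m≡ n≡ E≡) }
    where
    assemble : ∀ {M} a b (padded : Padded m n size̲ a b) →
      Σ[ bc ∈ BucketCount I ε (suc (a ℕ.+ b)) ] Run (afterPadding ε) M (afterPaddingTime a b (BucketCount.k bc)) Approximates →
      Σ[ s ∈ Sizes ] Run (afterPadding ε) M (Sizes.time s) Approximates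
    assemble a b padded (bc , r) = record { a = a ; b = b ; padded = padded ; buckets = bc } , r

-- Running time

-- A record, so that the factors can be recovered from the type.
record _≤_·_ (T t S : ℕ) : Set where
  constructor bounded
  field
    bound : T ℕ.≤ t ℕ.* S

open _≤_·_

const≤ : ∀ c {S} → 1 ℕ.≤ S → c ≤ c · S
const≤ c 1≤S = bounded (ℕₚ.≤-trans (ℕₚ.≤-reflexive (sym (ℕₚ.*-identityʳ c))) (ℕₚ.*-monoʳ-≤ c 1≤S))

+≤ : ∀ {X Y S x y} → X ≤ x · S → Y ≤ y · S → (X ℕ.+ Y) ≤ (x ℕ.+ y) · S
+≤ {S = S} {x} {y} X≤ Y≤ = bounded (ℕₚ.≤-trans (ℕₚ.+-mono-≤ (bound X≤) (bound Y≤)) (ℕₚ.≤-reflexive (sym (ℕₚ.*-distribʳ-+ S x y))))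

raise : ∀ {X S S′ x} → S ℕ.≤ S′ → X ≤ x · S → X ≤ x · S′
raise {x = x} S≤S′ X≤ = bounded (ℕₚ.≤-trans (bound X≤) (ℕₚ.*-monoʳ-≤ x S≤S′))

-- The positive bound `L′` takes the place of `L` because a loop without rounds still pays for its
-- final test.
loop≤ : ∀ c {t T L L′ S} → L ℕ.≤ L′ → 1 ℕ.≤ L′ → 1 ℕ.≤ S → T ≤ t · S →
        (L ℕ.* (c ℕ.+ T) ℕ.+ c) ≤ c ℕ.+ (c ℕ.+ t) · (L′ ℕ.* S)
loop≤ c {t} {T} {L} {L′} {S} L≤ 1≤L 1≤S T≤ = bounded (begin
  L ℕ.* (c ℕ.+ T) ℕ.+ c                 ≡⟨ ℕₚ.+-comm _ c ⟩
  c ℕ.+ L ℕ.* (c ℕ.+ T)                 ≤⟨ bound (+≤ (const≤ c (ℕₚ.*-mono-≤ 1≤L 1≤S)) (bounded {t = c ℕ.+ t} rounds)) ⟩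
  (c ℕ.+ (c ℕ.+ t)) ℕ.* (L′ ℕ.* S)      ∎)
  where
  open ℕₚ.≤-Reasoning
  lemma : ∀ L x S → L ℕ.* (x ℕ.* S) ≡ x ℕ.* (L ℕ.* S)
  lemma = ℕ-solve
  rounds : L ℕ.* (c ℕ.+ T) ℕ.≤ (c ℕ.+ t) ℕ.* (L′ ℕ.* S)
  rounds = ℕₚ.≤-trans (ℕₚ.*-mono-≤ L≤ (bound (+≤ (const≤ c 1≤S) T≤))) (ℕₚ.≤-reflexive (lemma L′ (c ℕ.+ t) S))

down≤ : ∀ a e {t T L L′ S} → L ℕ.≤ L′ → 1 ℕ.≤ L′ → 1 ℕ.≤ S → T ≤ t · S →
        downTime a e L T ≤ 3 ℕ.+ cost e ℕ.+ (20 ℕ.+ t) · (L′ ℕ.* S)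
down≤ a e {t} {T} {L} {L′} {S} L≤ 1≤L 1≤S T≤ = +≤ (const≤ (3 ℕ.+ cost e) (ℕₚ.*-mono-≤ 1≤L 1≤S))
  (loop≤ 6 {8 ℕ.+ t} {8 ℕ.+ T} {L} {L′} L≤ 1≤L 1≤S (+≤ (const≤ 8 1≤S) T≤))

each≤ : ∀ {t T A N S} → 1 ℕ.≤ A → 1 ℕ.≤ N → 1 ℕ.≤ S → T ≤ t · S → eachTime A N T ≤ 52 ℕ.+ t · (A ℕ.* (N ℕ.* S))
each≤ {T = T} {A} {N} 1≤A 1≤N 1≤S T≤ = down≤ #i (scalar nat #m′) {T = downTime #j (scalar nat #n′) N T} {L = A} ℕₚ.≤-refl 1≤A
  (ℕₚ.*-mono-≤ 1≤N 1≤S) (down≤ #j (scalar nat #n′) {T = T} {N} ℕₚ.≤-refl 1≤N 1≤S T≤)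

module Bounded (m n a b k : ℕ) (1≤m : 1 ℕ.≤ m) (1≤n : 1 ℕ.≤ n) (≤2m : 2 ℕ.^ a ℕ.≤ 2 ℕ.* m) (≤2n : 2 ℕ.^ b ℕ.≤ 2 ℕ.* n) where

  open ℕₚ.≤-Reasoning

  A N K K¹ K² K³ NK³ S nK³ X : ℕ
  A   = 2 ℕ.^ a
  N   = 2 ℕ.^ b
  K   = suc k
  -- The products are nested the way `down≤` builds them, so that the bounds of nested loops compose
  -- without rearrangement and `X` ends in `K ℕ.^ 3` by definition.
  K¹  = K ℕ.* 1
  K²  = K ℕ.* K¹
  K³  = K ℕ.* K²
  NK³ = N ℕ.* K³
  S   = A ℕ.* NK³
  nK³ = n ℕ.* K³
  X   = m ℕ.* nK³

  1≤A : 1 ℕ.≤ A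
  1≤A = ℕₚ.m^n>0 2 a

  1≤N : 1 ℕ.≤ N
  1≤N = ℕₚ.m^n>0 2 b

  1≤K : 1 ℕ.≤ K
  1≤K = s≤s z≤n

  1≤K¹ : 1 ℕ.≤ K¹
  1≤K¹ = ℕₚ.*-mono-≤ 1≤K (ℕₚ.≤-refl {1})

  1≤K² : 1 ℕ.≤ K²
  1≤K² = ℕₚ.*-mono-≤ 1≤K 1≤K¹

  1≤K³ : 1 ℕ.≤ K³
  1≤K³ = ℕₚ.*-mono-≤ 1≤K 1≤K²

  1≤S : 1 ℕ.≤ S
  1≤S = ℕₚ.*-mono-≤ 1≤A (ℕₚ.*-mono-≤ 1≤N 1≤K³)

  1≤nK³ : 1 ℕ.≤ nK³
  1≤nK³ = ℕₚ.*-mono-≤ 1≤n 1≤K³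

  1≤X : 1 ℕ.≤ X
  1≤X = ℕₚ.*-mono-≤ 1≤m 1≤nK³

  K¹≤K³ : K¹ ℕ.≤ K³
  K¹≤K³ = ℕₚ.*-monoʳ-≤ K {1} {K²} 1≤K²

  K¹≤S : K¹ ℕ.≤ S
  K¹≤S = begin
    K¹                     ≤⟨ K¹≤K³ ⟩
    K³                     ≡⟨ trans (sym (ℕₚ.*-identityˡ K³)) (sym (ℕₚ.*-identityˡ (1 ℕ.* K³))) ⟩
    1 ℕ.* (1 ℕ.* K³)       ≤⟨ ℕₚ.*-mono-≤ 1≤A (ℕₚ.*-monoˡ-≤ K³ 1≤N) ⟩
    S                      ∎

  insert≤ : insertTime K ≤ 93 · K¹
  insert≤ = down≤ #k (scalar nat #K) {67} {67} {K} ℕₚ.≤-refl 1≤K (ℕₚ.≤-refl {1}) (const≤ 67 (ℕₚ.≤-refl {1}))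

  mergeBody≤ : mergeBodyTime K ≤ 217 · K¹
  mergeBody≤ = +≤ (const≤ 120 1≤K¹) (+≤ (+≤ (+≤ (+≤ insert≤ one) one) one) one)
    where
    one : 1 ≤ 1 · K¹
    one = const≤ 1 1≤K¹

  merge≤ : mergeTime K ≤ 269 · K³
  merge≤ = down≤ #a (scalar nat #K) {T = downTime #b (scalar nat #K) K (mergeBodyTime K)} {K} ℕₚ.≤-refl 1≤K 1≤K²
    (down≤ #b (scalar nat #K) {T = mergeBodyTime K} {K} ℕₚ.≤-refl 1≤K 1≤K¹ mergeBody≤)

  node≤ : (8 ℕ.+ (62 ℕ.+ mergeTime K)) ≤ 339 · K³
  node≤ = +≤ (const≤ 8 1≤K³) (+≤ (const≤ 62 1≤K³) merge≤)

  fillNodes≤ : downTime #t (scalar nat #N :- lit 1) (2 ℕ.^ (a ℕ.+ b) ℕ.∸ 1) (8 ℕ.+ (62 ℕ.+ mergeTime K)) ≤ 367 · S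
  fillNodes≤ = raise (ℕₚ.≤-reflexive (trans (cong (ℕ._* K³) (ℕₚ.^-distribˡ-+-* 2 a b)) (ℕₚ.*-assoc A N K³)))
    (down≤ #t (scalar nat #N :- lit 1) {T = 8 ℕ.+ (62 ℕ.+ mergeTime K)} {2 ℕ.^ (a ℕ.+ b) ℕ.∸ 1} {2 ℕ.^ (a ℕ.+ b)}
      (ℕₚ.m∸n≤m _ 1) (ℕₚ.m^n>0 2 (a ℕ.+ b)) 1≤K³ node≤)

  leaf≤ : leafTime K ≤ 252 · K³
  leaf≤ = +≤ (const≤ 38 1≤K³) (+≤ (raise K¹≤K³ insert≤) (+≤ (const≤ 28 1≤K³) (raise K¹≤K³ insert≤)))

  each-const≤ : ∀ t → eachTime A N t ≤ 52 ℕ.+ t · S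
  each-const≤ t = each≤ {t} {t} {A} {N} 1≤A 1≤N 1≤K³ (const≤ t 1≤K³)

  fillLeaves≤ : (4 ℕ.+ eachTime A N (leafTime K)) ≤ 308 · S
  fillLeaves≤ = +≤ (const≤ 4 1≤S) (each≤ {252} {leafTime K} {A} {N} 1≤A 1≤N 1≤K³ leaf≤)

  findBest≤ : downTime #k (scalar nat #K) K 27 ≤ 53 · S
  findBest≤ = raise K¹≤S (down≤ #k (scalar nat #K) {27} {27} {K} ℕₚ.≤-refl 1≤K (ℕₚ.≤-refl {1}) (const≤ 27 (ℕₚ.≤-refl {1})))

  solve≤ : solveTime a b K ≤ 819 · S
  solve≤ = +≤ fillLeaves≤ (+≤ fillNodes≤ (+≤ findBest≤ (+≤ (const≤ 4 1≤S) (each-const≤ 35))))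

  gridLoop≤ : loopTime (read rat $G (lit 0) (scalar nat #K) :≤ lit 1ℚ :* scalar rat $B) k 24 ≤ 48 · S
  gridLoop≤ = raise K¹≤S (loop≤ 12 {24} {24} {k} {K} (ℕₚ.n≤1+n k) 1≤K (ℕₚ.≤-refl {1}) (const≤ 24 (ℕₚ.≤-refl {1})))

  afterMin≤ : afterMinTime a b k ≤ 877 · S
  afterMin≤ = +≤ (+≤ (const≤ 6 1≤S) (+≤ (const≤ 4 1≤S) gridLoop≤)) solve≤

  afterPadding≤ : afterPaddingTime a b k ≤ 1000 · S
  afterPadding≤ = +≤ (const≤ 10 1≤S) (+≤ (const≤ 11 1≤S) (+≤ (each-const≤ 50) afterMin≤))

  double-m≤ : doubleTime #m′ (scalar nat 0) m ≤ 34 · X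
  double-m≤ = loop≤ 8 {18} {18} {m} ℕₚ.≤-refl 1≤m 1≤nK³ (const≤ 18 1≤nK³)

  double-n≤ : doubleTime #n′ sizeE n ≤ 38 · nK³
  double-n≤ = loop≤ 10 {18} {18} {n} ℕₚ.≤-refl 1≤n 1≤K³ (const≤ 18 1≤K³)

  padding≤ : paddingTime m n ≤ 110 · X
  padding≤ = +≤ four (+≤ four (+≤ four (+≤ double-m≤
      (down≤ #i (scalar nat 0) {T = doubleTime #n′ sizeE n} {m} ℕₚ.≤-refl 1≤m 1≤nK³ double-n≤))))
    where
    four : 4 ≤ 4 · X
    four = const≤ 4 1≤X

  S≤4X : S ℕ.≤ 4 ℕ.* X
  S≤4X = begin
    A ℕ.* (N ℕ.* K³)                        ≤⟨ ℕₚ.*-mono-≤ ≤2m (ℕₚ.*-monoˡ-≤ K³ ≤2n) ⟩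
    2 ℕ.* m ℕ.* (2 ℕ.* n ℕ.* K³)            ≡⟨ lemma m n K³ ⟩
    4 ℕ.* X                                 ∎
    where
    lemma : ∀ m n K³ → 2 ℕ.* m ℕ.* (2 ℕ.* n ℕ.* K³) ≡ 4 ℕ.* (m ℕ.* (n ℕ.* K³))
    lemma = ℕ-solve

  -- 110 for the padding, and 1000 for the rest times 4 for rounding up both `m` and `n` to powers
  -- of 2.
  time≤ : paddingTime m n ℕ.+ afterPaddingTime a b k ℕ.≤ 4110 ℕ.* X
  time≤ = bound (+≤ padding≤ (bounded {t = 4000} (ℕₚ.≤-trans (bound afterPadding≤) (ℕₚ.≤-trans (ℕₚ.*-monoʳ-≤ 1000 S≤4X)
    (ℕₚ.≤-reflexive (sym (ℕₚ.*-assoc 1000 4 X)))))))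

-- This pays for the powers of log n in K³ with one factor n. From b = 4 on, where equality holds
-- and fixes the factor 4, one has (b + 1)³ ≤ 2 b³; smaller cases are evaluated.
cube≤ : ∀ b → b ℕ.* (b ℕ.* (b ℕ.* 1)) ℕ.≤ 4 ℕ.* 2 ℕ.^ b
cube≤ 0 = z≤n
cube≤ 1 = ℕₚ.≤ᵇ⇒≤ 1 8 tt
cube≤ 2 = ℕₚ.≤ᵇ⇒≤ 8 16 tt
cube≤ 3 = ℕₚ.≤ᵇ⇒≤ 27 32 tt
cube≤ (suc (suc (suc (suc d)))) = go d
  where
  open ℕₚ.≤-Reasoning
  cube : ℕ → ℕ
  cube b = b ℕ.* (b ℕ.* (b ℕ.* 1))
  lemma : ∀ d → 2 ℕ.* ((4 ℕ.+ d) ℕ.* ((4 ℕ.+ d) ℕ.* ((4 ℕ.+ d) ℕ.* 1))) ≡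
                (5 ℕ.+ d) ℕ.* ((5 ℕ.+ d) ℕ.* ((5 ℕ.+ d) ℕ.* 1)) ℕ.+ (3 ℕ.+ 21 ℕ.* d ℕ.+ 9 ℕ.* (d ℕ.* d) ℕ.+ d ℕ.* (d ℕ.* d))
  lemma = ℕ-solve
  swap : ∀ x → 2 ℕ.* (4 ℕ.* x) ≡ 4 ℕ.* (2 ℕ.* x)
  swap = ℕ-solve
  go : ∀ d → cube (4 ℕ.+ d) ℕ.≤ 4 ℕ.* 2 ℕ.^ (4 ℕ.+ d)
  go zero    = ℕₚ.≤-refl {64}
  go (suc d) = begin
    cube (5 ℕ.+ d)                        ≤⟨ ℕₚ.m≤m+n _ _ ⟩
    cube (5 ℕ.+ d) ℕ.+ _                  ≡⟨ lemma d ⟨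
    2 ℕ.* cube (4 ℕ.+ d)                  ≤⟨ ℕₚ.*-monoʳ-≤ 2 (go d) ⟩
    2 ℕ.* (4 ℕ.* 2 ℕ.^ (4 ℕ.+ d))         ≡⟨ swap (2 ℕ.^ (4 ℕ.+ d)) ⟩
    4 ℕ.* 2 ℕ.^ (5 ℕ.+ d)                 ∎

-- From the number of buckets to logarithms

fromℕ-^ : ∀ j k → fromℕ (j ℕ.^ k) ≡ fromℕ j ^ k
fromℕ-^ j zero    = refl
fromℕ-^ j (suc k) = trans (fromℕ-* j (j ℕ.^ k)) (cong (fromℕ j *_) (fromℕ-^ j k))

-- An instance of `exponent-bound` with both bases 2 and exponent 1: the factor 2 lost in padding is
-- the base itself and adds 1 to the logarithm.
level-bound : ∀ {p} m a → MaxOneLog≤ (fromℕ 2) (fromℕ m) p → 2 ℕ.^ a ℕ.≤ 2 ℕ.* m → fromℕ a ≤ 1ℚ + p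
level-bound {p} m a log ≤2m = subst (fromℕ a ≤_) (ℚₚ.*-identityˡ (1ℚ + p))
  (exponent-bound {fromℕ 2} {fromℕ m} {p} {fromℕ 2} 1 a (0≤fromℕ 2) (ℚ.*<* (ℤ.+<+ (s≤s (s≤s z≤n)))) ℚₚ.≤-refl log (0≤fromℕ m)
    (subst₂ _≤_ (fromℕ-^ 2 a) (fromℕ-* 2 m) (fromℕ-mono ≤2m)))

1≤* : ∀ {x y} → 1ℚ ≤ x → 1ℚ ≤ y → 1ℚ ≤ x * y
1≤* 1≤x 1≤y = *-mono (ℚₚ.≤-trans 0≤1 1≤x) 0≤1 1≤x 1≤y

4ℚ : ℚ
4ℚ = 1ℚ + 1ℚ + 1ℚ + 1ℚ

0≤4 : 0ℚ ≤ 4ℚ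
0≤4 = 0≤fromℕ 4

-- A sum of terms is traded for a product of factors that are at least 1. This separates log m,
-- which belongs to the final bound, from `b`, whose cube is absorbed by n.
depth-bound : ∀ {a b p} → 1ℚ ≤ p → 1ℚ ≤ b → a ≤ 1ℚ + p → 1ℚ + (a + b) ≤ 4ℚ * (p * b)
depth-bound {a} {b} {p} 1≤p 1≤b a≤ = ≤-by
  ((1ℚ + p - a) + (4ℚ * ((p - 1ℚ) * (b - 1ℚ)) + ((1ℚ + 1ℚ + 1ℚ) * (p - 1ℚ) + (1ℚ + 1ℚ + 1ℚ) * (b - 1ℚ))))
  (0≤+ (0≤- a≤) (0≤+ (0≤* 0≤4 (0≤* (0≤- 1≤p) (0≤- 1≤b))) (0≤+ (0≤* (0≤fromℕ 3) (0≤- 1≤p)) (0≤* (0≤fromℕ 3) (0≤- 1≤b)))))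
  (lemma a b p)
  where
  lemma : ∀ a b p → (1ℚ + 1ℚ + 1ℚ + 1ℚ) * (p * b) ≡ 1ℚ + (a + b) +
    ((1ℚ + p - a) + ((1ℚ + 1ℚ + 1ℚ + 1ℚ) * ((p - 1ℚ) * (b - 1ℚ)) + ((1ℚ + 1ℚ + 1ℚ) * (p - 1ℚ) + (1ℚ + 1ℚ + 1ℚ) * (b - 1ℚ))))
  lemma = ring-solve ℚ-ring

buckets-bound : ∀ {k y q} → 1ℚ ≤ y → 1ℚ ≤ q → k ≤ y * (1ℚ + q) → 1ℚ + (1ℚ + k) ≤ 4ℚ * (y * q)
buckets-bound {k} {y} {q} 1≤y 1≤q k≤ = ≤-by
  ((y * (1ℚ + q) - k) + ((1ℚ + 1ℚ + 1ℚ) * ((y - 1ℚ) * (q - 1ℚ)) + ((1ℚ + 1ℚ) * (y - 1ℚ) + (1ℚ + 1ℚ + 1ℚ) * (q - 1ℚ))))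
  (0≤+ (0≤- k≤) (0≤+ (0≤* (0≤fromℕ 3) (0≤* (0≤- 1≤y) (0≤- 1≤q))) (0≤+ (0≤* (0≤fromℕ 2) (0≤- 1≤y)) (0≤* (0≤fromℕ 3) (0≤- 1≤q)))))
  (lemma k y q)
  where
  lemma : ∀ k y q → (1ℚ + 1ℚ + 1ℚ + 1ℚ) * (y * q) ≡ 1ℚ + (1ℚ + k) +
    ((y * (1ℚ + q) - k) + ((1ℚ + 1ℚ + 1ℚ) * ((y - 1ℚ) * (q - 1ℚ)) + ((1ℚ + 1ℚ) * (y - 1ℚ) + (1ℚ + 1ℚ + 1ℚ) * (q - 1ℚ))))
  lemma = ring-solve ℚ-ring

module Counting (I : Instance) (ε : ℚ) (0<ε : 0ℚ < ε) (E-1 c : ℕ) (1+ε≤c : 1ℚ + ε ≤ fromℕ c)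
  (bc : BucketCount I ε (suc E-1)) where

  open Instance I
  open Ratio ε 0<ε E-1

  -- Powers within the relaxed capacity satisfy ρᵏ ≤ (1 + ε) B / wₘ. The factor 1 + ε is the base of
  -- the logarithm, so it contributes the 1 in `1ℚ + q`.
  exponent-count : ∀ {wₘ q x} → 0ℚ < wₘ → (∀ i j → 0ℚ < w i j → wₘ ≤ w i j) → x * wₘ ≡ B →
    MaxOneLog≤ (1ℚ + ε) x q → ∀ k → k ℕ.< BucketCount.k bc → fromℕ k ≤ fromℕ (c ℕ.* E) * (1ℚ + q)
  exponent-count {wₘ} {q} {x} 0<wₘ minimal xw≡B log k k< = exponent-bound {1ℚ + ε} {x} {q} {ρ} (c ℕ.* E) k (ℚₚ.<⇒≤ 0<1+ε) 1<ρ
    -- Nonnegativity of `x` is read off from `power≤`, whose left side is nonnegative.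
    (≤ρᶜᴱ c 1+ε≤c) log (*-cancelˡ (1ℚ + ε) 0<1+ε (subst (_≤ (1ℚ + ε) * x) (sym (ℚₚ.*-zeroʳ (1ℚ + ε)))
      (ℚₚ.≤-trans (0≤^ (ℚₚ.≤-trans 0≤1 1≤ρ) k) power≤))) power≤
    where
    open ℚₚ.≤-Reasoning
    open BucketCount bc using (μ; 0<μ; attained; within)
    wₘ≤μ : wₘ ≤ μ
    wₘ≤μ = subst (wₘ ≤_) (proj₂ (proj₂ attained))
      (minimal (proj₁ attained) (proj₁ (proj₂ attained)) (subst (0ℚ <_) (sym (proj₂ (proj₂ attained))) 0<μ))
    power≤ : ρ ^ k ≤ (1ℚ + ε) * x
    power≤ = *-cancelˡ wₘ 0<wₘ (begin
      wₘ * ρ ^ k                 ≤⟨ *-monoʳ (ρ ^ k) (0≤^ (ℚₚ.≤-trans 0≤1 1≤ρ) k) wₘ≤μ ⟩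
      μ * ρ ^ k                  ≤⟨ within k k< ⟩
      (1ℚ + ε) * B               ≡⟨ cong ((1ℚ + ε) *_) xw≡B ⟨
      (1ℚ + ε) * (x * wₘ)        ≡⟨ lemma (1ℚ + ε) x wₘ ⟩
      wₘ * ((1ℚ + ε) * x)        ∎)
      where
      lemma : ∀ e x w → e * (x * w) ≡ w * (e * x)
      lemma = ring-solve ℚ-ring

  count≤ : ∀ {wₘ q x} → 0ℚ < wₘ → (∀ i j → 0ℚ < w i j → wₘ ≤ w i j) → x * wₘ ≡ B →
    MaxOneLog≤ (1ℚ + ε) x q → 1 ℕ.≤ c → fromℕ (suc (BucketCount.k bc)) ≤ 4ℚ * (fromℕ (c ℕ.* E) * q)
  count≤ {wₘ} {q} {x} 0<wₘ minimal xw≡B log 1≤c = go (BucketCount.k bc) refl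
    where
    1≤q : 1ℚ ≤ q
    1≤q = MaxOneLog≤.one≤ log
    1≤cE : 1ℚ ≤ fromℕ (c ℕ.* E)
    1≤cE = 1≤fromℕ {c ℕ.* E} (ℕₚ.*-mono-≤ 1≤c (s≤s (z≤n {E-1})))
    go : ∀ k → BucketCount.k bc ≡ k → fromℕ (suc k) ≤ 4ℚ * (fromℕ (c ℕ.* E) * q)
    go zero    _  = 1≤* {4ℚ} (1≤fromℕ {4} (s≤s z≤n)) (1≤* 1≤cE 1≤q)
    -- Only exponents below the count are known to stay within the capacity, so the bound is applied
    -- to its predecessor; the number of buckets exceeds that by 2.
    go (suc k) k≡ = subst (_≤ 4ℚ * (fromℕ (c ℕ.* E) * q)) (sym (trans (fromℕ-suc (suc k)) (cong (_+_ 1ℚ) (fromℕ-suc k))))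
      (buckets-bound 1≤cE 1≤q (exponent-count 0<wₘ minimal xw≡B log k (subst (k ℕ.<_) (sym k≡) (ℕₚ.n<1+n k))))

-- The steps are multiplied by ε to match the factor 1 / ε of the claim, and ε ≤ e₀ moves this
-- factor into the constant. The cube of `b` left over from K³ becomes the second factor n.
combine : ∀ {T d m n K cc e₀ b : ℕ} {p q ε} → T ℕ.≤ d ℕ.* (m ℕ.* (n ℕ.* K ℕ.^ 3)) →
  fromℕ K ≤ fromℕ cc * (p * fromℕ b * q) → b ℕ.^ 3 ℕ.≤ 8 ℕ.* n → 0ℚ ≤ p → 0ℚ ≤ q → 0ℚ ≤ ε → ε ≤ fromℕ e₀ →
  fromℕ T * ε ≤ fromℕ (d ℕ.* (cc ℕ.^ 3 ℕ.* 8) ℕ.* e₀) * (fromℕ n ^ 2 * fromℕ m * p ^ 3 * q ^ 3)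
combine {T} {d} {m} {n} {K} {cc} {e₀} {b} {p} {q} {ε} T≤ K≤ b³≤ 0≤p 0≤q 0≤ε ε≤ = begin
  fromℕ T * ε
    ≤⟨ *-mono (0≤fromℕ (d ℕ.* (m ℕ.* (n ℕ.* K ℕ.^ 3)))) 0≤ε (fromℕ-mono T≤) ε≤ ⟩
  fromℕ (d ℕ.* (m ℕ.* (n ℕ.* K ℕ.^ 3))) * E₀
    ≡⟨ cong (_* E₀) (trans (fromℕ-* d _) (cong (D *_) (trans (fromℕ-* m _) (cong (M *_) (trans (fromℕ-* n _) (cong (N *_) (fromℕ-^ K 3))))))) ⟩
  D * (M * (N * fromℕ K ^ 3)) * E₀
    ≤⟨ *-monoʳ E₀ (0≤fromℕ e₀) (*-monoˡ D (0≤fromℕ d) (*-monoˡ M (0≤fromℕ m) (*-monoˡ N (0≤fromℕ n) (^-monoˡ (0≤fromℕ K) K≤ 3)))) ⟩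
  D * (M * (N * (CC * (p * Β * q)) ^ 3)) * E₀
    ≡⟨ regroup D M N CC p Β q E₀ ⟩
  D * (M * (N * (CC ^ 3 * p ^ 3 * q ^ 3))) * E₀ * Β ^ 3
    ≤⟨ *-monoˡ (D * (M * (N * (CC ^ 3 * p ^ 3 * q ^ 3))) * E₀)
         (0≤* (0≤* (0≤fromℕ d) (0≤* (0≤fromℕ m) (0≤* (0≤fromℕ n) (0≤* (0≤* (0≤^ (0≤fromℕ cc) 3) (0≤^ 0≤p 3)) (0≤^ 0≤q 3))))) (0≤fromℕ e₀))
         (subst₂ _≤_ (fromℕ-^ b 3) (fromℕ-* 8 n) (fromℕ-mono b³≤)) ⟩
  D * (M * (N * (CC ^ 3 * p ^ 3 * q ^ 3))) * E₀ * (fromℕ 8 * N)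
    ≡⟨ regroup′ D M N (CC ^ 3) (p ^ 3) (q ^ 3) E₀ (fromℕ 8) ⟩
  D * (CC ^ 3 * fromℕ 8) * E₀ * (N ^ 2 * M * p ^ 3 * q ^ 3)
    ≡⟨ cong (_* (N ^ 2 * M * p ^ 3 * q ^ 3)) (sym (trans (fromℕ-* (d ℕ.* (cc ℕ.^ 3 ℕ.* 8)) e₀)
         (cong (_* E₀) (trans (fromℕ-* d _) (cong (D *_) (trans (fromℕ-* (cc ℕ.^ 3) 8) (cong (_* fromℕ 8) (fromℕ-^ cc 3)))))))) ⟩
  fromℕ (d ℕ.* (cc ℕ.^ 3 ℕ.* 8) ℕ.* e₀) * (N ^ 2 * M * p ^ 3 * q ^ 3) ∎
  where
  open ℚₚ.≤-Reasoning
  D M N CC Β E₀ : ℚ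
  D  = fromℕ d
  M  = fromℕ m
  N  = fromℕ n
  CC = fromℕ cc
  Β  = fromℕ b
  E₀ = fromℕ e₀
  expand : ∀ D M N X Y E₀ → D * (M * (N * (X * Y))) * E₀ ≡ D * (M * (N * X)) * E₀ * Y
  expand = ring-solve ℚ-ring
  cube-* : ∀ c p b q → (c * (p * b * q)) ^ 3 ≡ c ^ 3 * p ^ 3 * q ^ 3 * b ^ 3
  cube-* c p b q = trans (*-^ c (p * b * q) 3) (trans (cong (c ^ 3 *_) (trans (*-^ (p * b) q 3) (cong (_* q ^ 3) (*-^ p b 3))))
    (lemma (c ^ 3) (p ^ 3) (b ^ 3) (q ^ 3)))
    where
    lemma : ∀ c p b q → c * (p * b * q) ≡ c * p * q * b
    lemma = ring-solve ℚ-ring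
  regroup : ∀ D M N c p b q E₀ → D * (M * (N * (c * (p * b * q)) ^ 3)) * E₀ ≡ D * (M * (N * (c ^ 3 * p ^ 3 * q ^ 3))) * E₀ * b ^ 3
  regroup D M N c p b q E₀ = trans (cong (λ x → D * (M * (N * x)) * E₀) (cube-* c p b q)) (expand D M N (c ^ 3 * p ^ 3 * q ^ 3) (b ^ 3) E₀)
  regroup′ : ∀ D M N c p q E₀ e → D * (M * (N * (c * p * q))) * E₀ * (e * N) ≡ D * (c * e) * E₀ * (N * (N * 1ℚ) * M * p * q)
  regroup′ = ring-solve ℚ-ring

-- 4110 steps per unit of m n K³; 16 = 4 · 4 from `depth-bound` and `buckets-bound`; `suc e₀` is the
-- c ≥ 1 + ε of the conversion between bases; 8 comes from b³ ≤ 4 · 2ᵇ ≤ 8 n; the last `e₀` bounds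
-- ε.
constant : ℕ → ℕ
constant e₀ = 4110 ℕ.* ((16 ℕ.* suc e₀) ℕ.^ 3 ℕ.* 8) ℕ.* e₀

module Timing (I : Instance) (ε : ℚ) .{{_ : Positive ε}} (feasible : ∃[ S ] Instance.Feasible I S)
  (e₀ : ℕ) (ε≤ : ε ≤ fromℕ e₀) where

  open Instance I
  open Whole I ε (ℚₚ.positive⁻¹ ε) feasible

  c : ℕ
  c = suc e₀

  1+ε≤c : 1ℚ + ε ≤ fromℕ c
  1+ε≤c = subst (1ℚ + ε ≤_) (sym (fromℕ-suc e₀)) (ℚₚ.+-monoʳ-≤ 1ℚ ε≤)

  total : Sizes → ℕ
  total s = paddingTime m n ℕ.+ Sizes.time s

  total≤ : ∀ s {wₘ p q x} → 0ℚ < wₘ → (∀ i j → 0ℚ < w i j → wₘ ≤ w i j) → x * wₘ ≡ B →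
    MaxOneLog≤ (fromℕ 2) (fromℕ m) p → MaxOneLog≤ (1ℚ + ε) x q →
    fromℕ (total s) * ε ≤ fromℕ (constant e₀) * (fromℕ n ^ 2 * fromℕ m * p ^ 3 * q ^ 3)
  total≤ s {wₘ} {p} {q} {x} 0<wₘ minimal xw≡B logp logq = combine {total s} {4110} {m} {n} {suc k} {16 ℕ.* c} {e₀} {b}
    (Bounded.time≤ m n a b k 1≤m 1≤n ≤2m ≤2n) K≤
    (ℕₚ.≤-trans (cube≤ b) (ℕₚ.≤-trans (ℕₚ.*-monoʳ-≤ 4 ≤2n) (ℕₚ.≤-reflexive (sym (ℕₚ.*-assoc 4 2 n)))))
    (ℚₚ.≤-trans 0≤1 1≤p) (ℚₚ.≤-trans 0≤1 1≤q) (ℚₚ.<⇒≤ (ℚₚ.positive⁻¹ ε)) ε≤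
    where
    open Sizes s
    open Padded padded
    k = BucketCount.k buckets
    E = suc (a ℕ.+ b)
    1≤p : 1ℚ ≤ p
    1≤p = MaxOneLog≤.one≤ logp
    1≤q : 1ℚ ≤ q
    1≤q = MaxOneLog≤.one≤ logq
    open ℚₚ.≤-Reasoning
    E≤ : fromℕ E ≤ 4ℚ * (p * fromℕ b)
    E≤ = subst (_≤ 4ℚ * (p * fromℕ b)) (sym (trans (fromℕ-suc (a ℕ.+ b)) (cong (_+_ 1ℚ) (fromℕ-+ a b))))
      (depth-bound 1≤p (1≤fromℕ 1≤b) (level-bound m a logp ≤2m))
    lemma : ∀ f c p b q → f * (c * (f * (p * b)) * q) ≡ f * f * c * (p * b * q)
    lemma = ring-solve ℚ-ring
    K≤ : fromℕ (suc k) ≤ fromℕ (16 ℕ.* c) * (p * fromℕ b * q)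
    K≤ = begin
      fromℕ (suc k)                                          ≤⟨ Counting.count≤ I ε (ℚₚ.positive⁻¹ ε) (a ℕ.+ b) c 1+ε≤c buckets
                                                                  0<wₘ minimal xw≡B logq (s≤s z≤n) ⟩
      4ℚ * (fromℕ (c ℕ.* E) * q)                             ≡⟨ cong (λ y → 4ℚ * (y * q)) (fromℕ-* c E) ⟩
      4ℚ * (fromℕ c * fromℕ E * q)                           ≤⟨ *-monoˡ 4ℚ 0≤4 (*-monoʳ q (ℚₚ.≤-trans 0≤1 1≤q) (*-monoˡ (fromℕ c) (0≤fromℕ c) E≤)) ⟩
      4ℚ * (fromℕ c * (4ℚ * (p * fromℕ b)) * q)              ≡⟨ lemma 4ℚ (fromℕ c) p (fromℕ b) q ⟩
      4ℚ * 4ℚ * fromℕ c * (p * fromℕ b * q)                  ≡⟨ cong (_* (p * fromℕ b * q)) (fromℕ-* 16 c) ⟨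
      fromℕ (16 ℕ.* c) * (p * fromℕ b * q)                   ∎

÷-intro : ∀ {x y ε} .{{_ : Positive ε}} → x * ε ≤ y → x ≤ (y ÷ ε) {{ℚₚ.pos⇒nonZero ε}}
÷-intro {x} {y} {ε} xε≤y = ℚₚ.*-cancelʳ-≤-pos ε (subst (x * ε ≤_) (sym (÷-* y ε {{ℚₚ.pos⇒nonZero ε}})) xε≤y)

program-solves : ∀ e₀ ε .{{_ : Positive ε}} → ε ≤ fromℕ e₀ → Solves (constant e₀) ε (program ε)
program-solves e₀ ε ε≤ I feasible = conclude (Whole.run-program I ε (ℚₚ.positive⁻¹ ε) feasible)
  where
  open Instance I
  open Whole I ε (ℚₚ.positive⁻¹ ε) feasible
  open Timing I ε feasible e₀ ε≤
  conclude : Σ[ s ∈ Sizes ] Run (program ε) (input I) (total s) Approximates →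
             ∃[ M ] ∃[ t ] (⟨ program ε , input I ⟩⇓⟨ M , t ⟩ × IsApproximateSolution ε (output I M) × WithinTime (constant e₀) ε I t)
  conclude (s , M , t , D , t≤ , ok) = M , t , D , ok , within
    where
    within : WithinTime (constant e₀) ε I t
    within wₘ min p q logp logq = ÷-intro (ℚₚ.≤-trans (*-monoʳ ε (ℚₚ.<⇒≤ (ℚₚ.positive⁻¹ ε)) (fromℕ-mono t≤))
      (total≤ s 0<wₘ (IsMinPositiveWeight.minimal min) (÷-* B wₘ {{ℚₚ.pos⇒nonZero wₘ {{IsMinPositiveWeight.positive min}}}}) logp logq))
      where
      0<wₘ : 0ℚ < wₘ
      0<wₘ = ℚₚ.positive⁻¹ wₘ {{IsMinPositiveWeight.positive min}}

theorem3p7 : (ε₀ : ℚ) → .{{_ : Positive ε₀}} →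
    Σ[ C ∈ ℕ ] ((ε : ℚ) → .{{_ : Positive ε}} → ε ≤ ε₀ →
    Σ[ P ∈ Program ] Solves C ε P)
theorem3p7 ε₀ = constant ∣ ↥ ε₀ ∣ , λ ε ε≤ε₀ → program ε , program-solves ∣ ↥ ε₀ ∣ ε (ℚₚ.≤-trans ε≤ε₀ (p≤fromℕ ε₀))
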